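{- There exists a polynomial time algorithm that takes as input a $(1-\epsilon)$-partially $2$-colorable graph $G=(V,E)$ on $n=|V|$ vertices and any fixed choice of $\gamma\in[\epsilon,1/100]$, and produces a set $S\subset V$ such that $|S|\le (4\epsilon/\gamma)|V|$ and a proper coloring of the induced subgraph $G[V\setminus S]$ using $\tilde{O}(n^{2\gamma})$ colors.
   Context: An undirected graph $G=(V,E)$ is $\alpha$-partially $k$-colorable if there exists a subset $V_{\rm good}\subset V$ with $|V_{\rm good}|\ge \alpha|V|$ such that the induced subgraph $G[V_{\rm good}]$ is $k$-colorable. The set $V_{\rm good}$ is not given to the algorithm. $\tilde{O}(\cdot)$ hides factors polylogarithmic in $n$.
   Formalization: The parameters ε and γ are taken to be rational numbers instead of real numbers. -}

module Defs where

open import Data.Bool using (Bool; true; false; T; _∧_; if_then_else_)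
open import Data.Fin using (Fin; toℕ; fromℕ<; remQuot)
open import Data.Fin.Subset using (Subset; _∈_; ∣_∣)
open import Data.Integer as ℤ using (+_)
open import Data.Nat
open import Data.Nat.Logarithm using (⌊log₂_⌋)
open import Data.Product using (_×_; _,_; ∃-syntax)
open import Data.Rational as ℚ using (ℚ; ↥_; ↧ₙ_)
open import Data.Vec using (lookup)
open import Relation.Binary.PropositionalEquality using (_≡_; _≢_)
open import Relation.Nullary using (yes; no)

-- Finite simple graphs with vertex set Fin n.

record Graph (n : ℕ) : Set where
  field
    adj       : Fin n → Fin n → Bool
    symmetric : ∀ u v → adj u v ≡ adj v u
    loopless  : ∀ v → adj v v ≡ false

-- Only the values of c on W matter, so this is a proper colouring of the
-- induced subgraph G[W] with the k colours 0, …, k-1.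

IsProperColoring : ∀ {n} → Graph n → Subset n → ℕ → (Fin n → ℕ) → Set
IsProperColoring G W k c =
    (∀ v → v ∈ W → c v < k)
  × (∀ u v → u ∈ W → v ∈ W → T (Graph.adj G u v) → c u ≢ c v)

fromℕ : ℕ → ℚ
fromℕ m = + m ℚ./ 1

PartiallyColorable : ∀ {n} → ℚ → ℕ → Graph n → Set
PartiallyColorable {n} α k G =
  ∃[ Good ] α ℚ.* fromℕ n ℚ.≤ fromℕ ∣ Good ∣
          × (∃[ c ] IsProperColoring G Good k c)

-- k ≤ A · n^δ for a non-negative rational exponent δ = a/b, with both sides
-- raised to the power b to avoid irrational numbers.

_≤_·_^_ : ℕ → ℕ → ℕ → ℚ → Set
k ≤ A · n ^ δ = (k ^ ↧ₙ δ) ≤ (A ^ ↧ₙ δ) * (n ^ ℤ.∣ ↥ δ ∣)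

-- A random access machine, presented as a while-language over finitely many
-- ℕ-indexed arrays of natural numbers: store σ has σ a i in cell i of array a,
-- and array names are fixed in the program text.  Every assignment and every
-- test costs one step.  A program has only finitely many, fixed expressions,
-- and these use only addition and truncated subtraction (no multiplication),
-- so a step lengthens the binary representation of the largest number present
-- by at most a constant.  Hence polynomial time here coincides with polynomial
-- time on Turing machines (Cook and Reckhow, "Time bounded random access
-- machines", 1973).

Store : Set
Store = ℕ → ℕ → ℕ

infixl 6 _⊕_ _⊖_
infix  5 _[_]
infix  4 _[_]≔_
infixr 3 _⨟_

data Expr : Set where
  lit     : ℕ → Expr
  _[_]    : ℕ → Expr → Expr
  _⊕_ _⊖_ : Expr → Expr → Expr

⟦_⟧ : Expr → Store → ℕ
⟦ lit m ⟧   σ = m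
⟦ a [ e ] ⟧ σ = σ a (⟦ e ⟧ σ)
⟦ e ⊕ f ⟧   σ = ⟦ e ⟧ σ + ⟦ f ⟧ σ
⟦ e ⊖ f ⟧   σ = ⟦ e ⟧ σ ∸ ⟦ f ⟧ σ

data Program : Set where
  skip    : Program
  _[_]≔_  : ℕ → Expr → Expr → Program
  _⨟_     : Program → Program → Program
  cond    : Expr → Program → Program → Program
  while   : Expr → Program → Program

update : Store → ℕ → ℕ → ℕ → Store
update σ a i m b j = if (b ≡ᵇ a) ∧ (j ≡ᵇ i) then m else σ b j

-- P ⊢ σ ⇓ τ in-time t : started in store σ, P halts in store τ after t steps.
-- A test succeeds when its value is nonzero.

infix 2 _⊢_⇓_in-time_

data _⊢_⇓_in-time_ : Program → Store → Store → ℕ → Set where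
  run-skip   : ∀ {σ} → skip ⊢ σ ⇓ σ in-time 1
  run-assign : ∀ {a e f σ} →
               (a [ e ]≔ f) ⊢ σ ⇓ update σ a (⟦ e ⟧ σ) (⟦ f ⟧ σ) in-time 1
  run-seq    : ∀ {P Q σ τ υ s t} →
               P ⊢ σ ⇓ τ in-time s → Q ⊢ τ ⇓ υ in-time t →
               (P ⨟ Q) ⊢ σ ⇓ υ in-time (s + t)
  cond-true  : ∀ {e P Q σ τ t} → ⟦ e ⟧ σ ≢ 0 → P ⊢ σ ⇓ τ in-time t →
               cond e P Q ⊢ σ ⇓ τ in-time suc t
  cond-false : ∀ {e P Q σ τ t} → ⟦ e ⟧ σ ≡ 0 → Q ⊢ σ ⇓ τ in-time t →
               cond e P Q ⊢ σ ⇓ τ in-time suc t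
  while-stop : ∀ {e P σ} → ⟦ e ⟧ σ ≡ 0 →
               while e P ⊢ σ ⇓ σ in-time 1
  while-step : ∀ {e P σ τ υ s t} → ⟦ e ⟧ σ ≢ 0 →
               P ⊢ σ ⇓ τ in-time s → while e P ⊢ τ ⇓ υ in-time t →
               while e P ⊢ σ ⇓ υ in-time suc (s + t)

-- Input format: array 0 starts with n and the numerator and denominator of γ;
-- array 1 starts with the adjacency matrix in row-major order; every other
-- cell is 0.

bit : Bool → ℕ
bit b = if b then 1 else 0

adjacencyCell : ∀ {n} → Graph n → ℕ → ℕ
adjacencyCell {n} G i with i <? n * n
... | yes i<n² = let (u , v) = remQuot {n} n (fromℕ< i<n²) in bit (Graph.adj G u v)
... | no  _    = 0

encode : ∀ {n} → Graph n → ℚ → Store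
encode {n} G γ 0 0 = n
encode     G γ 0 1 = ℤ.∣ ↥ γ ∣
encode     G γ 0 2 = ↧ₙ γ
encode     G γ 1 i = adjacencyCell G i
encode     G γ _ _ = 0

-- Bit length of the input; in particular γ counts with its binary length.

bitLength : ℕ → ℕ
bitLength m = 1 + ⌊log₂ m ⌋

inputSize : ℕ → ℚ → ℕ
inputSize n γ = n * n + bitLength n + bitLength ℤ.∣ ↥ γ ∣ + bitLength (↧ₙ γ)

RunsInPolynomialTime : Program → Set
RunsInPolynomialTime P =
  ∃[ A ] ∃[ d ] (∀ {n} (G : Graph n) (γ : ℚ) .{{_ : ℚ.Positive γ}} →
    ∃[ τ ] ∃[ t ] (P ⊢ encode G γ ⇓ τ in-time t) × t ≤ A * (inputSize n γ ^ d))

-- Output format: on halting, array 2 holds the indicator vector of S and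
-- array 3 the colours (whose values at vertices of S are to be ignored).

Outputs : ∀ {n} → Program → Graph n → ℚ → Subset n → (Fin n → ℕ) → Set
Outputs P G γ S c =
  ∃[ τ ] ∃[ t ] (P ⊢ encode G γ ⇓ τ in-time t)
              × (∀ v → τ 2 (toℕ v) ≡ bit (lookup S v))
              × (∀ v → τ 3 (toℕ v) ≡ c v)

{-# OPTIONS --safe #-}

-- Let k be about 1 / γ and q about n^(1/k).  Grow a tree from a vertex v, level
-- by level, until the ball of radius r + 1 is at most q times as large as the
-- ball of radius r; since q^k ≥ n this happens for some r < k.  If two adjacent
-- vertices of the inner ball have the same parity, their tree paths to v
-- together with that edge form a closed odd walk on at most 2k vertices.  It
-- contains a bad vertex, so deleting all of it is affordable: at most 2k ≤ 4 / γ
-- deletions are charged to each bad vertex.  Otherwise colour the inner ball by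
-- parity, with two colours reserved for the current phase, and put the boundary
-- off to the next phase, so that no edge joins two balls of the same phase.
-- Each phase settles a 1/q fraction of the remaining vertices, hence
-- q (1 + log n) phases suffice.

module Submission where

-- The machine cannot multiply, and its programs need not halt. The program is therefore written in
-- a sublanguage whose only loop runs exactly `n` times: its meaning is a total function on stores,
-- and its running time can be read off its syntax. A shorter loop is a full loop with a guard. This
-- is why `k` is capped at `n` and why `n` phases are run, although only the first `q * L` of them,
-- with `L` about log n, can assign colours. The charging is sound because a tree consists of active
-- vertices, none of them deleted before: each deleted walk contains a bad vertex that no earlier
-- deletion has taken. Rounding 1 / γ up to an integer at most doubles it, whence 2k ≤ 4 / γ. The
-- radius test compares the larger ball with the next power of `q`, not with `q` times the smaller
-- ball. The tests already passed bound the smaller ball from below by the previous power, so the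
-- required ratio follows.

open import Defs

-- A language of bounded loops: semantics, loop rules, running time.

module Language where

  open import Data.Bool using (Bool; true; false; _∨_; _∧_; not; if_then_else_)
  open import Data.Bool.Properties using (∨-conicalˡ; ∨-conicalʳ; ∧-conicalˡ; ∧-conicalʳ; not-injective)
  open import Data.Empty using (⊥-elim)
  open import Data.List using (List; []; _∷_)
  open import Data.List.Relation.Unary.All using (All; []; _∷_)
  open import Data.Nat
  open import Data.Nat.Properties
  open import Data.Product using (_×_; _,_; proj₁; proj₂; ∃-syntax)
  open import Data.Sum using (inj₁; inj₂)
  open import Relation.Binary.PropositionalEquality hiding ([_])
  open import Relation.Nullary using (¬_)

  data Cmd : Set where
    skip   : Cmd
    _[_]≔_ : ℕ → Expr → Expr → Cmd
    _⨟_    : Cmd → Cmd → Cmd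
    cond   : Expr → Cmd → Cmd → Cmd
    for    : ℕ → Cmd → Cmd

  infix 9 $_
  infix 8 _!_

  _!_ : ℕ → Expr → Expr
  _!_ = _[_]

  -- Array c is used as a scalar through its cell 0.
  $_ : ℕ → Expr
  $ c = c [ lit 0 ]

  compile : Cmd → Program
  compile skip          = skip
  compile (a [ e ]≔ f)  = a [ e ]≔ f
  compile (P ⨟ Q)       = compile P ⨟ compile Q
  compile (cond e P Q)  = cond e (compile P) (compile Q)
  compile (for c P)     =
    (c [ lit 0 ]≔ lit 0) ⨟
    while ($ 0 ⊖ $ c) (compile P ⨟ (c [ lit 0 ]≔ $ c ⊕ lit 1))

  branch : ∀ {A : Set} → ℕ → A → A → A
  branch zero    x y = y
  branch (suc _) x y = x

  branch-elim : ∀ {A : Set} (Φ : A → Set) m {x y} →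
                (m ≢ 0 → Φ x) → (m ≡ 0 → Φ y) → Φ (branch m x y)
  branch-elim Φ zero    nonzero zero′ = zero′ refl
  branch-elim Φ (suc m) nonzero zero′ = nonzero λ ()

  iterate : ∀ {A : Set} → ℕ → (A → A) → A → A
  iterate zero    f x = x
  iterate (suc m) f x = iterate m f (f x)

  bump : ℕ → Store → Store
  bump c τ = update τ c 0 (τ c 0 + 1)

  -- The number of repetitions is an argument and is not read from the store. This agrees with the
  -- compiled `while` as long as array 0 is never assigned and no loop body assigns its own counter,
  -- the side conditions of `execution`.
  sem : ℕ → Cmd → Store → Store
  sem n skip         σ = σ
  sem n (a [ e ]≔ f) σ = update σ a (⟦ e ⟧ σ) (⟦ f ⟧ σ)
  sem n (P ⨟ Q)      σ = sem n Q (sem n P σ)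
  sem n (cond e P Q) σ = branch (⟦ e ⟧ σ) (sem n P σ) (sem n Q σ)
  sem n (for c P)    σ = iterate n (λ τ → bump c (sem n P τ)) (update σ c 0 0)

  assigns : ℕ → Cmd → Bool
  assigns b skip         = false
  assigns b (a [ e ]≔ f) = b ≡ᵇ a
  assigns b (P ⨟ Q)      = assigns b P ∨ assigns b Q
  assigns b (cond e P Q) = assigns b P ∨ assigns b Q
  assigns b (for c P)    = (b ≡ᵇ c) ∨ assigns b P

  wellFormed : Cmd → Bool
  wellFormed skip         = true
  wellFormed (a [ e ]≔ f) = true
  wellFormed (P ⨟ Q)      = wellFormed P ∧ wellFormed Q
  wellFormed (cond e P Q) = wellFormed P ∧ wellFormed Q
  wellFormed (for c P)    = wellFormed P ∧ not (assigns c P)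

  -- An equality of functions that needs no extensionality: both sides are
  -- instances, up to η, of one function of the Boolean b ≡ᵇ a.
  update-frame : ∀ σ a i m b → (b ≡ᵇ a) ≡ false → update σ a i m b ≡ σ b
  update-frame σ a i m b =
    cong (λ t j → if t ∧ (j ≡ᵇ i) then m else σ b j)

  ≡ᵇ-refl : ∀ m → (m ≡ᵇ m) ≡ true
  ≡ᵇ-refl zero    = refl
  ≡ᵇ-refl (suc m) = ≡ᵇ-refl m

  update-scalar : ∀ σ a m → update σ a 0 m a 0 ≡ m
  update-scalar σ a m rewrite ≡ᵇ-refl a = refl

  iterate-frame : ∀ (f : Store → Store) b → (∀ τ → f τ b ≡ τ b) →
                  ∀ m σ → iterate m f σ b ≡ σ b
  iterate-frame f b h zero    σ = refl
  iterate-frame f b h (suc m) σ = trans (iterate-frame f b h m (f σ)) (h σ)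

  -- Whole arrays are equated as functions, so that an invariant about an array can be moved by
  -- `subst`. The hypothesis is a Boolean computation, hence `refl` on a concrete program.
  frame : ∀ n P σ b → assigns b P ≡ false → sem n P σ b ≡ σ b
  frame n skip         σ b h = refl
  frame n (a [ e ]≔ f) σ b h = update-frame σ a (⟦ e ⟧ σ) (⟦ f ⟧ σ) b h
  frame n (P ⨟ Q)      σ b h =
    trans (frame n Q (sem n P σ) b (∨-conicalʳ (assigns b P) _ h))
          (frame n P σ b (∨-conicalˡ _ _ h))
  frame n (cond e P Q) σ b h with ⟦ e ⟧ σ
  ... | zero  = frame n Q σ b (∨-conicalʳ (assigns b P) _ h)
  ... | suc _ = frame n P σ b (∨-conicalˡ _ _ h)
  frame n (for c P)    σ b h =
    trans (iterate-frame _ b body n (update σ c 0 0)) (update-frame σ c 0 0 b b≢c)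
    where
    b≢c : (b ≡ᵇ c) ≡ false
    b≢c = ∨-conicalˡ _ _ h
    body : ∀ τ → bump c (sem n P τ) b ≡ τ b
    body τ = trans (update-frame (sem n P τ) c 0 _ b b≢c)
                   (frame n P τ b (∨-conicalʳ (b ≡ᵇ c) _ h))

  for-induction : ∀ n c P σ (I : ℕ → Store → Set) → assigns c P ≡ false →
    I 0 (update σ c 0 0) →
    (∀ i τ → i < n → τ c 0 ≡ i → I i τ → I (suc i) (bump c (sem n P τ))) →
    I n (sem n (for c P) σ)
  for-induction n c P σ I h start step =
    go n 0 _ refl (update-scalar σ c 0) start
    where
    go : ∀ m i τ → i + m ≡ n → τ c 0 ≡ i → I i τ →
         I n (iterate m (λ τ → bump c (sem n P τ)) τ)
    go zero    i τ eq _  inv = subst (λ j → I j τ) (trans (sym (+-identityʳ i)) eq) inv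
    go (suc m) i τ eq ci inv = go m (suc i) _ eq′ ci′ (step i τ i<n ci inv)
      where
      eq′ : suc i + m ≡ n
      eq′ = trans (sym (+-suc i m)) eq
      i<n : i < n
      i<n = subst (suc i ≤_) eq′ (m≤m+n (suc i) m)
      ci′ : bump c (sem n P τ) c 0 ≡ suc i
      ci′ = trans (update-scalar (sem n P τ) c _)
           (trans (+-comm _ 1)
           (cong suc (trans (cong (λ f → f 0) (frame n P τ c h)) ci)))

  -- For loops that treat one index per round: round `i` establishes `Q i`, the other rounds must
  -- preserve it, and `K` holds throughout. Both must tolerate a change of the counter, because
  -- `bump` follows every round.
  for-each : ∀ n c P σ (K : Store → Set) (Q : ℕ → Store → Set) →
    assigns c P ≡ false →
    (∀ τ v → K τ → K (update τ c 0 v)) →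
    (∀ τ v i → Q i τ → Q i (update τ c 0 v)) →
    K σ →
    (∀ τ → τ c 0 < n → K τ → K (sem n P τ) × Q (τ c 0) (sem n P τ) ×
                             (∀ i → i < n → Q i τ → Q i (sem n P τ))) →
    K (sem n (for c P) σ) × (∀ i → i < n → Q i (sem n (for c P) σ))
  for-each n c P σ K Q h K-counter Q-counter k step =
    for-induction n c P σ (λ i τ → K τ × (∀ j → j < i → Q j τ)) h
      (K-counter _ _ k , λ _ ())
      body
    where
    body : ∀ i τ → i < n → τ c 0 ≡ i → K τ × (∀ j → j < i → Q j τ) →
           K (bump c (sem n P τ)) × (∀ j → j < suc i → Q j (bump c (sem n P τ)))
    body .(τ c 0) τ i<n refl (kτ , qτ) = K-counter _ _ (proj₁ s) , next
      where
      s = step τ i<n kτ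
      next : ∀ j → j < suc (τ c 0) → Q j (bump c (sem n P τ))
      next j (s≤s j≤i) with m≤n⇒m<n∨m≡n j≤i
      ... | inj₁ j<i  = Q-counter _ _ _ (proj₂ (proj₂ s) j (<-trans j<i i<n) (qτ j j<i))
      ... | inj₂ refl = Q-counter _ _ _ (proj₁ (proj₂ s))

  for-each₂ : ∀ n c d P σ (K : Store → Set) (Q : ℕ → ℕ → Store → Set) →
    assigns c (for d P) ≡ false → assigns d P ≡ false →
    (∀ τ v → K τ → K (update τ c 0 v)) →
    (∀ τ v → K τ → K (update τ d 0 v)) →
    (∀ τ v i j → Q i j τ → Q i j (update τ c 0 v)) →
    (∀ τ v i j → Q i j τ → Q i j (update τ d 0 v)) →
    K σ →
    (∀ τ → τ c 0 < n → τ d 0 < n → K τ →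
       K (sem n P τ) × Q (τ c 0) (τ d 0) (sem n P τ) ×
       (∀ i j → i < n → j < n → Q i j τ → Q i j (sem n P τ))) →
    K (sem n (for c (for d P)) σ) ×
    (∀ i j → i < n → j < n → Q i j (sem n (for c (for d P)) σ))
  for-each₂ n c d P σ K Q hc hd Kc Kd Qc Qd k step =
    proj₁ outer , λ i j i<n j<n → proj₂ outer i i<n j j<n
    where
    Row : ℕ → Store → Set
    Row i τ = ∀ j → j < n → Q i j τ
    outer : K (sem n (for c (for d P)) σ) × (∀ i → i < n → Row i (sem n (for c (for d P)) σ))
    outer = for-each n c (for d P) σ K Row hc Kc
      (λ τ v i q j j<n → Qc τ v i j (q j j<n)) k inner
      where
      inner : ∀ τ → τ c 0 < n → K τ →
        K (sem n (for d P) τ) × Row (τ c 0) (sem n (for d P) τ) ×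
        (∀ i → i < n → Row i τ → Row i (sem n (for d P) τ))
      inner τ i<n kτ = proj₁ (proj₁ run) , proj₂ run , keep
        where
        K′ : Store → Set
        K′ ρ = K ρ × ρ c 0 ≡ τ c 0
        hc₀ : (c ≡ᵇ d) ≡ false
        hc₀ = ∨-conicalˡ _ _ hc
        hcP : assigns c P ≡ false
        hcP = ∨-conicalʳ (c ≡ᵇ d) _ hc
        bumpc : ∀ ρ v → update ρ d 0 v c 0 ≡ ρ c 0
        bumpc ρ v = cong (λ f → f 0) (update-frame ρ d 0 v c hc₀)
        framec : ∀ ρ → sem n P ρ c 0 ≡ ρ c 0
        framec ρ = cong (λ f → f 0) (frame n P ρ c hcP)
        run : K′ (sem n (for d P) τ) × Row (τ c 0) (sem n (for d P) τ)
        run = for-each n d P τ K′ (λ j ρ → Q (τ c 0) j ρ) hd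
          (λ ρ v (kρ , e) → Kd ρ v kρ , trans (bumpc ρ v) e)
          (λ ρ v j q → Qd ρ v _ j q)
          (kτ , refl)
          (λ ρ j<n (kρ , e) →
            let s = step ρ (subst (_< n) (sym e) i<n) j<n kρ in
            (proj₁ s , trans (framec ρ) e) ,
            subst (λ x → Q x (ρ d 0) (sem n P ρ)) e (proj₁ (proj₂ s)) ,
            λ j j<n q → proj₂ (proj₂ s) _ j i<n j<n q)
        keep : ∀ i → i < n → Row i τ → Row i (sem n (for d P) τ)
        -- The inner loop is analysed a second time, now with the finished row `i` as part of the
        -- invariant and a trivial postcondition.
        keep i i<n′ row = proj₂ (proj₁ (for-each n d P τ
          (λ ρ → K′ ρ × Row i ρ) (λ _ _ → ℕ) hd
          (λ ρ v ((kρ , e) , r) → (Kd ρ v kρ , trans (bumpc ρ v) e) ,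
                                   λ j j<n → Qd ρ v i j (r j j<n))
          (λ _ _ _ z → z)
          ((kτ , refl) , row)
          (λ ρ j<n ((kρ , e) , r) →
            let s = step ρ (subst (_< n) (sym e) i<n) j<n kρ in
            ((proj₁ s , trans (framec ρ) e) ,
              λ j j<n → proj₂ (proj₂ s) i j i<n′ j<n (r j j<n)) , 0 , λ _ _ z → z)))

  guard : List Expr → Cmd → Cmd
  guard []       P = P
  guard (e ∷ es) P = cond e (guard es P) skip

  guard-elim : ∀ n P σ (Φ : Store → Set) es →
    (All (λ e → ⟦ e ⟧ σ ≢ 0) es → Φ (sem n P σ)) →
    (¬ All (λ e → ⟦ e ⟧ σ ≢ 0) es → Φ σ) →
    Φ (sem n (guard es P) σ)
  guard-elim n P σ Φ [] y z = y []
  guard-elim n P σ Φ (e ∷ es) y z with ⟦ e ⟧ σ in eq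
  ... | zero  = z λ { (h ∷ _) → h eq }
  ... | suc m = guard-elim n P σ Φ es (λ hs → y (h ∷ hs)) (λ ¬hs → z λ { (_ ∷ hs) → ¬hs hs })
    where
    h : ⟦ e ⟧ σ ≢ 0
    h p with trans (sym eq) p
    ... | ()

  cost : ℕ → Cmd → ℕ
  cost n skip         = 1
  cost n (a [ e ]≔ f) = 1
  cost n (P ⨟ Q)      = cost n P + cost n Q
  cost n (cond e P Q) = suc (cost n P + cost n Q)
  cost n (for c P)    = suc (suc (n * (2 + cost n P)))

  suc⇒≢0 : ∀ {e σ m} → ⟦ e ⟧ σ ≡ suc m → ⟦ e ⟧ σ ≢ 0
  suc⇒≢0 eq eq₀ with trans (sym eq) eq₀
  ... | ()

  execution : ∀ n P σ → wellFormed P ≡ true → assigns 0 P ≡ false → σ 0 0 ≡ n →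
    ∃[ t ] (compile P ⊢ σ ⇓ sem n P σ in-time t) × t ≤ cost n P
  execution n skip σ wf fr h = 1 , run-skip , ≤-refl
  execution n (a [ e ]≔ f) σ wf fr h = 1 , run-assign , ≤-refl
  execution n (P ⨟ Q) σ wf fr h =
    let h′ = trans (cong (λ g → g 0) (frame n P σ 0 (∨-conicalˡ _ _ fr))) h
        (s , r , s≤)  = execution n P σ (∧-conicalˡ _ _ wf) (∨-conicalˡ _ _ fr) h
        (t , r′ , t≤) = execution n Q (sem n P σ) (∧-conicalʳ (wellFormed P) _ wf) (∨-conicalʳ (assigns 0 P) _ fr) h′ in
    s + t , run-seq r r′ , +-mono-≤ s≤ t≤
  execution n (cond e P Q) σ wf fr h with ⟦ e ⟧ σ in eq
  ... | zero  = let (t , r , t≤) = execution n Q σ (∧-conicalʳ (wellFormed P) _ wf) (∨-conicalʳ (assigns 0 P) _ fr) h in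
                suc t , cond-false eq r , s≤s (≤-trans t≤ (m≤n+m _ (cost n P)))
  ... | suc _ = let (t , r , t≤) = execution n P σ (∧-conicalˡ _ _ wf) (∨-conicalˡ _ _ fr) h in
                suc t , cond-true (suc⇒≢0 {e} {σ} eq) r , s≤s (≤-trans t≤ (m≤m+n _ _))
  execution n (for c P) σ wf fr h =
    let (t , r , t≤) = loop n (update σ c 0 0) start (trans (cong (_+ n) (update-scalar σ c 0)) refl) in
    suc t , run-seq run-assign r , s≤s t≤
    where
    free : assigns c P ≡ false
    free = not-injective (∧-conicalʳ (wellFormed P) _ wf)
    0≢c : (0 ≡ᵇ c) ≡ false
    0≢c = ∨-conicalˡ _ _ fr
    frame₀ : assigns 0 P ≡ false
    frame₀ = ∨-conicalʳ (0 ≡ᵇ c) _ fr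
    start : update σ c 0 0 0 0 ≡ n
    start = trans (cong (λ f → f 0) (update-frame σ c 0 0 0 0≢c)) h
    loop : ∀ m τ → τ 0 0 ≡ n → τ c 0 + m ≡ n →
      ∃[ t ] (while ($ 0 ⊖ $ c) (compile P ⨟ (c [ lit 0 ]≔ $ c ⊕ lit 1))
                ⊢ τ ⇓ iterate m (λ τ → bump c (sem n P τ)) τ in-time t)
           × t ≤ suc (m * (2 + cost n P))
    loop zero τ h₀ hc = 1 , while-stop test , ≤-refl
      where
      test : τ 0 0 ∸ τ c 0 ≡ 0
      test = m≤n⇒m∸n≡0 (≤-reflexive (trans h₀ (trans (sym hc) (+-identityʳ (τ c 0)))))
    loop (suc m) τ h₀ hc =
      let (s , r , s≤) = execution n P τ (∧-conicalˡ _ _ wf) frame₀ h₀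
          (t , r′ , t≤) = loop m (bump c (sem n P τ)) h₀′ hc′ in
      suc (s + 1 + t) , while-step test (run-seq r run-assign) r′ , s≤s (bound s t s≤ t≤)
      where
      test : τ 0 0 ∸ τ c 0 ≢ 0
      test z = <⇒≱ (subst₂ _<_ refl (trans hc (sym h₀)) (m<m+n (τ c 0) (s≤s z≤n))) (m∸n≡0⇒m≤n z)
      h₀′ : bump c (sem n P τ) 0 0 ≡ n
      h₀′ = trans (cong (λ f → f 0) (trans
              (update-frame (sem n P τ) c 0 _ 0 0≢c)
              (frame n P τ 0 frame₀))) h₀
      hc′ : bump c (sem n P τ) c 0 + m ≡ n
      hc′ = trans (cong (_+ m) (trans (update-scalar (sem n P τ) c _)
              (cong (λ f → f 0 + 1) (frame n P τ c free))))
            (trans (+-assoc (τ c 0) 1 m) hc)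
      bound : ∀ s t → s ≤ cost n P → t ≤ suc (m * (2 + cost n P)) →
              s + 1 + t ≤ suc m * (2 + cost n P)
      bound s t s≤ t≤ = begin
        s + 1 + t                                   ≤⟨ +-mono-≤ (+-monoˡ-≤ 1 s≤) t≤ ⟩
        cost n P + 1 + suc (m * (2 + cost n P))     ≡⟨ +-suc _ _ ⟩
        suc (cost n P + 1) + m * (2 + cost n P)     ≡⟨ cong (λ x → suc x + m * (2 + cost n P)) (+-comm (cost n P) 1) ⟩
        suc m * (2 + cost n P)                      ∎
        where open ≤-Reasoning

  depth : Cmd → ℕ
  depth skip         = 0
  depth (a [ e ]≔ f) = 0
  depth (P ⨟ Q)      = depth P ⊔ depth Q
  depth (cond e P Q) = depth P ⊔ depth Q
  depth (for c P)    = suc (depth P)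

  weight : Cmd → ℕ
  weight skip         = 1
  weight (a [ e ]≔ f) = 1
  weight (P ⨟ Q)      = weight P + weight Q
  weight (cond e P Q) = suc (weight P + weight Q)
  weight (for c P)    = 4 + weight P

  1≤power : ∀ n d → 1 ≤ suc n ^ d
  1≤power n d = m^n>0 (suc n) d

  mutual
    -- The base is `suc n`, not `n`: its powers are at least 1 even for the empty graph and so
    -- absorb the constant overhead of tests and loops.
    cost-bound : ∀ n P → cost n P ≤ weight P * suc n ^ depth P
    cost-bound n skip         = ≤-refl
    cost-bound n (a [ e ]≔ f) = ≤-refl
    cost-bound n (P ⨟ Q)      = cost-bound-pair n P Q
    cost-bound n (cond e P Q) = +-mono-≤ (1≤power n (depth P ⊔ depth Q)) (cost-bound-pair n P Q)
    cost-bound n (for c P)    = begin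
      2 + n * (2 + cost n P)                      ≤⟨ +-monoʳ-≤ 2 (*-monoʳ-≤ n (+-monoʳ-≤ 2 (cost-bound n P))) ⟩
      2 + n * (2 + weight P * N)                  ≡⟨ cong (2 +_) (*-distribˡ-+ n 2 _) ⟩
      2 + (n * 2 + n * (weight P * N))            ≡⟨ +-assoc 2 (n * 2) _ ⟨
      suc n * 2 + n * (weight P * N)              ≤⟨ +-mono-≤
          (*-monoʳ-≤ (suc n) (*-monoˡ-≤ 2 (1≤power n (depth P)))) (*-monoˡ-≤ (weight P * N) (n≤1+n n)) ⟩
      suc n * (N * 2) + suc n * (weight P * N)    ≡⟨ *-distribˡ-+ (suc n) (N * 2) _ ⟨
      suc n * (N * 2 + weight P * N)              ≡⟨ cong (λ x → suc n * (x + weight P * N)) (*-comm N 2) ⟩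
      suc n * (2 * N + weight P * N)              ≡⟨ cong (suc n *_) (*-distribʳ-+ N 2 (weight P)) ⟨
      suc n * ((2 + weight P) * N)                ≡⟨ x∙yz≈y∙xz (suc n) (2 + weight P) N ⟩
      (2 + weight P) * (suc n * N)                ≤⟨ *-monoˡ-≤ (suc n * N) (m≤n+m (2 + weight P) 2) ⟩
      (4 + weight P) * (suc n * N)                ∎
      where
      open ≤-Reasoning
      open import Algebra.Properties.CommutativeSemigroup *-commutativeSemigroup using (x∙yz≈y∙xz)
      N = suc n ^ depth P

    cost-bound-pair : ∀ n P Q → cost n P + cost n Q ≤ (weight P + weight Q) * suc n ^ (depth P ⊔ depth Q)
    cost-bound-pair n P Q = begin
      cost n P + cost n Q                                        ≤⟨ +-mono-≤ (cost-bound n P) (cost-bound n Q) ⟩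
      weight P * suc n ^ depth P + weight Q * suc n ^ depth Q    ≤⟨ +-mono-≤
          (*-monoʳ-≤ (weight P) (^-monoʳ-≤ (suc n) (m≤m⊔n (depth P) (depth Q))))
          (*-monoʳ-≤ (weight Q) (^-monoʳ-≤ (suc n) (m≤n⊔m (depth P) (depth Q)))) ⟩
      weight P * N + weight Q * N                                ≡⟨ *-distribʳ-+ N (weight P) (weight Q) ⟨
      (weight P + weight Q) * N                                  ∎
      where
      open ≤-Reasoning
      N = suc n ^ (depth P ⊔ depth Q)

-- Finite sums, geometric decay, and the rounding of `k` and `q`.

module Arithmetic where

  open import Data.Bool using (false; if_then_else_)
  open import Data.Empty using (⊥-elim)
  open import Data.Nat
  open import Data.Nat.Logarithm using (⌊log₂_⌋; ⌊log₂⌋-mono-≤; ⌊log₂[2^n]⌋≡n)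
  open import Data.Nat.Properties
  open import Data.Sum using (_⊎_; inj₁; inj₂)
  open import Relation.Binary.PropositionalEquality
  open import Relation.Nullary using (yes; no)
  open Language using (≡ᵇ-refl)
  open import Algebra.Properties.CommutativeSemigroup +-commutativeSemigroup
    using () renaming (interchange to +-interchange; xy∙z≈xz∙y to +-xy∙z≈xz∙y)

  ∑ : ℕ → (ℕ → ℕ) → ℕ
  ∑ zero    f = 0
  ∑ (suc n) f = ∑ n f + f n

  ∑-mono : ∀ n {f g} → (∀ i → i < n → f i ≤ g i) → ∑ n f ≤ ∑ n g
  ∑-mono zero    h = z≤n
  ∑-mono (suc n) h = +-mono-≤ (∑-mono n (λ i i<n → h i (m<n⇒m<1+n i<n))) (h n ≤-refl)

  ∑-cong : ∀ n {f g} → (∀ i → i < n → f i ≡ g i) → ∑ n f ≡ ∑ n g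
  ∑-cong zero    h = refl
  ∑-cong (suc n) h = cong₂ _+_ (∑-cong n (λ i i<n → h i (m<n⇒m<1+n i<n))) (h n ≤-refl)

  ∑-+ : ∀ n f g → ∑ n (λ i → f i + g i) ≡ ∑ n f + ∑ n g
  ∑-+ zero    f g = refl
  ∑-+ (suc n) f g = trans (cong (_+ (f n + g n)) (∑-+ n f g)) (+-interchange (∑ n f) (∑ n g) (f n) (g n))

  ∑-* : ∀ n c f → ∑ n (λ i → c * f i) ≡ c * ∑ n f
  ∑-* zero    c f = sym (*-zeroʳ c)
  ∑-* (suc n) c f = trans (cong (_+ c * f n) (∑-* n c f)) (sym (*-distribˡ-+ c (∑ n f) (f n)))

  ∑-const : ∀ n c → ∑ n (λ _ → c) ≡ n * c
  ∑-const zero    c = refl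
  ∑-const (suc n) c = trans (cong (_+ c) (∑-const n c)) (+-comm (n * c) c)

  ≤∑ : ∀ n f i → i < n → f i ≤ ∑ n f
  ≤∑ (suc n) f i (s≤s i≤n) with m≤n⇒m<n∨m≡n i≤n
  ... | inj₁ i<n  = ≤-trans (≤∑ n f i i<n) (m≤m+n _ _)
  ... | inj₂ refl = m≤n+m _ _

  ∑≡0⇒ : ∀ n f → ∑ n f ≡ 0 → ∀ i → i < n → f i ≡ 0
  ∑≡0⇒ n f h i i<n = n≤0⇒n≡0 (subst (f i ≤_) h (≤∑ n f i i<n))

  put : (ℕ → ℕ) → ℕ → ℕ → ℕ → ℕ
  put f i m j = if j ≡ᵇ i then m else f j

  put-here : ∀ f i m → put f i m i ≡ m
  put-here f i m rewrite ≡ᵇ-refl i = refl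

  ≢⇒≡ᵇ : ∀ i j → i ≢ j → (i ≡ᵇ j) ≡ false
  ≢⇒≡ᵇ zero    zero    h = ⊥-elim (h refl)
  ≢⇒≡ᵇ zero    (suc j) h = refl
  ≢⇒≡ᵇ (suc i) zero    h = refl
  ≢⇒≡ᵇ (suc i) (suc j) h = ≢⇒≡ᵇ i j (λ e → h (cong suc e))

  put-there : ∀ f i m j → j ≢ i → put f i m j ≡ f j
  put-there f i m j h rewrite ≢⇒≡ᵇ j i h = refl

  put-elim : ∀ (Φ : ℕ → ℕ → Set) f i m → Φ i m → (∀ j → j ≢ i → Φ j (f j)) → ∀ j → Φ j (put f i m j)
  put-elim Φ f i m here there j with j ≟ i
  ... | yes refl = subst (Φ j) (sym (put-here f j m)) here
  ... | no  j≢i  = subst (Φ j) (sym (put-there f i m j j≢i)) (there j j≢i)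

  ∑-put : ∀ n f i m → i < n → ∑ n (put f i m) + f i ≡ ∑ n f + m
  ∑-put (suc n) f i m (s≤s i≤n) with m≤n⇒m<n∨m≡n i≤n
  ... | inj₁ i<n  = begin
    ∑ n (put f i m) + put f i m n + f i    ≡⟨ +-xy∙z≈xz∙y (∑ n (put f i m)) _ _ ⟩
    ∑ n (put f i m) + f i + put f i m n    ≡⟨ cong₂ _+_ (∑-put n f i m i<n) (put-there f i m n (λ e → <⇒≢ i<n (sym e))) ⟩
    ∑ n f + m + f n                        ≡⟨ +-xy∙z≈xz∙y (∑ n f) _ _ ⟩
    ∑ n f + f n + m                        ∎
    where open ≡-Reasoning
  ... | inj₂ refl = begin
    ∑ n (put f n m) + put f n m n + f n    ≡⟨ cong₂ (λ a b → a + b + f n)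
        (∑-cong n (λ j j<n → put-there f n m j (<⇒≢ j<n))) (put-here f n m) ⟩
    ∑ n f + m + f n                        ≡⟨ +-xy∙z≈xz∙y (∑ n f) _ _ ⟩
    ∑ n f + f n + m                        ∎
    where open ≡-Reasoning

  -- Bernoulli's inequality 1 + j/s ≤ (1 + 1/s)^j, multiplied by s^(j+1).
  bernoulli : ∀ s j → (s + j) * s ^ j ≤ s * suc s ^ j
  bernoulli s zero    = ≤-reflexive (cong (_* 1) (+-identityʳ s))
  bernoulli s (suc j) = begin
    (s + suc j) * (s * s ^ j)         ≡⟨ *-assoc (s + suc j) s (s ^ j) ⟨
    (s + suc j) * s * s ^ j           ≤⟨ *-monoˡ-≤ (s ^ j) coefficient ⟩
    suc s * (s + j) * s ^ j           ≡⟨ *-assoc (suc s) (s + j) (s ^ j) ⟩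
    suc s * ((s + j) * s ^ j)         ≤⟨ *-monoʳ-≤ (suc s) (bernoulli s j) ⟩
    suc s * (s * suc s ^ j)           ≡⟨ x∙yz≈y∙xz (suc s) s (suc s ^ j) ⟩
    s * (suc s * suc s ^ j)           ∎
    where
    open ≤-Reasoning
    open import Algebra.Properties.CommutativeSemigroup *-commutativeSemigroup using (x∙yz≈y∙xz)
    coefficient : (s + suc j) * s ≤ suc s * (s + j)
    coefficient = begin
      (s + suc j) * s            ≡⟨ cong (_* s) (+-suc s j) ⟩
      s + (s + j) * s            ≤⟨ +-mono-≤ (m≤m+n s j) (≤-reflexive (*-comm (s + j) s)) ⟩
      (s + j) + s * (s + j)      ∎

  -- In fractions, (1 - 1/q)^q ≤ 1/2. Bernoulli's inequality is used with both parameters equal to q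
  -- - 1.
  halving : ∀ q → 1 ≤ q → pred q ^ q * 2 ≤ q ^ q
  halving (suc zero)    _ = z≤n
  halving (suc (suc r)) _ = begin
    s * s ^ s * 2              ≡⟨ *-comm (s * s ^ s) 2 ⟩
    2 * (s * s ^ s)            ≡⟨ *-assoc 2 s (s ^ s) ⟨
    2 * s * s ^ s              ≡⟨ cong (λ z → (s + z) * s ^ s) (+-identityʳ s) ⟩
    (s + s) * s ^ s            ≤⟨ bernoulli s s ⟩
    s * suc s ^ s              ≤⟨ *-monoˡ-≤ (suc s ^ s) (n≤1+n s) ⟩
    suc s * suc s ^ s          ∎
    where
    open ≤-Reasoning
    s = suc r

  ^-distribʳ-* : ∀ j m n → (m * n) ^ j ≡ m ^ j * n ^ j
  ^-distribʳ-* zero    m n = refl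
  ^-distribʳ-* (suc j) m n = trans (cong (m * n *_) (^-distribʳ-* j m n)) (interchange m n (m ^ j) (n ^ j))
    where open import Algebra.Properties.CommutativeSemigroup *-commutativeSemigroup using (interchange)

  -- Since p ≥ q·L, the decay factor (1 - 1/q)^p is at most 2^(-L), by `halving`. Hence m ≤ n / 2^L
  -- < 1.
  few-phases : ∀ {n q L} p m → 1 ≤ q → n < 2 ^ L → q * L ≤ p → m * q ^ p ≤ pred q ^ p * n → m ≡ 0
  few-phases {n} {q} {L} p zero    1≤q n< T≤p decay = refl
  few-phases {n} {q} {L} p (suc m) 1≤q n< T≤p decay = ⊥-elim (<⇒≱ n< (*-cancelˡ-≤ (q ^ p) {{q^p≢0}} (begin
    q ^ p * 2 ^ L                  ≤⟨ *-monoˡ-≤ (2 ^ L) (≤-trans (m≤m+n (q ^ p) (m * q ^ p)) decay) ⟩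
    pred q ^ p * n * 2 ^ L         ≡⟨ xy∙z≈xz∙y (pred q ^ p) n (2 ^ L) ⟩
    pred q ^ p * 2 ^ L * n         ≤⟨ *-monoˡ-≤ n rate ⟩
    q ^ p * n                      ∎)))
    where
    open ≤-Reasoning
    open import Algebra.Properties.CommutativeSemigroup *-commutativeSemigroup using (xy∙z≈xz∙y)
    q^p≢0 : NonZero (q ^ p)
    q^p≢0 = m^n≢0 q p {{>-nonZero 1≤q}}
    d = p ∸ q * L
    p≡ : q * L + d ≡ p
    p≡ = m+[n∸m]≡n T≤p
    rate : pred q ^ p * 2 ^ L ≤ q ^ p
    rate = begin
      pred q ^ p * 2 ^ L                          ≡⟨ cong (λ z → pred q ^ z * 2 ^ L) p≡ ⟨
      pred q ^ (q * L + d) * 2 ^ L                ≡⟨ cong (_* 2 ^ L) (^-distribˡ-+-* (pred q) (q * L) d) ⟩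
      pred q ^ (q * L) * pred q ^ d * 2 ^ L       ≡⟨ xy∙z≈xz∙y (pred q ^ (q * L)) _ _ ⟩
      pred q ^ (q * L) * 2 ^ L * pred q ^ d       ≡⟨ cong (λ z → z * 2 ^ L * pred q ^ d) (^-*-assoc (pred q) q L) ⟨
      (pred q ^ q) ^ L * 2 ^ L * pred q ^ d       ≡⟨ cong (_* pred q ^ d) (^-distribʳ-* L (pred q ^ q) 2) ⟨
      (pred q ^ q * 2) ^ L * pred q ^ d           ≤⟨ *-mono-≤ (^-monoˡ-≤ L (halving q 1≤q)) (^-monoˡ-≤ d pred[n]≤n) ⟩
      (q ^ q) ^ L * q ^ d                         ≡⟨ cong (_* q ^ d) (^-*-assoc q q L) ⟩
      q ^ (q * L) * q ^ d                         ≡⟨ ^-distribˡ-+-* q (q * L) d ⟨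
      q ^ (q * L + d)                             ≡⟨ cong (q ^_) p≡ ⟩
      q ^ p                                       ∎

  n<2^n : ∀ n → n < 2 ^ n
  n<2^n zero    = s≤s z≤n
  n<2^n (suc n) = ≤-trans (s≤s (n<2^n n)) (+-mono-≤ (m^n>0 2 n) (≤-reflexive (sym (+-identityʳ (2 ^ n)))))

  n<2^[1+⌊log₂n⌋] : ∀ n → n < 2 ^ suc ⌊log₂ n ⌋
  n<2^[1+⌊log₂n⌋] n = ≰⇒> λ le → <⇒≱ (n<1+n ⌊log₂ n ⌋)
    (subst (_≤ ⌊log₂ n ⌋) (⌊log₂[2^n]⌋≡n (suc ⌊log₂ n ⌋)) (⌊log₂⌋-mono-≤ le))

  -- c and d are the numerator and denominator of 2a / b.
  ratio-bound : ∀ {n k q a b c d} → 1 ≤ n → 1 ≤ b → 1 ≤ q → pred q ^ k < n →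
    c * b ≡ 2 * a * d → k ≡ n ⊎ b ≤ k * a → q ^ d ≤ 2 ^ d * n ^ c
  ratio-bound {n} {k} {suc zero} {a} {b} {c} {d} 1≤n 1≤b _ _ _ _ =
    ≤-trans (≤-reflexive (^-zeroˡ d)) (*-mono-≤ (m^n>0 2 d) (m^n>0 n {{>-nonZero 1≤n}} c))
  ratio-bound {n} {k} {suc (suc r)} {a} {b} {c} {d} 1≤n 1≤b _ small 2a/b high = begin
    -- Here q = s + 1 ≤ 2s with s^k < n: rounding `q` up to an integer costs the factor 2^d.
    suc s ^ d             ≤⟨ ^-monoˡ-≤ d (+-monoˡ-≤ s (s≤s z≤n)) ⟩
    (s + s) ^ d           ≡⟨ cong (λ z → (s + z) ^ d) (+-identityʳ s) ⟨
    (2 * s) ^ d           ≡⟨ ^-distribʳ-* d 2 s ⟩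
    2 ^ d * s ^ d         ≤⟨ *-monoʳ-≤ (2 ^ d) (power-bound high) ⟩
    2 ^ d * n ^ c         ∎
    where
    open ≤-Reasoning
    s = suc r
    power-bound : k ≡ n ⊎ b ≤ k * a → s ^ d ≤ n ^ c
    -- If `k` was capped at `n`, then s ≥ 2 would give 2^n ≤ s^n < n, so `s` is 1.
    power-bound (inj₁ refl) = ≤-trans (≤-reflexive (trans (cong (_^ d) s≡1) (^-zeroˡ d))) (m^n>0 n {{>-nonZero 1≤n}} c)
      where
      s≡1 : s ≡ 1
      s≡1 = ≤-antisym (≮⇒≥ λ 1<s → <-asym small (<-≤-trans (n<2^n n) (^-monoˡ-≤ n 1<s))) (s≤s z≤n)
    power-bound (inj₂ b≤ka) = begin
      s ^ d             ≤⟨ ^-monoʳ-≤ s d≤kc ⟩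
      s ^ (k * c)       ≡⟨ ^-*-assoc s k c ⟨
      (s ^ k) ^ c       ≤⟨ ^-monoˡ-≤ c (<⇒≤ small) ⟩
      n ^ c             ∎
      where
      open import Algebra.Properties.CommutativeSemigroup *-commutativeSemigroup using (x∙yz≈y∙xz)
      d≤kc : d ≤ k * c
      d≤kc = *-cancelˡ-≤ b {{>-nonZero 1≤b}} (begin
        b * d                ≤⟨ *-monoˡ-≤ d b≤ka ⟩
        k * a * d            ≤⟨ *-monoˡ-≤ d (*-monoʳ-≤ k (m≤m+n a (1 * a))) ⟩
        k * (2 * a) * d      ≡⟨ *-assoc k (2 * a) d ⟩
        k * (2 * a * d)      ≡⟨ cong (k *_) 2a/b ⟨
        k * (c * b)          ≡⟨ *-assoc k c b ⟨
        k * c * b            ≡⟨ *-comm (k * c) b ⟩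
        b * (k * c)          ∎)

  -- The values 0 to 2qL make 1 + 2qL ≤ 3qL colours. The constant 6 is this 3 times the 2 lost by
  -- rounding `q`.
  palette-bound : ∀ {n q L c d} → 1 ≤ q → 1 ≤ L → q ^ d ≤ 2 ^ d * n ^ c →
    suc (q * L * 2) ^ d ≤ (6 * L ^ 1) ^ d * n ^ c
  palette-bound {n} {q} {L} {c} {d} 1≤q 1≤L h = begin
    suc (q * L * 2) ^ d               ≤⟨ ^-monoˡ-≤ d (+-monoˡ-≤ (q * L * 2) (*-mono-≤ 1≤q 1≤L)) ⟩
    (q * L + q * L * 2) ^ d           ≡⟨ cong (_^ d) (*-suc (q * L) 2) ⟨
    (q * L * 3) ^ d                   ≡⟨ cong (_^ d) (*-assoc q L 3) ⟩
    (q * (L * 3)) ^ d                 ≡⟨ ^-distribʳ-* d q (L * 3) ⟩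
    q ^ d * (L * 3) ^ d               ≤⟨ *-monoˡ-≤ ((L * 3) ^ d) h ⟩
    2 ^ d * n ^ c * (L * 3) ^ d       ≡⟨ xy∙z≈xz∙y (2 ^ d) _ _ ⟩
    2 ^ d * (L * 3) ^ d * n ^ c       ≡⟨ cong (_* n ^ c) (^-distribʳ-* d 2 (L * 3)) ⟨
    (2 * (L * 3)) ^ d * n ^ c         ≡⟨ cong (λ z → (2 * z) ^ d * n ^ c) (*-comm L 3) ⟩
    (2 * (3 * L)) ^ d * n ^ c         ≡⟨ cong (λ z → z ^ d * n ^ c) (*-assoc 2 3 L) ⟨
    (6 * L) ^ d * n ^ c               ≡⟨ cong (λ z → (6 * z) ^ d * n ^ c) (^-identityʳ L) ⟨
    (6 * L ^ 1) ^ d * n ^ c           ∎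
    where
    open ≤-Reasoning
    open import Algebra.Properties.CommutativeSemigroup *-commutativeSemigroup using (xy∙z≈xz∙y)

  -- Both k - 1 and 1 are at most b/a, so k ≤ 2b/a; the further factor 2 stands for the two tree
  -- paths of a deleted walk. This is the origin of the 4 in 4ε/γ.
  double-rounding : ∀ {a b} k → pred k * a < b → a ≤ b → k * 2 * a ≤ 4 * b
  double-rounding         zero    _ _   = z≤n
  double-rounding {a} {b} (suc j) h a≤b = begin
    suc j * 2 * a        ≡⟨ cong (_* a) (*-comm (suc j) 2) ⟩
    2 * suc j * a        ≡⟨ *-assoc 2 (suc j) a ⟩
    2 * (suc j * a)      ≤⟨ *-monoʳ-≤ 2 (+-mono-≤ a≤b (<⇒≤ h)) ⟩
    2 * (b + b)          ≡⟨ cong (λ z → 2 * (b + z)) (+-identityʳ b) ⟨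
    2 * (2 * b)          ≡⟨ *-assoc 2 2 b ⟨
    4 * b                ∎
    where open ≤-Reasoning

-- Transfer of the integer bounds to rational numbers.

module Rationals where

  open import Data.Integer as ℤ using (+_; +[1+_])
  import Data.Integer.Properties as ℤ
  open import Data.Nat as ℕ using (ℕ; suc; pred)
  import Data.Nat.Properties as ℕ
  open import Data.Rational
  open import Data.Rational.Properties
  open import Data.Rational.Unnormalised as ℚᵘ using (mkℚᵘ; *≤*; *≡*)
  import Data.Rational.Unnormalised.Properties as ℚᵘ
  open import Relation.Binary.PropositionalEquality
  open Arithmetic using (double-rounding)

  -- `fromℕ` reduces to lowest terms and does not compute on a variable. Unnormalised rationals keep
  -- the numerator visible, so the following laws are proved there.
  fromℕ-toℚᵘ : ∀ m → toℚᵘ (fromℕ m) ℚᵘ.≃ mkℚᵘ (+ m) 0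
  fromℕ-toℚᵘ m = toℚᵘ-fromℚᵘ (mkℚᵘ (+ m) 0)

  fromℕ-mono : ∀ {m n} → m ℕ.≤ n → fromℕ m ≤ fromℕ n
  fromℕ-mono {m} {n} m≤n = toℚᵘ-cancel-≤ (begin
    toℚᵘ (fromℕ m)    ≃⟨ fromℕ-toℚᵘ m ⟩
    mkℚᵘ (+ m) 0      ≤⟨ *≤* (ℤ.*-monoʳ-≤-nonNeg (+ 1) (ℤ.+≤+ m≤n)) ⟩
    mkℚᵘ (+ n) 0      ≃⟨ fromℕ-toℚᵘ n ⟨
    toℚᵘ (fromℕ n)    ∎)
    where open ℚᵘ.≤-Reasoning

  fromℕ-+ : ∀ m n → fromℕ (m ℕ.+ n) ≡ fromℕ m + fromℕ n
  fromℕ-+ m n = toℚᵘ-injective (begin-equality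
    toℚᵘ (fromℕ (m ℕ.+ n))                 ≃⟨ fromℕ-toℚᵘ (m ℕ.+ n) ⟩
    mkℚᵘ (+ (m ℕ.+ n)) 0                   ≃⟨ *≡*
        (cong (ℤ._* + 1) (cong₂ ℤ._+_ (sym (ℤ.*-identityʳ (+ m))) (sym (ℤ.*-identityʳ (+ n))))) ⟩
    mkℚᵘ (+ m) 0 ℚᵘ.+ mkℚᵘ (+ n) 0         ≃⟨ ℚᵘ.+-cong (fromℕ-toℚᵘ m) (fromℕ-toℚᵘ n) ⟨
    toℚᵘ (fromℕ m) ℚᵘ.+ toℚᵘ (fromℕ n)     ≃⟨ toℚᵘ-homo-+ (fromℕ m) (fromℕ n) ⟨
    toℚᵘ (fromℕ m + fromℕ n)               ∎)
    where open ℚᵘ.≤-Reasoning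

  fromℕ-* : ∀ m n → fromℕ (m ℕ.* n) ≡ fromℕ m * fromℕ n
  fromℕ-* m n = toℚᵘ-injective (begin-equality
    toℚᵘ (fromℕ (m ℕ.* n))                 ≃⟨ fromℕ-toℚᵘ (m ℕ.* n) ⟩
    mkℚᵘ (+ (m ℕ.* n)) 0                   ≃⟨ *≡* (cong (ℤ._* + 1) (ℤ.pos-* m n)) ⟩
    mkℚᵘ (+ m) 0 ℚᵘ.* mkℚᵘ (+ n) 0         ≃⟨ ℚᵘ.*-cong (fromℕ-toℚᵘ m) (fromℕ-toℚᵘ n) ⟨
    toℚᵘ (fromℕ m) ℚᵘ.* toℚᵘ (fromℕ n)     ≃⟨ toℚᵘ-homo-* (fromℕ m) (fromℕ n) ⟨
    toℚᵘ (fromℕ m * fromℕ n)               ∎)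
    where open ℚᵘ.≤-Reasoning

  double-ratio : ∀ γ → let δ = fromℕ 2 * γ in
    ℤ.∣ ↥ δ ∣ ℕ.* ↧ₙ γ ≡ 2 ℕ.* ℤ.∣ ↥ γ ∣ ℕ.* ↧ₙ δ
  double-ratio γ = cross-multiply (fromℕ 2 * γ) γ (toℚᵘ-homo-* (fromℕ 2) γ)
    where
    -- Generalising over `δ` lets pattern matching expose its numerator and denominator, which are
    -- those of 2γ in lowest terms.
    cross-multiply : ∀ δ γ → toℚᵘ δ ℚᵘ.≃ mkℚᵘ (+ 2) 0 ℚᵘ.* toℚᵘ γ →
      ℤ.∣ ↥ δ ∣ ℕ.* ↧ₙ γ ≡ 2 ℕ.* ℤ.∣ ↥ γ ∣ ℕ.* ↧ₙ δ
    cross-multiply (mkℚ c d _) (mkℚ a b _) (*≡* eq) = begin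
      ℤ.∣ c ∣ ℕ.* suc b                     ≡⟨ cong (ℤ.∣ c ∣ ℕ.*_) (ℕ.+-identityʳ (suc b)) ⟨
      ℤ.∣ c ∣ ℕ.* (1 ℕ.* suc b)             ≡⟨ ℤ.abs-* c (+ (1 ℕ.* suc b)) ⟨
      ℤ.∣ c ℤ.* + (1 ℕ.* suc b) ∣           ≡⟨ cong ℤ.∣_∣ eq ⟩
      ℤ.∣ + 2 ℤ.* a ℤ.* + suc d ∣           ≡⟨ ℤ.abs-* (+ 2 ℤ.* a) (+ suc d) ⟩
      ℤ.∣ + 2 ℤ.* a ∣ ℕ.* suc d             ≡⟨ cong (ℕ._* suc d) (ℤ.abs-* (+ 2) a) ⟩
      2 ℕ.* ℤ.∣ a ∣ ℕ.* suc d               ∎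
      where open ≡-Reasoning

  numerator≤denominator : ∀ γ .{{_ : Positive γ}} → γ ≤ + 1 / 100 → ℤ.∣ ↥ γ ∣ ℕ.≤ ↧ₙ γ
  numerator≤denominator (mkℚ +[1+ a ] b _) (*≤* h) = ℕ.≤-trans (ℕ.m≤m*n (suc a) 100)
    (subst (suc a ℕ.* 100 ℕ.≤_) (ℕ.+-identityʳ (suc b)) (ℤ.drop‿+≤+ h))

  twice-bound : ∀ k γ .{{_ : Positive γ}} → pred k ℕ.* ℤ.∣ ↥ γ ∣ ℕ.< ↧ₙ γ → ℤ.∣ ↥ γ ∣ ℕ.≤ ↧ₙ γ →
    fromℕ (k ℕ.* 2) * γ ≤ fromℕ 4
  twice-bound k γ@(mkℚ +[1+ a ] b _) k-low a≤b = toℚᵘ-cancel-≤ (begin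
    toℚᵘ (fromℕ (k ℕ.* 2) * γ)                ≃⟨ toℚᵘ-homo-* (fromℕ (k ℕ.* 2)) γ ⟩
    toℚᵘ (fromℕ (k ℕ.* 2)) ℚᵘ.* toℚᵘ γ        ≃⟨ ℚᵘ.*-congʳ (fromℕ-toℚᵘ (k ℕ.* 2)) ⟩
    mkℚᵘ (+ (k ℕ.* 2)) 0 ℚᵘ.* toℚᵘ γ          ≤⟨ *≤* (subst₂ ℤ._≤_ left right (ℤ.+≤+ bound)) ⟩
    mkℚᵘ (+ 4) 0                              ∎)
    where
    open ℚᵘ.≤-Reasoning
    left : + (k ℕ.* 2 ℕ.* suc a ℕ.* 1) ≡ + (k ℕ.* 2) ℤ.* +[1+ a ] ℤ.* + 1
    left = trans (ℤ.pos-* (k ℕ.* 2 ℕ.* suc a) 1) (cong (ℤ._* + 1) (ℤ.pos-* (k ℕ.* 2) (suc a)))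
    right : + (4 ℕ.* (1 ℕ.* suc b)) ≡ + 4 ℤ.* + (1 ℕ.* suc b)
    right = ℤ.pos-* 4 (1 ℕ.* suc b)
    bound : k ℕ.* 2 ℕ.* suc a ℕ.* 1 ℕ.≤ 4 ℕ.* (1 ℕ.* suc b)
    bound = subst₂ ℕ._≤_ (sym (ℕ.*-identityʳ (k ℕ.* 2 ℕ.* suc a))) (cong (4 ℕ.*_) (sym (ℕ.+-identityʳ (suc b))))
      (double-rounding k k-low a≤b)

  +-cancelˡ-≤ : ∀ p {q r} → p + q ≤ p + r → q ≤ r
  +-cancelˡ-≤ p {q} {r} h = subst₂ _≤_ (cancel q) (cancel r) (+-monoʳ-≤ (- p) h)
    where
    cancel : ∀ q → - p + (p + q) ≡ q
    cancel q = trans (sym (+-assoc (- p) p q)) (trans (cong (_+ q) (+-inverseˡ p)) (+-identityˡ q))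

  few-bad : ∀ n g B ε → g ℕ.+ B ≡ n → (1ℚ - ε) * fromℕ n ≤ fromℕ g → fromℕ B ≤ ε * fromℕ n
  few-bad n g B ε refl h = +-cancelˡ-≤ (fromℕ g) (begin
    fromℕ g + fromℕ B                                   ≡⟨ fromℕ-+ g B ⟨
    N                                                   ≡⟨ *-identityˡ N ⟨
    1ℚ * N                                              ≡⟨ cong (_* N) (split ε) ⟩
    (1ℚ - ε + ε) * N                                    ≡⟨ *-distribʳ-+ N (1ℚ - ε) ε ⟩
    (1ℚ - ε) * N + ε * N                                ≤⟨ +-monoˡ-≤ (ε * N) h ⟩
    fromℕ g + ε * N                                     ∎)
    where
    open ≤-Reasoning
    N = fromℕ (g ℕ.+ B)
    split : ∀ ε → 1ℚ ≡ 1ℚ - ε + ε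
    split ε = sym (trans (+-assoc 1ℚ (- ε) ε) (trans (cong (λ z → 1ℚ + z) (+-inverseˡ ε)) (+-identityʳ 1ℚ)))

  -- With `B` the number of bad vertices, s ≤ 2k·B ≤ (4/γ)·B ≤ (4/γ)·ε·n.
  removed-bound : ∀ n g B s k ε γ .{{γ>0 : Positive γ}} → γ ≤ + 1 / 100 →
    pred k ℕ.* ℤ.∣ ↥ γ ∣ ℕ.< ↧ₙ γ → s ℕ.≤ k ℕ.* 2 ℕ.* B → g ℕ.+ B ≡ n →
    (1ℚ - ε) * fromℕ n ≤ fromℕ g →
    fromℕ s ≤ (_÷_ (fromℕ 4 * ε) γ {{pos⇒nonZero γ}}) * fromℕ n
  removed-bound n g B s k ε γ γ≤ k-low s≤ g+B≡n good = begin
    fromℕ s                                ≤⟨ fromℕ-mono s≤ ⟩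
    fromℕ (k ℕ.* 2 ℕ.* B)                  ≡⟨ fromℕ-* (k ℕ.* 2) B ⟩
    fromℕ (k ℕ.* 2) * fromℕ B              ≤⟨ *-monoʳ-≤-nonNeg (fromℕ B)
        {{nonNegative (fromℕ-mono {0} {B} ℕ.z≤n)}} 2k≤4/γ ⟩
    fromℕ 4 * γ⁻¹ * fromℕ B                ≤⟨ *-monoˡ-≤-nonNeg (fromℕ 4 * γ⁻¹) {{nonNegative 0≤4/γ}}
        (few-bad n g B ε g+B≡n good) ⟩
    fromℕ 4 * γ⁻¹ * (ε * fromℕ n)          ≡⟨ *-assoc (fromℕ 4 * γ⁻¹) ε (fromℕ n) ⟨
    fromℕ 4 * γ⁻¹ * ε * fromℕ n            ≡⟨ cong (_* fromℕ n)
        (trans (*-assoc (fromℕ 4) γ⁻¹ ε)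
        (trans (cong (fromℕ 4 *_) (*-comm γ⁻¹ ε)) (sym (*-assoc (fromℕ 4) ε γ⁻¹)))) ⟩
    fromℕ 4 * ε * γ⁻¹ * fromℕ n            ∎
    where
    open ≤-Reasoning
    instance
      γ≢0 = pos⇒nonZero γ
    γ⁻¹ = 1/ γ
    instance
      γ⁻¹>0 : NonNegative γ⁻¹
      γ⁻¹>0 = pos⇒nonNeg γ⁻¹ {{1/pos⇒pos γ}}
    2k≤4/γ : fromℕ (k ℕ.* 2) ≤ fromℕ 4 * γ⁻¹
    2k≤4/γ = begin
      fromℕ (k ℕ.* 2)                ≡⟨ *-identityʳ (fromℕ (k ℕ.* 2)) ⟨
      fromℕ (k ℕ.* 2) * 1ℚ           ≡⟨ cong (fromℕ (k ℕ.* 2) *_) (*-inverseʳ γ) ⟨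
      fromℕ (k ℕ.* 2) * (γ * γ⁻¹)    ≡⟨ *-assoc (fromℕ (k ℕ.* 2)) γ γ⁻¹ ⟨
      fromℕ (k ℕ.* 2) * γ * γ⁻¹      ≤⟨ *-monoʳ-≤-nonNeg γ⁻¹ (twice-bound k γ k-low (numerator≤denominator γ γ≤)) ⟩
      fromℕ 4 * γ⁻¹                  ∎
    0≤4/γ : 0ℚ ≤ fromℕ 4 * γ⁻¹
    0≤4/γ = ≤-trans (fromℕ-mono {0} {k ℕ.* 2} ℕ.z≤n) 2k≤4/γ

-- The colouring program and its correctness.

module Algorithm where

  open import Data.Bool using (Bool; true; false; T; not)
  open import Data.Empty using (⊥; ⊥-elim)
  open import Data.Fin using (Fin; zero; suc; toℕ; fromℕ<; remQuot; combine)
  open import Data.Fin.Properties using (toℕ<n; fromℕ<-toℕ; toℕ-fromℕ<; toℕ-combine; remQuot-combine)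
  open import Data.Fin.Subset using (Subset; _∈_; ∁; ∣_∣)
  open import Data.Fin.Subset.Properties using (∣∁p∣≡n∸∣p∣; ∣p∣≤n)
  import Data.Integer as ℤ
  open import Data.List using (List; []; _∷_)
  open import Data.List.Relation.Unary.All using (All; []; _∷_)
  open import Data.Nat
  open import Data.Nat.Logarithm using (⌊log₂_⌋)
  open import Data.Nat.Properties
  open import Data.Product using (_×_; _,_; proj₁; proj₂; ∃-syntax; uncurry)
  import Data.Rational as ℚ
  open import Data.Sum using (_⊎_; inj₁; inj₂; [_,_]′)
  open import Data.Unit using (tt)
  open import Data.Vec using ([]; _∷_; lookup; tabulate)
  open import Data.Vec.Properties using (lookup∘tabulate; lookup-map; lookup⇒[]=; []=⇒lookup)
  open import Relation.Binary.PropositionalEquality hiding ([_])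
  open import Relation.Nullary using (¬_; Dec; yes; no; ¬?)
  open import Algebra.Properties.CommutativeSemigroup +-commutativeSemigroup using (interchange)
  open Arithmetic
  open Language
  open Rationals using (double-ratio; removed-bound)

  -- Array names; scalars live in cell 0.  As there is no multiplication, rowₐ
  -- tabulates the multiples of n and thresholdₐ the powers of q, which is kept in
  -- growthₐ; boundₐ holds k.
  pattern inputₐ = 0
  pattern adjacencyₐ = 1
  pattern removedₐ = 2
  pattern coloursₐ = 3
  pattern rowₐ = 4
  pattern boundₐ = 5
  pattern thresholdₐ = 6
  pattern growthₐ = 7
  pattern scratchₐ = 8
  pattern activeₐ = 10
  pattern levelₐ = 11
  pattern parentₐ = 12
  pattern parityₐ = 13
  pattern radiusₐ = 14
  pattern sizeₐ = 15
  pattern foundₐ = 16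
  pattern leftₐ = 17
  pattern rightₐ = 18
  pattern phaseₐ = 20
  pattern sourceₐ = 21
  pattern iₐ = 22
  pattern roundₐ = 23
  pattern xₐ = 24
  pattern yₐ = 25

  -- The program text.

  edge : Expr → Expr → Expr
  edge x y = adjacencyₐ ! (rowₐ ! x ⊕ y)

  differ : Expr → Expr → Expr
  differ e f = (e ⊖ f) ⊕ (f ⊖ e)

  offsetStep offsets : Cmd
  offsetStep = rowₐ [ $ iₐ ⊕ lit 1 ]≔ rowₐ ! $ iₐ ⊕ $ inputₐ
  offsets = for iₐ offsetStep

  -- With γ = a/b in input cells 1 and 2, the scratch cell follows `k * a`. The result is the least
  -- integer `k` with k ≥ 1/γ, or `n` if that is smaller.
  radiusBoundStep radiusBound : Cmd
  radiusBoundStep = guard (inputₐ ! lit 2 ⊖ $ scratchₐ ∷ [])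
    ((boundₐ [ lit 0 ]≔ $ boundₐ ⊕ lit 1) ⨟ (scratchₐ [ lit 0 ]≔ $ scratchₐ ⊕ inputₐ ! lit 1))
  radiusBound = for iₐ radiusBoundStep

  multiplyStep multiply powerStep power : Cmd
  multiplyStep = guard ($ growthₐ ⊖ $ xₐ ∷ []) (scratchₐ [ lit 0 ]≔ $ scratchₐ ⊕ thresholdₐ ! $ roundₐ)
  multiply = for xₐ multiplyStep
  powerStep = (scratchₐ [ lit 0 ]≔ lit 0) ⨟ multiply ⨟ (thresholdₐ [ $ roundₐ ⊕ lit 1 ]≔ $ scratchₐ)
  power = for roundₐ powerStep

  -- The values q = 1, 2, ... are tried until q^k ≥ n, and each trial rebuilds the whole table of
  -- powers.
  thresholdStep thresholds : Cmd
  thresholdStep = guard ($ inputₐ ⊖ thresholdₐ ! $ boundₐ ∷ [])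
    ((growthₐ [ lit 0 ]≔ $ growthₐ ⊕ lit 1) ⨟ (thresholdₐ [ lit 0 ]≔ lit 1) ⨟ power)
  thresholds = for iₐ thresholdStep

  unlabelStep unlabel root : Cmd
  unlabelStep = levelₐ [ $ iₐ ]≔ $ inputₐ ⊕ lit 1
  unlabel = for iₐ unlabelStep
  root = (levelₐ [ $ sourceₐ ]≔ lit 0) ⨟ (parentₐ [ $ sourceₐ ]≔ $ sourceₐ) ⨟ (parityₐ [ $ sourceₐ ]≔ lit 0) ⨟
      (radiusₐ [ lit 0 ]≔ lit 0)

  -- Labels change while the loop reads them. A label set in this round fails the test on a parent,
  -- so only one level is added; a vertex just labelled can at most be given another valid parent.
  label growStep grow : Cmd
  label = (levelₐ [ $ xₐ ]≔ $ roundₐ ⊕ lit 1) ⨟ (parentₐ [ $ xₐ ]≔ $ yₐ) ⨟ (parityₐ [ $ xₐ ]≔ lit 1 ⊖ parityₐ ! $ yₐ)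
  growStep = guard
    (activeₐ ! $ xₐ ∷ levelₐ ! $ xₐ ⊖ $ roundₐ ∷ ($ roundₐ ⊕ lit 1) ⊖ levelₐ ! $ yₐ ∷ edge ($ xₐ) ($ yₐ) ∷ [])
    label
  grow = for xₐ (for yₐ growStep)

  countStep count : Cmd
  countStep = guard (($ roundₐ ⊕ lit 2) ⊖ levelₐ ! $ xₐ ∷ []) (sizeₐ [ lit 0 ]≔ $ sizeₐ ⊕ lit 1)
  count = (sizeₐ [ lit 0 ]≔ lit 0) ⨟ for xₐ countStep

  -- Radius 0 encodes that the search is still going on; accepted radii are positive.
  exploreStep explore : Cmd
  exploreStep = cond ($ radiusₐ) skip
    (grow ⨟ count ⨟ cond ($ sizeₐ ⊖ thresholdₐ ! ($ roundₐ ⊕ lit 1)) skip (radiusₐ [ lit 0 ]≔ $ roundₐ ⊕ lit 1))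
  explore = for roundₐ exploreStep

  report conflictStep conflict : Cmd
  report = (foundₐ [ lit 0 ]≔ lit 1) ⨟ (leftₐ [ lit 0 ]≔ $ xₐ) ⨟ (rightₐ [ lit 0 ]≔ $ yₐ)
  conflictStep = guard
    ($ radiusₐ ⊖ levelₐ ! $ xₐ ∷ $ radiusₐ ⊖ levelₐ ! $ yₐ ∷ edge ($ xₐ) ($ yₐ) ∷
     lit 1 ⊖ differ (parityₐ ! $ xₐ) (parityₐ ! $ yₐ) ∷ [])
    report
  conflict = (foundₐ [ lit 0 ]≔ lit 0) ⨟ for xₐ (for yₐ conflictStep)

  climb : ℕ → Cmd
  climb e = (removedₐ [ $ e ]≔ lit 1) ⨟ (activeₐ [ $ e ]≔ lit 0) ⨟ (e [ lit 0 ]≔ parentₐ ! $ e)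

  -- Exactly `k` vertices are visited from either end, whatever its level. The root is its own
  -- parent, so surplus steps only delete the root again.
  removeStep remove : Cmd
  removeStep = guard ($ boundₐ ⊖ $ xₐ ∷ []) (climb leftₐ ⨟ climb rightₐ)
  remove = for xₐ removeStep

  -- Phase p owns the colours 2p + 1 and 2p + 2, and 0 means uncoloured. A vertex whose level equals
  -- the radius is deactivated but not painted: it waits for the next `refill`.
  paint retire colourStep colour : Cmd
  paint = coloursₐ [ $ xₐ ]≔ ($ phaseₐ ⊕ $ phaseₐ) ⊕ (lit 1 ⊕ parityₐ ! $ xₐ)
  retire = (activeₐ [ $ xₐ ]≔ lit 0) ⨟ guard ($ radiusₐ ⊖ levelₐ ! $ xₐ ∷ []) paint
  colourStep = guard (($ radiusₐ ⊕ lit 1) ⊖ levelₐ ! $ xₐ ∷ []) retire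
  colour = for xₐ colourStep

  search carve : Cmd
  search = unlabel ⨟ root ⨟ explore ⨟ conflict
  carve = search ⨟ cond ($ foundₐ) remove colour

  refillStep refill : Cmd
  refillStep = activeₐ [ $ iₐ ]≔ (lit 1 ⊖ removedₐ ! $ iₐ) ⊖ coloursₐ ! $ iₐ
  refill = for iₐ refillStep

  carveStep phase phases : Cmd
  carveStep = guard (activeₐ ! $ sourceₐ ∷ []) carve
  phase = refill ⨟ for sourceₐ carveStep
  phases = for phaseₐ phase

  algorithm : Cmd
  algorithm = offsets ⨟ radiusBound ⨟ thresholds ⨟ phases

  ∸≢0⇒< : ∀ m n → m ∸ n ≢ 0 → n < m
  ∸≢0⇒< m n h with n <? m
  ... | yes n<m = n<m
  ... | no  n≮m = ⊥-elim (h (m≤n⇒m∸n≡0 (≮⇒≥ n≮m)))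

  <⇒∸≢0 : ∀ m n → n < m → m ∸ n ≢ 0
  <⇒∸≢0 m n n<m h = <⇒≱ n<m (m∸n≡0⇒m≤n h)

  ¬guard⇒≡0 : ∀ {σ} e → ¬ All (λ f → ⟦ f ⟧ σ ≢ 0) (e ∷ []) → ⟦ e ⟧ σ ≡ 0
  ¬guard⇒≡0 {σ} e h with ⟦ e ⟧ σ ≟ 0
  ... | yes z = z
  ... | no  z = ⊥-elim (h (z ∷ []))

  -- The precomputed values: row offsets, `k`, and the powers of `q`.

  offsets-correct : ∀ {n} σ → σ inputₐ 0 ≡ n → σ rowₐ 0 ≡ 0 →
                    ∀ i → i ≤ n → sem n offsets σ rowₐ i ≡ i * n
  offsets-correct {n} σ h₀ h₄ = proj₂ (for-induction n iₐ offsetStep σ I refl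
    (h₀ , (λ { zero z≤n → h₄ })) step)
    where
    I : ℕ → Store → Set
    I i τ = τ inputₐ 0 ≡ n × (∀ j → j ≤ i → τ rowₐ j ≡ j * n)
    step : ∀ i τ → i < n → τ iₐ 0 ≡ i → I i τ →
           I (suc i) (bump iₐ (sem n offsetStep τ))
    step .(τ iₐ 0) τ i<n refl (z , inv) = z ,
      put-elim (λ j x → j ≤ suc (τ iₐ 0) → x ≡ j * n) (τ rowₐ) (τ iₐ 0 + 1) (τ rowₐ (τ iₐ 0) + τ inputₐ 0)
        (λ _ → new) (λ j j≢ j≤ → inv j (s≤s⁻¹ (≤∧≢⇒< j≤ (λ e → j≢ (trans e (+-comm 1 _))))))
      where
      new : τ rowₐ (τ iₐ 0) + τ inputₐ 0 ≡ (τ iₐ 0 + 1) * n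
      new = trans (cong₂ _+_ (inv _ ≤-refl) z)
           (trans (+-comm _ n) (cong (_* n) (+-comm 1 (τ iₐ 0))))

  -- As long as the guard succeeds, `k` keeps pace with the loop counter; once it fails, nothing
  -- changes any more. This gives the final alternative.
  radiusBound-correct : ∀ {n} a b σ → σ inputₐ 1 ≡ a → σ inputₐ 2 ≡ b → σ boundₐ 0 ≡ 0 → σ scratchₐ 0 ≡ 0 →
    let k = sem n radiusBound σ boundₐ 0 in
    k ≤ n × (k ≡ 0 ⊎ pred k * a < b) × (k ≡ n ⊎ b ≤ k * a)
  radiusBound-correct {n} a b σ ha hb hk ht = proj₂ (proj₂ (proj₂ (for-induction n iₐ radiusBoundStep σ I refl
    (ha , hb , trans ht (cong (_* a) (sym hk)) , ≤-reflexive hk , inj₁ hk , inj₁ hk) step)))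
    where
    I : ℕ → Store → Set
    I i τ = τ inputₐ 1 ≡ a × τ inputₐ 2 ≡ b × τ scratchₐ 0 ≡ τ boundₐ 0 * a × τ boundₐ 0 ≤ i ×
            (τ boundₐ 0 ≡ 0 ⊎ pred (τ boundₐ 0) * a < b) × (τ boundₐ 0 ≡ i ⊎ b ≤ τ boundₐ 0 * a)
    step : ∀ i τ → i < n → τ iₐ 0 ≡ i → I i τ → I (suc i) (bump iₐ (sem n radiusBoundStep τ))
    step i τ i<n _ (ha , hb , ht , k≤i , low , high) =
      guard-elim n ((boundₐ [ lit 0 ]≔ $ boundₐ ⊕ lit 1) ⨟ (scratchₐ [ lit 0 ]≔ $ scratchₐ ⊕ inputₐ ! lit 1)) τ
          (λ ρ → I (suc i) (bump iₐ ρ)) (inputₐ ! lit 2 ⊖ $ scratchₐ ∷ []) continue stop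
      where
      continue : All (λ e → ⟦ e ⟧ τ ≢ 0) (inputₐ ! lit 2 ⊖ $ scratchₐ ∷ []) → _
      continue (h ∷ []) =
        ha , hb ,
        trans (cong₂ _+_ ht ha) (trans (+-comm _ a) (cong (_* a) (+-comm 1 (τ boundₐ 0)))) ,
        subst (_≤ suc i) (+-comm 1 (τ boundₐ 0)) (s≤s k≤i) ,
        inj₂ (subst (λ x → pred x * a < b) (+-comm 1 (τ boundₐ 0)) ka<b) ,
        inj₁ (trans (+-comm _ 1) (cong suc k≡i))
        where
        ka<b : τ boundₐ 0 * a < b
        ka<b = subst₂ _<_ ht hb (∸≢0⇒< (τ inputₐ 2) (τ scratchₐ 0) h)
        k≡i : τ boundₐ 0 ≡ i
        k≡i = [ (λ e → e) , (λ b≤ → ⊥-elim (<⇒≱ ka<b b≤)) ]′ high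
      stop : ¬ All (λ e → ⟦ e ⟧ τ ≢ 0) (inputₐ ! lit 2 ⊖ $ scratchₐ ∷ []) → _
      stop h = ha , hb , ht , m≤n⇒m≤1+n k≤i , low ,
        inj₂ (subst₂ _≤_ hb ht (m∸n≡0⇒m≤n (¬guard⇒≡0 (inputₐ ! lit 2 ⊖ $ scratchₐ) h)))

  power-correct : ∀ {n} q σ → σ growthₐ 0 ≡ q → q ≤ n → σ thresholdₐ 0 ≡ 1 →
                  ∀ r → r ≤ n → sem n power σ thresholdₐ r ≡ q ^ r
  power-correct {n} q σ hq q≤n h₆ = proj₂ (for-induction n roundₐ powerStep σ I refl
    (hq , λ { zero z≤n → h₆ }) step)
    where
    multiply-correct : ∀ σ → σ scratchₐ 0 ≡ 0 → σ growthₐ 0 ≡ q →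
        sem n multiply σ scratchₐ 0 ≡ q * σ thresholdₐ (σ roundₐ 0)
    multiply-correct σ h₈ h₇ = trans (proj₁ run) (cong₂ _*_ (m≥n⇒m⊓n≡n q≤n) (proj₂ (proj₂ run)))
      where
      -- The loop has `n` rounds and adds only in the first `q` of them, hence `i ⊓ q`. The product
      -- is complete because q ≤ n.
      Partial : ℕ → Store → Set
      Partial i τ = τ scratchₐ 0 ≡ (i ⊓ q) * τ thresholdₐ (τ roundₐ 0) × τ growthₐ 0 ≡ q ×
          τ thresholdₐ (τ roundₐ 0) ≡ σ thresholdₐ (σ roundₐ 0)
      inner : ∀ i τ → i < n → τ xₐ 0 ≡ i → Partial i τ → Partial (suc i) (bump xₐ (sem n multiplyStep τ))
      inner i τ i<n hi (e , hq , h₆) =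
          guard-elim n (scratchₐ [ lit 0 ]≔ $ scratchₐ ⊕ thresholdₐ ! $ roundₐ) τ
          (λ ρ → Partial (suc i) (bump xₐ ρ)) ($ growthₐ ⊖ $ xₐ ∷ [])
        (λ { (h ∷ []) → let i<q = subst₂ _<_ hi hq (∸≢0⇒< (τ growthₐ 0) (τ xₐ 0) h) in
             trans (cong (_+ x) (trans e (cong (_* x) (m≤n⇒m⊓n≡m (<⇒≤ i<q)))))
               (trans (+-comm (i * x) x) (cong (_* x) (sym (m≤n⇒m⊓n≡m i<q)))) , hq , h₆ })
        (λ h → let q≤i = subst₂ _≤_ hq hi (m∸n≡0⇒m≤n {τ growthₐ 0} (¬guard⇒≡0 ($ growthₐ ⊖ $ xₐ) h)) in
           trans e (cong (_* x) (trans (m≥n⇒m⊓n≡n q≤i) (sym (m≥n⇒m⊓n≡n (m≤n⇒m≤1+n q≤i))))) , hq , h₆)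
        where
        x = τ thresholdₐ (τ roundₐ 0)
      run : Partial n (sem n multiply σ)
      run = for-induction n xₐ multiplyStep σ Partial refl (h₈ , h₇ , refl) inner
    I : ℕ → Store → Set
    I i τ = τ growthₐ 0 ≡ q × (∀ r → r ≤ i → τ thresholdₐ r ≡ q ^ r)
    step : ∀ i τ → i < n → τ roundₐ 0 ≡ i → I i τ → I (suc i) (bump roundₐ (sem n powerStep τ))
    step .(τ roundₐ 0) τ i<n refl (hq , th) =
      trans (cong (λ f → f 0) (frame n multiply τ′ growthₐ refl)) hq ,
      subst (λ f → ∀ r → r ≤ suc i → put f (sem n multiply τ′ roundₐ 0 + 1) (sem n multiply τ′ scratchₐ 0) r ≡ q ^ r)
        (sym (frame n multiply τ′ thresholdₐ refl))
        (put-elim (λ r x → r ≤ suc i → x ≡ q ^ r) (τ thresholdₐ) _ _ (λ _ → new)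
          λ r r≢ r≤ → th r (s≤s⁻¹ (≤∧≢⇒< r≤ λ e → r≢ (trans e (sym index)))))
      where
      i = τ roundₐ 0
      τ′ = sem n (scratchₐ [ lit 0 ]≔ lit 0) τ
      index : sem n multiply τ′ roundₐ 0 + 1 ≡ suc i
      index = trans (cong (λ f → f 0 + 1) (frame n multiply τ′ roundₐ refl)) (+-comm i 1)
      new : sem n multiply τ′ scratchₐ 0 ≡ q ^ (sem n multiply τ′ roundₐ 0 + 1)
      new = trans (multiply-correct τ′ refl hq)
           (trans (cong (q *_) (th i ≤-refl)) (cong (q ^_) (sym index)))

  zero-power : ∀ {x k} → 1 ≤ k → x ≡ 0 → x ^ k ≡ 0
  zero-power {k = suc _} _ refl = refl

  -- Since k ≥ 1, q = n already satisfies q^k ≥ n; thus `q` never exceeds `n` and `n` rounds suffice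
  -- for each multiplication by it.
  thresholds-correct : ∀ {n} k σ → 1 ≤ n → 1 ≤ k → k ≤ n → σ inputₐ 0 ≡ n → σ boundₐ 0 ≡ k → σ growthₐ 0 ≡ 0 →
      σ thresholdₐ k ≡ 0 →
    let q = sem n thresholds σ growthₐ 0 in
    1 ≤ q × (∀ r → r ≤ n → sem n thresholds σ thresholdₐ r ≡ q ^ r) × n ≤ q ^ k × pred q ^ k < n
  thresholds-correct {n} k σ 1≤n 1≤k k≤n h₀ h₅ h₇ h₆ = finish (for-induction n iₐ thresholdStep σ I refl
    -- Before the first trial the table is blank, but its entry at `k` is already right: 0^k = 0 for
    -- k ≥ 1.
    (h₀ , h₅ , ≤-reflexive h₇ , trans h₆ (sym (0^k h₇)) , subst (_< n) (sym (0^k (cong pred h₇))) 1≤n ,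
        inj₁ h₇ , inj₂ h₇) step)
    where
    0^k : ∀ {x} → x ≡ 0 → x ^ k ≡ 0
    0^k = zero-power 1≤k
    I : ℕ → Store → Set
    I i τ = let q = τ growthₐ 0 in
            τ inputₐ 0 ≡ n × τ boundₐ 0 ≡ k × q ≤ i × τ thresholdₐ k ≡ q ^ k × pred q ^ k < n ×
            (q ≡ 0 ⊎ (∀ r → r ≤ n → τ thresholdₐ r ≡ q ^ r)) × (n ≤ q ^ k ⊎ q ≡ i)
    step : ∀ i τ → i < n → τ iₐ 0 ≡ i → I i τ → I (suc i) (bump iₐ (sem n thresholdStep τ))
    step i τ i<n _ (h₀ , h₅ , q≤i , hk , low , th , high) =
      guard-elim n ((growthₐ [ lit 0 ]≔ $ growthₐ ⊕ lit 1) ⨟ (thresholdₐ [ lit 0 ]≔ lit 1) ⨟ power) τ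
          (λ ρ → I (suc i) (bump iₐ ρ)) ($ inputₐ ⊖ thresholdₐ ! $ boundₐ ∷ [])
      (λ { (h ∷ []) →
        let q^k<n = subst₂ _<_ (trans (cong (τ thresholdₐ) h₅) hk) h₀ (∸≢0⇒< (τ inputₐ 0) _ h) in
        trans (cong (λ f → f 0) (frame n power τ′ inputₐ refl)) h₀ ,
        trans (cong (λ f → f 0) (frame n power τ′ boundₐ refl)) h₅ ,
        subst (_≤ suc i) (sym q′) (s≤s q≤i) ,
        subst (λ x → sem n power τ′ thresholdₐ k ≡ x ^ k) (sym q′) (powers k k≤n) ,
        subst (λ x → pred x ^ k < n) (sym q′) q^k<n ,
        inj₂ (λ r r≤n → trans (powers r r≤n) (cong (_^ r) (sym q′))) ,
        inj₂ (trans q′ (cong suc (q≡i q^k<n))) })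
      (λ h → h₀ , h₅ , m≤n⇒m≤1+n q≤i , hk , low , th ,
        inj₁ (subst₂ _≤_ h₀ (trans (cong (τ thresholdₐ) h₅) hk)
               (m∸n≡0⇒m≤n (¬guard⇒≡0 ($ inputₐ ⊖ thresholdₐ ! $ boundₐ) h))))
      where
      τ′ = sem n ((growthₐ [ lit 0 ]≔ $ growthₐ ⊕ lit 1) ⨟ (thresholdₐ [ lit 0 ]≔ lit 1)) τ
      q′ : sem n power τ′ growthₐ 0 ≡ suc (τ growthₐ 0)
      q′ = trans (cong (λ f → f 0) (frame n power τ′ growthₐ refl)) (+-comm (τ growthₐ 0) 1)
      powers : ∀ r → r ≤ n → sem n power τ′ thresholdₐ r ≡ suc (τ growthₐ 0) ^ r
      powers = power-correct (suc (τ growthₐ 0)) τ′ (+-comm (τ growthₐ 0) 1) (≤-trans (s≤s q≤i) i<n) refl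
      q≡i : τ growthₐ 0 ^ k < n → τ growthₐ 0 ≡ i
      q≡i lt = [ (λ ge → ⊥-elim (<⇒≱ lt ge)) , (λ e → e) ]′ high
    finish : I n (sem n thresholds σ) → _
    finish (_ , _ , q≤n , hk , low , th , high) = 1≤q , powers th , n≤q^k , low
      where
      q = sem n thresholds σ growthₐ 0
      n≤q^k : n ≤ q ^ k
      n≤q^k = [ (λ ge → ge) , (λ e → subst (λ x → n ≤ x ^ k) (sym e)
        (subst (_≤ n ^ k) (^-identityʳ n) (^-monoʳ-≤ n {{>-nonZero 1≤n}} 1≤k))) ]′ high
      1≤q : 1 ≤ q
      1≤q = n≢0⇒n>0 λ e → <⇒≱ 1≤n (subst (n ≤_) (0^k e) n≤q^k)
      powers : (q ≡ 0 ⊎ (∀ r → r ≤ n → sem n thresholds σ thresholdₐ r ≡ q ^ r)) →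
               ∀ r → r ≤ n → sem n thresholds σ thresholdₐ r ≡ q ^ r
      powers (inj₁ e) = ⊥-elim (<⇒≱ 1≤q (≤-reflexive e))
      powers (inj₂ th) = th

  -- Growing a tree around a vertex.

  sgn : ℕ → ℕ
  sgn zero    = 0
  sgn (suc _) = 1

  sgn≤1 : ∀ m → sgn m ≤ 1
  sgn≤1 zero    = z≤n
  sgn≤1 (suc m) = ≤-refl

  sgn-pos : ∀ {m} → m ≢ 0 → sgn m ≡ 1
  sgn-pos {zero}  h = ⊥-elim (h refl)
  sgn-pos {suc m} h = refl

  -- The comparison with `ρ` is strict: a ball of radius r in the usual sense is
  -- `ball n level (suc r)`.
  ball : ℕ → (ℕ → ℕ) → ℕ → ℕ
  ball n level ρ = ∑ n (λ x → sgn (ρ ∸ level x))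

  ball≤n : ∀ n level ρ → ball n level ρ ≤ n
  ball≤n n level ρ = subst (ball n level ρ ≤_) (trans (∑-const n 1) (*-identityʳ n))
    (∑-mono n (λ x _ → sgn≤1 (ρ ∸ level x)))

  -- Vertices outside the tree have level n + 1.
  Node : ℕ → (ℕ → ℕ → ℕ) → ℕ → ℕ → (active level parent parity : ℕ → ℕ) → ℕ → Set
  Node n E v m active level parent parity x = level x ≡ suc n ⊎
    (level x ≤ m × active x ≢ 0 ×
      (x ≡ v ⊎ (parent x < n × level (parent x) < level x × E x (parent x) ≢ 0 ×
                parity x ≡ 1 ∸ parity (parent x))))

  -- `m` bounds the levels and thereby the length of a path to the root, because levels drop
  -- strictly towards it. Nothing is claimed about distances in the graph.
  record Tree (n : ℕ) (E : ℕ → ℕ → ℕ) (v m : ℕ) (active level parent parity : ℕ → ℕ) : Set where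
    field
      root-level  : level v ≡ 0
      root-parent : parent v ≡ v
      root-parity : parity v ≡ 0
      node        : ∀ x → x < n → Node n E v m active level parent parity x

  open Tree

  Tree-weaken : ∀ {n E v m active level parent parity} →
    Tree n E v m active level parent parity → Tree n E v (suc m) active level parent parity
  Tree-weaken t .root-level  = t .root-level
  Tree-weaken t .root-parent = t .root-parent
  Tree-weaken t .root-parity = t .root-parity
  Tree-weaken t .node x x<n with t .node x x<n
  ... | inj₁ e            = inj₁ e
  ... | inj₂ (l≤ , a , h) = inj₂ (m≤n⇒m≤1+n l≤ , a , h)

  -- No other node depends on `x`: a parent has a level below that of its child, so at most `r`,
  -- whereas `x` lies above level `r`.
  Tree-label : ∀ {n E v active level parent parity x y} r m → m ≡ suc r →
    Tree n E v m active level parent parity → y < n → active x ≢ 0 →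
    r < level x → level y ≤ r → E x y ≢ 0 →
    Tree n E v m active (put level x m) (put parent x y) (put parity x (1 ∸ parity y))
  Tree-label {n} {E} {v} {active} {level} {parent} {parity} {x} {y} r m refl t y<n ax r<x y≤r Exy = record
    { root-level  = trans (put-there level x m v v≢x) (t .root-level)
    ; root-parent = trans (put-there parent x y v v≢x) (t .root-parent)
    ; root-parity = trans (put-there parity x _ v v≢x) (t .root-parity)
    ; node        = node′
    }
    where
    lower⇒≢x : ∀ {z} → level z ≤ r → z ≢ x
    lower⇒≢x z≤r refl = <⇒≱ r<x z≤r
    v≢x : v ≢ x
    v≢x = lower⇒≢x (subst (_≤ r) (sym (t .root-level)) z≤n)
    node′ : ∀ z → z < n → Node n E v m active (put level x m) (put parent x y) (put parity x (1 ∸ parity y)) z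
    node′ z z<n with z ≟ x
    ... | yes refl rewrite put-here level z m | put-here parent z y | put-here parity z (1 ∸ parity y)
                         | put-there level z m y (lower⇒≢x y≤r) | put-there parity z (1 ∸ parity y) y (lower⇒≢x y≤r) =
      inj₂ (≤-refl , ax , inj₂ (y<n , s≤s y≤r , Exy , refl))
    ... | no z≢x rewrite put-there level x m z z≢x | put-there parent x y z z≢x | put-there parity x (1 ∸ parity y) z z≢x
      with t .node z z<n
    ...   | inj₁ e = inj₁ e
    ...   | inj₂ (z≤ , az , inj₁ z≡v) = inj₂ (z≤ , az , inj₁ z≡v)
    ...   | inj₂ (z≤ , az , inj₂ (p<n , lp< , Ezp , eq)) = inj₂ (z≤ , az , inj₂
      (p<n , subst (_< level z) (sym (put-there level x m _ p≢x)) lp< , Ezp ,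
       trans eq (cong (1 ∸_) (sym (put-there parity x _ _ p≢x)))))
      where
      p≢x : parent z ≢ x
      p≢x = lower⇒≢x (s≤s⁻¹ (≤-trans lp< z≤))

  Adjacency : ℕ → (ℕ → ℕ → ℕ) → Store → Set
  Adjacency n E τ = ∀ x y → x < n → y < n → τ adjacencyₐ (τ rowₐ x + y) ≡ E x y

  -- Every active neighbour of the inner ball is in the tree. Once the inner ball is coloured and
  -- the tree deactivated, no active vertex is adjacent to the new colours.
  Closed : ℕ → (ℕ → ℕ → ℕ) → ℕ → (active level : ℕ → ℕ) → Set
  Closed n E ρ active level =
    ∀ x y → x < n → y < n → active x ≢ 0 → level y < ρ → E x y ≢ 0 → level x ≤ ρ

  -- Truncated subtraction sends all levels above `r` to 0, so the middle component says that levels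
  -- up to `r` are untouched. It carries the size of the previous ball over to the enlarged tree.
  grow-correct : ∀ {n E v} σ → let r = σ roundₐ 0 ; τ = sem n grow σ in
    Adjacency n E σ → Tree n E v r (σ activeₐ) (σ levelₐ) (σ parentₐ) (σ parityₐ) →
    Tree n E v (suc r) (σ activeₐ) (τ levelₐ) (τ parentₐ) (τ parityₐ) ×
    (∀ x → suc r ∸ τ levelₐ x ≡ suc r ∸ σ levelₐ x) ×
    Closed n E (suc r) (σ activeₐ) (τ levelₐ)
  grow-correct {n} {E} {v} σ adj tree =
    let ((_ , _ , _ , tree′ , same) , closed) = run in
    tree′ , same , λ x y x<n y<n ax y< → closed x y x<n y<n ax (s≤s⁻¹ y<)
    where
    r = σ roundₐ 0
    K : Store → Set
    K τ = τ activeₐ ≡ σ activeₐ × τ roundₐ 0 ≡ r × Adjacency n E τ ×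
          Tree n E v (suc r) (σ activeₐ) (τ levelₐ) (τ parentₐ) (τ parityₐ) ×
          (∀ x → suc r ∸ τ levelₐ x ≡ suc r ∸ σ levelₐ x)
    Q : ℕ → ℕ → Store → Set
    Q x y τ = σ activeₐ x ≢ 0 → τ levelₐ y ≤ r → E x y ≢ 0 → τ levelₐ x ≤ suc r
    step : ∀ τ → τ xₐ 0 < n → τ yₐ 0 < n → K τ →
       K (sem n growStep τ) × Q (τ xₐ 0) (τ yₐ 0) (sem n growStep τ) ×
       (∀ i j → i < n → j < n → Q i j τ → Q i j (sem n growStep τ))
    step τ x<n y<n (hU , hr , adj , tree , same) =
      guard-elim n label τ
        (λ ρ → K ρ × Q x y ρ × (∀ i j → i < n → j < n → Q i j τ → Q i j ρ)) tests yes′ no′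
      where
      x = τ xₐ 0
      y = τ yₐ 0
      level = τ levelₐ
      tests = activeₐ ! $ xₐ ∷ levelₐ ! $ xₐ ⊖ $ roundₐ ∷ ($ roundₐ ⊕ lit 1) ⊖ levelₐ ! $ yₐ ∷ edge ($ xₐ) ($ yₐ) ∷ []
      r+1 : τ roundₐ 0 + 1 ≡ suc r
      r+1 = trans (+-comm _ 1) (cong suc hr)
      yes′ : All (λ e → ⟦ e ⟧ τ ≢ 0) tests → _
      yes′ (h₁ ∷ h₂ ∷ h₃ ∷ h₄ ∷ []) =
        (hU , hr , adj ,
         subst (λ m → Tree n E v (suc r) (σ activeₐ) (put level x m) (put (τ parentₐ) x y)
             (put (τ parityₐ) x (1 ∸ τ parityₐ y))) (sym r+1)
           (Tree-label r (suc r) refl tree y<n (subst (λ U → U x ≢ 0) hU h₁) r<x y≤r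
             (subst (_≢ 0) (adj x y x<n y<n) h₄)) ,
         λ z → trans (put-elim (λ z l → suc r ∸ l ≡ suc r ∸ level z) level x (τ roundₐ 0 + 1)
                        (trans (trans (cong (suc r ∸_) r+1) (n∸n≡0 (suc r))) (sym (m≤n⇒m∸n≡0 r<x)))
                        (λ _ _ → refl) z)
                     (same z)) ,
        (λ _ _ _ → ≤-reflexive (trans (put-here level x _) r+1)) ,
        λ i j i<n j<n q ai → put-elim
          (λ j l → (level j ≤ r → E i j ≢ 0 → level i ≤ suc r) → l ≤ r → E i j ≢ 0 →
              put level x (τ roundₐ 0 + 1) i ≤ suc r)
          level x (τ roundₐ 0 + 1)
          (λ _ l≤r → ⊥-elim (<⇒≱ (≤-reflexive (sym r+1)) l≤r))
          (λ j j≢x q l≤r Eij → put-elim (λ i l → level i ≤ suc r → l ≤ suc r) level x (τ roundₐ 0 + 1)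
            (λ _ → ≤-reflexive r+1) (λ _ _ h → h) i (q l≤r Eij))
          j (q ai)
        where
        r<x : r < level x
        r<x = subst (_< level x) hr (∸≢0⇒< (level x) (τ roundₐ 0) h₂)
        y≤r : level y ≤ r
        y≤r = s≤s⁻¹ (subst (level y <_) r+1 (∸≢0⇒< (τ roundₐ 0 + 1) (level y) h₃))
      no′ : ¬ All (λ e → ⟦ e ⟧ τ ≢ 0) tests → _
      no′ h = (hU , hr , adj , tree , same) , closed , λ _ _ _ _ q → q
        where
        closed : Q x y τ
        closed ax y≤r Exy with level x ≤? suc r
        ... | yes x≤ = x≤
        ... | no  x≰ = ⊥-elim (h (
          subst (λ U → U x ≢ 0) (sym hU) ax ∷
          <⇒∸≢0 _ _ (subst (_< level x) (sym hr) (<⇒≤ (≰⇒> x≰))) ∷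
          <⇒∸≢0 _ _ (subst (level y <_) (sym r+1) (s≤s y≤r)) ∷
          subst (_≢ 0) (sym (adj x y x<n y<n)) Exy ∷ []))
    run = for-each₂ n xₐ yₐ growStep σ K Q refl refl (λ _ _ k → k) (λ _ _ k → k)
      (λ _ _ _ _ q → q) (λ _ _ _ _ q → q)
      (refl , refl , adj , Tree-weaken tree , λ _ → refl) step

  count-correct : ∀ {n} σ → sem n count σ sizeₐ 0 ≡ ball n (σ levelₐ) (2 + σ roundₐ 0)
  count-correct {n} σ = proj₂ (proj₂ (for-induction n xₐ countStep (update σ sizeₐ 0 0) I refl
    (refl , refl , refl) step))
    where
    I : ℕ → Store → Set
    I i τ = τ levelₐ ≡ σ levelₐ × τ roundₐ 0 ≡ σ roundₐ 0 × τ sizeₐ 0 ≡ ∑ i (λ x → sgn (2 + σ roundₐ 0 ∸ σ levelₐ x))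
    step : ∀ i τ → i < n → τ xₐ 0 ≡ i → I i τ → I (suc i) (bump xₐ (sem n countStep τ))
    step i τ i<n hi (h₁₁ , h₂₃ , h₁₅) =
      guard-elim n (sizeₐ [ lit 0 ]≔ $ sizeₐ ⊕ lit 1) τ (λ ρ → I (suc i) (bump xₐ ρ))
          (($ roundₐ ⊕ lit 2) ⊖ levelₐ ! $ xₐ ∷ [])
        (λ { (h ∷ []) → h₁₁ , h₂₃ , cong₂ _+_ h₁₅ (sym (sgn-pos (subst (_≢ 0) test h))) })
        (λ h → h₁₁ , h₂₃ , trans h₁₅ (sym
            (trans (cong (λ z → ∑ i (λ x → sgn (2 + σ roundₐ 0 ∸ σ levelₐ x)) + sgn z)
            (trans (sym test) (¬guard⇒≡0 (($ roundₐ ⊕ lit 2) ⊖ levelₐ ! $ xₐ) h))) (+-identityʳ _))))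
      where
      test : (τ roundₐ 0 + 2) ∸ τ levelₐ (τ xₐ 0) ≡ 2 + σ roundₐ 0 ∸ σ levelₐ i
      test = cong₂ _∸_ (trans (+-comm _ 2) (cong (2 +_) h₂₃)) (trans (cong (τ levelₐ) hi) (cong (λ f → f i) h₁₁))

  record Explored (n : ℕ) (E : ℕ → ℕ → ℕ) (q v ρ : ℕ) (active level parent parity : ℕ → ℕ) : Set where
    field
      tree   : Tree n E v ρ active level parent parity
      closed : Closed n E ρ active level
      growth : ball n level (suc ρ) ≤ q * ball n level ρ

  -- During the search q^r ≤ ball(r+1). Either the grown ball exceeds q^(r+1), which renews this
  -- bound, or ball(r+2) ≤ q·q^r ≤ q·ball(r+1) and the radius is accepted. The first case is
  -- impossible at r + 1 = k, because q^k ≥ n.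
  explore-correct : ∀ {n E} k q v σ → 1 ≤ k → k ≤ n → n ≤ q ^ k →
    Adjacency n E σ → (∀ r → r ≤ n → σ thresholdₐ r ≡ q ^ r) → σ radiusₐ 0 ≡ 0 → v < n →
    Tree n E v 0 (σ activeₐ) (σ levelₐ) (σ parentₐ) (σ parityₐ) →
    let τ = sem n explore σ ; ρ = τ radiusₐ 0 in
    1 ≤ ρ × ρ ≤ k × Explored n E q v ρ (σ activeₐ) (τ levelₐ) (τ parentₐ) (τ parityₐ)
  explore-correct {n} {E} k q v σ 1≤k k≤n n≤q^k adj th h₁₄ v<n tree₀ =
    finish (for-induction n roundₐ exploreStep σ I refl
      (refl , adj , th , inj₁ (h₁₄ , tree₀ , 1≤k , root∈)) step)
    where
    root∈ : 1 ≤ ball n (σ levelₐ) 1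
    root∈ = ≤-trans (≤-reflexive (cong (λ l → sgn (1 ∸ l)) (sym (tree₀ .root-level))))
                    (≤∑ n (λ x → sgn (1 ∸ σ levelₐ x)) v v<n)
    Searching Done : ℕ → Store → Set
    Searching r τ = τ radiusₐ 0 ≡ 0 × Tree n E v r (σ activeₐ) (τ levelₐ) (τ parentₐ) (τ parityₐ) × r < k ×
        q ^ r ≤ ball n (τ levelₐ) (suc r)
    Done r τ = 1 ≤ τ radiusₐ 0 × τ radiusₐ 0 ≤ k ×
        Explored n E q v (τ radiusₐ 0) (σ activeₐ) (τ levelₐ) (τ parentₐ) (τ parityₐ)
    I : ℕ → Store → Set
    I r τ = τ activeₐ ≡ σ activeₐ × Adjacency n E τ × (∀ r → r ≤ n → τ thresholdₐ r ≡ q ^ r) × (Searching r τ ⊎ Done r τ)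
    finish : I n (sem n explore σ) → _
    finish (_ , _ , _ , inj₁ (_ , _ , n<k , _)) = ⊥-elim (<⇒≱ n<k k≤n)
    finish (_ , _ , _ , inj₂ done)              = done
    step : ∀ r τ → r < n → τ roundₐ 0 ≡ r → I r τ → I (suc r) (bump roundₐ (sem n exploreStep τ))
    step r τ r<n hr (hU , adj , th , inj₂ done) =
      branch-elim (λ ρ → I (suc r) (bump roundₐ ρ)) (τ radiusₐ 0)
        (λ _ → hU , adj , th , inj₂ done)
        (λ e → ⊥-elim (<⇒≢ (proj₁ done) (sym e)))
    step .(τ roundₐ 0) τ r<n refl (hU , adj , th , inj₁ (e , tree , r<k , low)) =
      branch-elim (λ ρ → I (suc r) (bump roundₐ ρ)) (τ radiusₐ 0) (λ ne → ⊥-elim (ne e)) (λ _ →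
        branch-elim (λ ρ → I (suc r) (bump roundₐ ρ)) (τ″ sizeₐ 0 ∸ τ″ thresholdₐ (τ″ roundₐ 0 + 1))
          (λ h →
            let large = subst₂ _<_ limit size (∸≢0⇒< (τ″ sizeₐ 0) _ h) in
            U″ , adj″ , th″ , inj₁
            (trans (cong (λ f → f 0) (unchanged radiusₐ refl refl)) e , tree″ , r+1<k large ,
             subst (λ l → q ^ suc r ≤ ball n l (2 + r)) (sym f₁₁) (<⇒≤ large)))
          (λ h → U″ , adj″ , th″ , inj₂
            (subst (λ ρ → 1 ≤ ρ × ρ ≤ k × Explored n E q v ρ (σ activeₐ) (τ″ levelₐ) (τ″ parentₐ) (τ″ parityₐ)) (sym r+1)
              (s≤s z≤n , r<k , record { tree = tree″
                                      ; closed = subst (Closed n E (suc r) (σ activeₐ)) (sym f₁₁) closed′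
                                      ; growth = growth (subst₂ _≤_ size limit (m∸n≡0⇒m≤n h)) }))))
      where
      r = τ roundₐ 0
      τ′ = sem n grow τ
      τ″ = sem n count τ′
      unchanged : ∀ b → assigns b grow ≡ false → assigns b count ≡ false → τ″ b ≡ τ b
      unchanged b g c = trans (frame n count τ′ b c) (frame n grow τ b g)
      f₁₁ : τ″ levelₐ ≡ τ′ levelₐ
      f₁₁ = frame n count τ′ levelₐ refl
      U″ : τ″ activeₐ ≡ σ activeₐ
      U″ = trans (unchanged activeₐ refl refl) hU
      adj″ : Adjacency n E τ″
      adj″ = subst₂ (λ f g → ∀ x y → x < n → y < n → f (g x + y) ≡ E x y)
        (sym (unchanged adjacencyₐ refl refl)) (sym (unchanged rowₐ refl refl)) adj
      th″ : ∀ r → r ≤ n → τ″ thresholdₐ r ≡ q ^ r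
      th″ r r≤n = trans (cong (λ f → f r) (unchanged thresholdₐ refl refl)) (th r r≤n)
      grown = grow-correct τ adj (subst (λ U → Tree n E v r U (τ levelₐ) (τ parentₐ) (τ parityₐ)) (sym hU) tree)
      tree″ : Tree n E v (suc r) (σ activeₐ) (τ″ levelₐ) (τ″ parentₐ) (τ″ parityₐ)
      tree″ rewrite frame n count τ′ levelₐ refl | frame n count τ′ parentₐ refl | frame n count τ′ parityₐ refl =
        subst (λ U → Tree n E v (suc r) U (τ′ levelₐ) (τ′ parentₐ) (τ′ parityₐ)) hU (proj₁ grown)
      closed′ : Closed n E (suc r) (σ activeₐ) (τ′ levelₐ)
      closed′ = subst (λ U → Closed n E (suc r) U (τ′ levelₐ)) hU (proj₂ (proj₂ grown))
      r+1 : τ″ roundₐ 0 + 1 ≡ suc r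
      r+1 = trans (+-comm _ 1) (cong (λ f → suc (f 0)) (unchanged roundₐ refl refl))
      size : τ″ sizeₐ 0 ≡ ball n (τ′ levelₐ) (2 + r)
      size = trans (count-correct {n} τ′) (cong (λ f → ball n (τ′ levelₐ) (2 + f 0)) (frame n grow τ roundₐ refl))
      limit : τ″ thresholdₐ (τ″ roundₐ 0 + 1) ≡ q ^ suc r
      limit = trans (cong (τ″ thresholdₐ) r+1) (th″ (suc r) r<n)
      r+1<k : q ^ suc r < ball n (τ′ levelₐ) (2 + r) → suc r < k
      r+1<k large = ≤∧≢⇒< r<k λ { refl → <⇒≱ (<-≤-trans large (ball≤n n (τ′ levelₐ) (2 + r))) n≤q^k }
      growth : ball n (τ′ levelₐ) (2 + r) ≤ q ^ suc r → ball n (τ″ levelₐ) (2 + r) ≤ q * ball n (τ″ levelₐ) (suc r)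
      growth small = begin
        ball n (τ″ levelₐ) (2 + r)        ≡⟨ cong (λ l → ball n l (2 + r)) f₁₁ ⟩
        ball n (τ′ levelₐ) (2 + r)        ≤⟨ small ⟩
        q * q ^ r                     ≤⟨ *-monoʳ-≤ q low ⟩
        q * ball n (τ levelₐ) (suc r)     ≡⟨ cong (q *_)
            (∑-cong n (λ x _ → cong sgn (trans (cong (λ l → suc r ∸ l x) f₁₁) (proj₁ (proj₂ grown) x)))) ⟨
        q * ball n (τ″ levelₐ) (suc r)    ∎
        where open ≤-Reasoning

  start-correct : ∀ {n E} σ → let v = σ sourceₐ 0 ; τ = sem n (unlabel ⨟ root) σ in
    σ inputₐ 0 ≡ n → v < n → σ activeₐ v ≢ 0 → Tree n E v 0 (σ activeₐ) (τ levelₐ) (τ parentₐ) (τ parityₐ)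
  start-correct {n} {E} σ h₀ v<n av = subst (λ w → Tree n E w 0 (σ activeₐ) (put (σ′ levelₐ) (σ′ sourceₐ 0) 0)
      (put (σ′ parentₐ) (σ′ sourceₐ 0) (σ′ sourceₐ 0)) (put (σ′ parityₐ) (σ′ sourceₐ 0) 0)) same record
    { root-level  = put-here (σ′ levelₐ) v′ 0
    ; root-parent = put-here (σ′ parentₐ) v′ v′
    ; root-parity = put-here (σ′ parityₐ) v′ 0
    ; node        = node′
    }
    where
    v = σ sourceₐ 0
    σ′ = sem n unlabel σ
    v′ = σ′ sourceₐ 0
    same : v′ ≡ v
    same = cong (λ f → f 0) (frame n unlabel σ sourceₐ refl)
    unlabelled : sem n unlabel σ inputₐ 0 ≡ n × (∀ x → x < n → sem n unlabel σ levelₐ x ≡ suc n)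
    unlabelled = for-each n iₐ unlabelStep σ (λ τ → τ inputₐ 0 ≡ n) (λ x τ → τ levelₐ x ≡ suc n) refl
      (λ _ _ h → h) (λ _ _ _ h → h) h₀
      (λ τ x<n h₀ → h₀ , trans (put-here (τ levelₐ) (τ iₐ 0) _) (n+1 τ h₀) ,
        λ i _ h → put-elim (λ i l → τ levelₐ i ≡ suc n → l ≡ suc n) (τ levelₐ) (τ iₐ 0) (τ inputₐ 0 + 1)
          (λ _ → n+1 τ h₀) (λ _ _ h → h) i h)
      where
      n+1 : ∀ τ → τ inputₐ 0 ≡ n → τ inputₐ 0 + 1 ≡ suc n
      n+1 τ h = trans (+-comm _ 1) (cong suc h)
    node′ : ∀ x → x < n → Node n E v′ 0 (σ activeₐ) (put (σ′ levelₐ) v′ 0) (put (σ′ parentₐ) v′ v′)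
        (put (σ′ parityₐ) v′ 0) x
    node′ x x<n with x ≟ v′
    ... | yes refl = inj₂ (≤-reflexive (put-here (σ′ levelₐ) v′ 0) ,
        subst (λ w → σ activeₐ w ≢ 0) (sym same) av , inj₁ refl)
    ... | no  x≢v  = inj₁ (trans (put-there (σ′ levelₐ) v′ 0 x x≢v) (proj₂ unlabelled x x<n))

  -- Edges inside the inner ball whose ends have equal parity.

  equal-test : ∀ {a b} → a ≡ b → 1 ∸ ((a ∸ b) + (b ∸ a)) ≢ 0
  equal-test {a} refl h rewrite n∸n≡0 a = 0≢1+n (sym h)

  equal-test⁻¹ : ∀ a b → 1 ∸ ((a ∸ b) + (b ∸ a)) ≢ 0 → a ≡ b
  equal-test⁻¹ a b h = ≤-antisym (m∸n≡0⇒m≤n (m+n≡0⇒m≡0 (a ∸ b) zero-sum))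
                                 (m∸n≡0⇒m≤n (m+n≡0⇒n≡0 (a ∸ b) zero-sum))
    where
    zero-sum : (a ∸ b) + (b ∸ a) ≡ 0
    zero-sum = n<1⇒n≡0 (∸≢0⇒< 1 _ h)

  Monochromatic : ℕ → (ℕ → ℕ → ℕ) → ℕ → (level parity : ℕ → ℕ) → ℕ → ℕ → Set
  Monochromatic n E ρ level parity x y =
    x < n × y < n × level x < ρ × level y < ρ × E x y ≢ 0 × parity x ≡ parity y

  conflict-correct : ∀ {n E} σ → Adjacency n E σ → let τ = sem n conflict σ in
    (τ foundₐ 0 ≡ 0 × (∀ x y → ¬ Monochromatic n E (σ radiusₐ 0) (σ levelₐ) (σ parityₐ) x y)) ⊎
    (τ foundₐ 0 ≢ 0 × Monochromatic n E (σ radiusₐ 0) (σ levelₐ) (σ parityₐ) (τ leftₐ 0) (τ rightₐ 0))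
  conflict-correct {n} {E} σ adj = finish run
    where
    Bad : ℕ → ℕ → Set
    Bad = Monochromatic n E (σ radiusₐ 0) (σ levelₐ) (σ parityₐ)
    K : Store → Set
    K τ = τ levelₐ ≡ σ levelₐ × τ parityₐ ≡ σ parityₐ × τ radiusₐ 0 ≡ σ radiusₐ 0 × Adjacency n E τ ×
          (τ foundₐ 0 ≡ 0 ⊎ (τ foundₐ 0 ≢ 0 × Bad (τ leftₐ 0) (τ rightₐ 0)))
    Q : ℕ → ℕ → Store → Set
    Q x y τ = τ foundₐ 0 ≡ 0 → ¬ Bad x y
    run : K (sem n conflict σ) × (∀ x y → x < n → y < n → Q x y (sem n conflict σ))
    run = for-each₂ n xₐ yₐ conflictStep (update σ foundₐ 0 0) K Q refl refl (λ _ _ k → k) (λ _ _ k → k)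
      (λ _ _ _ _ q → q) (λ _ _ _ _ q → q) (refl , refl , refl , adj , inj₁ refl)
      λ τ x<n y<n (h₁₁ , h₁₃ , h₁₄ , adj , found) →
        guard-elim n report τ
          (λ ρ → K ρ × Q (τ xₐ 0) (τ yₐ 0) ρ × (∀ i j → i < n → j < n → Q i j τ → Q i j ρ)) tests
          (λ { (a ∷ b ∷ c ∷ d ∷ []) →
            (h₁₁ , h₁₃ , h₁₄ , adj , inj₂ ((λ ()) , x<n , y<n ,
              subst₂ _<_ (cong (λ f → f (τ xₐ 0)) h₁₁) h₁₄ (∸≢0⇒< _ (τ levelₐ (τ xₐ 0)) a) ,
              subst₂ _<_ (cong (λ f → f (τ yₐ 0)) h₁₁) h₁₄ (∸≢0⇒< _ (τ levelₐ (τ yₐ 0)) b) ,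
              subst (_≢ 0) (adj _ _ x<n y<n) c ,
              subst (λ f → f (τ xₐ 0) ≡ f (τ yₐ 0)) h₁₃ (equal-test⁻¹ _ _ d))) ,
            (λ ()) , λ _ _ _ _ _ () })
          (λ h → (h₁₁ , h₁₃ , h₁₄ , adj , found) ,
            (λ _ (_ , _ , a , b , c , d) → h (
              <⇒∸≢0 (τ radiusₐ 0) _ (subst₂ _<_ (cong (λ f → f (τ xₐ 0)) (sym h₁₁)) (sym h₁₄) a) ∷
              <⇒∸≢0 (τ radiusₐ 0) _ (subst₂ _<_ (cong (λ f → f (τ yₐ 0)) (sym h₁₁)) (sym h₁₄) b) ∷
              subst (_≢ 0) (sym (adj _ _ x<n y<n)) c ∷
              equal-test (subst (λ f → f (τ xₐ 0) ≡ f (τ yₐ 0)) (sym h₁₃) d) ∷ [])) ,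
            λ _ _ _ _ q → q)
      where
      tests = $ radiusₐ ⊖ levelₐ ! $ xₐ ∷ $ radiusₐ ⊖ levelₐ ! $ yₐ ∷ edge ($ xₐ) ($ yₐ) ∷
              lit 1 ⊖ differ (parityₐ ! $ xₐ) (parityₐ ! $ yₐ) ∷ []
    finish : K (sem n conflict σ) × (∀ x y → x < n → y < n → Q x y (sem n conflict σ)) → _
    finish ((_ , _ , _ , _ , inj₁ z) , q) = inj₁ (z , λ x y b → q x y (proj₁ b) (proj₁ (proj₂ b)) z b)
    finish ((_ , _ , _ , _ , inj₂ w) , q) = inj₂ w

  iterate-suc : ∀ {A : Set} (f : A → A) m x → iterate (suc m) f x ≡ f (iterate m f x)
  iterate-suc f zero    x = refl
  iterate-suc f (suc m) x = iterate-suc f m (f x)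

  -- Tree paths and closed odd walks.

  module Ancestors {n E v m active level parent parity}
    (tree : Tree n E v m active level parent parity) (m≤n : m ≤ n) where

    Within : ℕ → ℕ → Set
    Within d x = x < n × level x ≤ d

    -- The bounds d ≤ m ≤ n exclude the level n + 1 of vertices outside the tree. Away from the root
    -- each step lowers `d`, so `d` steps reach the root.
    parent-within : ∀ {d x} → d ≤ m → Within d x → x ≡ v ⊎
      (Within (pred d) (parent x) × 0 < d × E x (parent x) ≢ 0 × parity x ≡ 1 ∸ parity (parent x))
    parent-within {d} {x} d≤m (x<n , l≤) with tree .node x x<n
    ... | inj₁ e = ⊥-elim (<⇒≱ (≤-reflexive (sym e)) (≤-trans l≤ (≤-trans d≤m m≤n)))
    ... | inj₂ (_ , _ , inj₁ e) = inj₁ e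
    ... | inj₂ (_ , _ , inj₂ (p<n , lp< , Exp , eq)) =
      inj₂ ((p<n , <⇒≤pred (<-≤-trans lp< l≤)) , ≤-trans (s≤s z≤n) (<-≤-trans lp< l≤) , Exp , eq)

    within-active : ∀ {x} → Within m x → active x ≢ 0
    within-active {x} (x<n , l≤) with tree .node x x<n
    ... | inj₁ e = ⊥-elim (<⇒≱ (≤-reflexive (sym e)) (≤-trans l≤ m≤n))
    ... | inj₂ (_ , a , _) = a

    ancestor-within : ∀ c {d x} → d ≤ m → Within d x → Within d (iterate c parent x)
    ancestor-within zero    d≤m w = w
    ancestor-within (suc c) {d} d≤m w with parent-within d≤m w
    ... | inj₁ refl = ancestor-within c d≤m (subst (Within d) (sym (tree .root-parent)) w)
    ... | inj₂ ((p<n , l≤) , _) = ancestor-within c d≤m (p<n , ≤-trans l≤ pred[n]≤n)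

    root-ancestor : ∀ c → iterate c parent v ≡ v
    root-ancestor zero    = refl
    root-ancestor (suc c) = trans (cong (iterate c parent) (tree .root-parent)) (root-ancestor c)

    ancestor-root : ∀ c {x} → c ≤ m → Within c x → iterate c parent x ≡ v
    ancestor-root c c≤m w with parent-within c≤m w
    ... | inj₁ refl = root-ancestor c
    ancestor-root (suc c) c≤m w | inj₂ (w′ , _) = ancestor-root c (≤-trans (n≤1+n c) c≤m) w′

    parity≤1 : ∀ {x} → Within m x → parity x ≤ 1
    parity≤1 {x} w with parent-within ≤-refl w
    ... | inj₁ refl = subst (_≤ 1) (sym (tree .root-parity)) z≤n
    ... | inj₂ (_ , _ , _ , eq) = subst (_≤ 1) (sym eq) (m∸n≤m 1 (parity (parent x)))

  third-colour : ∀ {a b c} → a < 2 → b < 2 → c < 2 → a ≢ b → b ≢ c → a ≡ c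
  third-colour {0} {0} _ _ _ h _ = ⊥-elim (h refl)
  third-colour {1} {1} _ _ _ h _ = ⊥-elim (h refl)
  third-colour {0} {1} {0} _ _ _ _ _ = refl
  third-colour {0} {1} {1} _ _ _ _ h = ⊥-elim (h refl)
  third-colour {1} {0} {0} _ _ _ _ h = ⊥-elim (h refl)
  third-colour {1} {0} {1} _ _ _ _ _ = refl
  third-colour {suc (suc _)} (s≤s (s≤s ()))
  third-colour {0} {suc (suc _)} _ (s≤s (s≤s ()))
  third-colour {1} {suc (suc _)} _ (s≤s (s≤s ()))
  third-colour {0} {1} {suc (suc _)} _ _ (s≤s (s≤s ()))
  third-colour {1} {0} {suc (suc _)} _ _ (s≤s (s≤s ()))

  -- The hidden good set and its 2-colouring, which occur only in proofs. On bad vertices `side` is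
  -- arbitrary.
  record Bipartition (n : ℕ) (E : ℕ → ℕ → ℕ) (bad side : ℕ → ℕ) : Set where
    field
      binary : ∀ x → x < n → bad x ≡ 0 → side x < 2
      proper : ∀ x y → x < n → y < n → bad x ≡ 0 → bad y ≡ 0 → E x y ≢ 0 → side x ≢ side y

  module OddWalk {n E v m active level parent parity bad side}
    (tree : Tree n E v m active level parent parity) (m≤n : m ≤ n)
    (bip : Bipartition n E bad side) where

    open Ancestors tree m≤n
    open Bipartition bip

    -- Along a path of good vertices, parity and side both flip at each edge. That two flips of the
    -- side cancel is `third-colour`.
    side-by-parity : side v < 2 → ∀ c {x} → c ≤ m → Within c x →
      (∀ j → j ≤ c → bad (iterate j parent x) ≡ 0) →
      (parity x ≡ 0 × side x ≡ side v) ⊎ (parity x ≡ 1 × side x ≢ side v)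
    side-by-parity v₂ c c≤m w good with parent-within c≤m w
    ... | inj₁ refl = inj₁ (tree .root-parity , refl)
    side-by-parity v₂ (suc c) {x} c≤m w good | inj₂ (w′ , _ , Exp , eq)
      with side-by-parity v₂ c (≤-trans (n≤1+n c) c≤m) w′ (λ j j≤c → good (suc j) (s≤s j≤c))
    ... | inj₁ (p₀ , same) = inj₂ (trans eq (cong (1 ∸_) p₀) , λ e →
            proper x _ (proj₁ w) (proj₁ w′) (good 0 z≤n) (good 1 (s≤s z≤n)) Exp (trans e (sym same)))
    ... | inj₂ (p₁ , diff) = inj₁ (trans eq (cong (1 ∸_) p₁) ,
            third-colour (binary x (proj₁ w) (good 0 z≤n)) (binary _ (proj₁ w′) (good 1 (s≤s z≤n))) v₂
              (proper x _ (proj₁ w) (proj₁ w′) (good 0 z≤n) (good 1 (s≤s z≤n)) Exp) diff)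

    -- The tree paths of x and y and the edge xy form a closed odd walk.
    bad-ancestor : ∀ c {x y} → c ≤ m → Within c x → Within c y → E x y ≢ 0 → parity x ≡ parity y →
      ∃[ j ] j ≤ c × (bad (iterate j parent x) ≢ 0 ⊎ bad (iterate j parent y) ≢ 0)
    bad-ancestor c {x} {y} c≤m wx wy Exy same
      -- A bad ancestor has to be exhibited, so the finitely many candidates are searched. If all
      -- were good, equal parities would force equal sides on the two ends of an edge.
      with anyUpTo? (λ j → ¬? (bad (iterate j parent x) + bad (iterate j parent y) ≟ 0)) (suc c)
    ... | yes (j , s≤s j≤c , h) = j , j≤c , split h
      where
      split : ∀ {a b} → a + b ≢ 0 → a ≢ 0 ⊎ b ≢ 0
      split {zero}  h = inj₂ h
      split {suc a} h = inj₁ λ ()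
    ... | no none = ⊥-elim (clash (side-by-parity v₂ c c≤m wx goodx) (side-by-parity v₂ c c≤m wy goody))
      where
      good : ∀ j → j ≤ c → bad (iterate j parent x) + bad (iterate j parent y) ≡ 0
      good j j≤c with bad (iterate j parent x) + bad (iterate j parent y) ≟ 0
      ... | yes e = e
      ... | no ¬e = ⊥-elim (none (j , s≤s j≤c , ¬e))
      goodx : ∀ j → j ≤ c → bad (iterate j parent x) ≡ 0
      goodx j j≤c = m+n≡0⇒m≡0 _ (good j j≤c)
      goody : ∀ j → j ≤ c → bad (iterate j parent y) ≡ 0
      goody j j≤c = m+n≡0⇒n≡0 (bad (iterate j parent x)) (good j j≤c)
      v₂ : side v < 2
      -- The root is the `c`-th ancestor of `x` and is therefore good.
      v₂ = subst (λ z → side z < 2) (ancestor-root c c≤m wx)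
        (binary _ (proj₁ (ancestor-within c c≤m wx)) (goodx c ≤-refl))
      Sided : ℕ → Set
      Sided z = (parity z ≡ 0 × side z ≡ side v) ⊎ (parity z ≡ 1 × side z ≢ side v)
      differ′ : side x ≢ side y
      differ′ = proper x y (proj₁ wx) (proj₁ wy) (goodx 0 z≤n) (goody 0 z≤n) Exy
      clash : Sided x → Sided y → ⊥
      clash (inj₁ (_ , a)) (inj₁ (_ , b)) = differ′ (trans a (sym b))
      clash (inj₁ (a , _)) (inj₂ (b , _)) = 0≢1+n (trans (sym a) (trans same b))
      clash (inj₂ (a , _)) (inj₁ (b , _)) = 0≢1+n (trans (sym b) (trans (sym same) a))
      clash (inj₂ (_ , a)) (inj₂ (_ , b)) = a (third-colour (binary x (proj₁ wx) (goodx 0 z≤n))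
        (binary y (proj₁ wy) (goody 0 z≤n)) v₂ differ′ b)

  -- Effects of a deletion and of a colouring.

  Gone : (removed active : ℕ → ℕ) → ℕ → Set
  Gone S U z = S z ≡ 1 × U z ≡ 0

  Change : (removed active removed′ active′ : ℕ → ℕ) → ℕ → Set
  Change S U S′ U′ z = (S′ z ≡ S z × U′ z ≡ U z) ⊎ Gone S′ U′ z

  gone-put : ∀ S U e z → Gone S U z → Gone (put S e 1) (put U e 0) z
  gone-put S U e z (s , u) with z ≟ e
  ... | yes refl = put-here S z 1 , put-here U z 0
  ... | no  z≢e  = trans (put-there S e 1 z z≢e) s , trans (put-there U e 0 z z≢e) u

  gone-here : ∀ S U e → Gone (put S e 1) (put U e 0) e
  gone-here S U e = put-here S e 1 , put-here U e 0

  change-put : ∀ S U S′ U′ e z → Change S U S′ U′ z → Change S U (put S′ e 1) (put U′ e 0) z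
  change-put S U S′ U′ e z (inj₂ g) = inj₂ (gone-put S′ U′ e z g)
  change-put S U S′ U′ e z (inj₁ (s , u)) with z ≟ e
  ... | yes refl = inj₂ (gone-here S′ U′ z)
  ... | no  z≢e  = inj₁ (trans (put-there S′ e 1 z z≢e) s , trans (put-there U′ e 0 z z≢e) u)

  ∑-mark : ∀ n S e → e < n → ∑ n (put S e 1) ≤ ∑ n S + 1
  ∑-mark n S e e<n = subst (∑ n (put S e 1) ≤_) (∑-put n S e 1 e<n) (m≤m+n _ _)

  -- Each round marks two vertices and raises the sum by at most 2; where the paths meet or stay at
  -- the root, repeated marks only make the bound generous.
  remove-correct : ∀ {n} k σ → σ boundₐ 0 ≡ k → k ≤ n → let parent = σ parentₐ ; x = σ leftₐ 0 ; y = σ rightₐ 0 ; τ = sem n remove σ in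
    (∀ j → iterate j parent x < n × iterate j parent y < n) →
    (∀ z → Change (σ removedₐ) (σ activeₐ) (τ removedₐ) (τ activeₐ) z) × ∑ n (τ removedₐ) ≤ ∑ n (σ removedₐ) + k * 2 ×
    (∀ j → j < k → Gone (τ removedₐ) (τ activeₐ) (iterate j parent x) ×
        Gone (τ removedₐ) (τ activeₐ) (iterate j parent y))
  remove-correct {n} k σ hk k≤n bounded =
    finish (subst (λ j → Progress j (sem n remove σ)) (m≥n⇒m⊓n≡n k≤n) (proj₂ (proj₂
      (for-induction n xₐ removeStep σ I refl
        (hk , refl , refl , refl , (λ z → inj₁ (refl , refl)) , ≤-reflexive (sym (+-identityʳ _)) , λ _ ()) step))))
    where
    parent = σ parentₐ
    x = σ leftₐ 0
    y = σ rightₐ 0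
    Progress : ℕ → Store → Set
    Progress j τ = τ leftₐ 0 ≡ iterate j parent x × τ rightₐ 0 ≡ iterate j parent y ×
      (∀ z → Change (σ removedₐ) (σ activeₐ) (τ removedₐ) (τ activeₐ) z) × ∑ n (τ removedₐ) ≤ ∑ n (σ removedₐ) + j * 2 ×
      (∀ i → i < j → Gone (τ removedₐ) (τ activeₐ) (iterate i parent x) ×
          Gone (τ removedₐ) (τ activeₐ) (iterate i parent y))
    finish : Progress k (sem n remove σ) → _
    finish (_ , _ , change , sum , gone) = change , sum , gone
    I : ℕ → Store → Set
    I i τ = τ boundₐ 0 ≡ k × τ parentₐ ≡ parent × Progress (i ⊓ k) τ
    step : ∀ i τ → i < n → τ xₐ 0 ≡ i → I i τ → I (suc i) (bump xₐ (sem n removeStep τ))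
    step i τ i<n hi (h₅ , h₁₂ , inv) = guard-elim n (climb leftₐ ⨟ climb rightₐ) τ
      (λ ρ → I (suc i) (bump xₐ ρ)) ($ boundₐ ⊖ $ xₐ ∷ [])
      (λ { (h ∷ []) → let i<k = subst₂ _<_ hi h₅ (∸≢0⇒< (τ boundₐ 0) _ h) in
        h₅ , h₁₂ , subst (λ j → Progress j ρ) (sym (m≤n⇒m⊓n≡m i<k))
          (advance (subst (λ j → Progress j τ) (m≤n⇒m⊓n≡m (<⇒≤ i<k)) inv)) })
      (λ h → let k≤i = subst₂ _≤_ h₅ hi (m∸n≡0⇒m≤n {τ boundₐ 0} (¬guard⇒≡0 ($ boundₐ ⊖ $ xₐ) h)) in
        h₅ , h₁₂ , subst (λ j → Progress j τ) (trans (m≥n⇒m⊓n≡n k≤i) (sym (m≥n⇒m⊓n≡n (m≤n⇒m≤1+n k≤i)))) inv)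
      where
      ρ = sem n (climb leftₐ ⨟ climb rightₐ) τ
      a = τ leftₐ 0
      b = τ rightₐ 0
      S′ = put (τ removedₐ) a 1
      U′ = put (τ activeₐ) a 0
      advance : Progress i τ → Progress (suc i) ρ
      advance (ha , hb , change , sum , gone) =
        trans (cong₂ (λ f z → f z) h₁₂ ha) (sym (iterate-suc parent i x)) ,
        trans (cong₂ (λ f z → f z) h₁₂ hb) (sym (iterate-suc parent i y)) ,
        (λ z → change-put (σ removedₐ) (σ activeₐ) S′ U′ b z
            (change-put (σ removedₐ) (σ activeₐ) (τ removedₐ) (τ activeₐ) a z (change z))) ,
        (begin
          ∑ n (put S′ b 1)              ≤⟨ ∑-mark n S′ b (subst (_< n) (sym hb) (proj₂ (bounded i))) ⟩
          ∑ n S′ + 1                    ≤⟨ +-monoˡ-≤ 1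
              (∑-mark n (τ removedₐ) a (subst (_< n) (sym ha) (proj₁ (bounded i)))) ⟩
          ∑ n (τ removedₐ) + 1 + 1             ≡⟨ +-assoc (∑ n (τ removedₐ)) 1 1 ⟩
          ∑ n (τ removedₐ) + 2                 ≤⟨ +-monoˡ-≤ 2 sum ⟩
          ∑ n (σ removedₐ) + i * 2 + 2         ≡⟨ +-assoc (∑ n (σ removedₐ)) (i * 2) 2 ⟩
          ∑ n (σ removedₐ) + (i * 2 + 2)       ≡⟨ cong (∑ n (σ removedₐ) +_) (+-comm (i * 2) 2) ⟩
          ∑ n (σ removedₐ) + suc i * 2         ∎) ,
        λ j j<1+i → [ (λ j<i → gone-put S′ U′ b _ (gone-put (τ removedₐ) (τ activeₐ) a _ (proj₁ (gone j j<i))) ,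
                               gone-put S′ U′ b _ (gone-put (τ removedₐ) (τ activeₐ) a _ (proj₂ (gone j j<i)))) ,
                      (λ { refl → gone-put S′ U′ b _ (subst (Gone S′ U′) ha (gone-here (τ removedₐ) (τ activeₐ) a)) ,
                                  subst (Gone (put S′ b 1) (put U′ b 0)) hb (gone-here S′ U′ b) }) ]′
                    (m≤n⇒m<n∨m≡n (s≤s⁻¹ j<1+i))
        where open ≤-Reasoning

  colour-correct : ∀ {n} σ → let τ = sem n colour σ ; ρ = σ radiusₐ 0 in ∀ x → x < n →
    (σ levelₐ x ≤ ρ → τ activeₐ x ≡ 0) × (ρ < σ levelₐ x → τ activeₐ x ≡ σ activeₐ x) ×
    (σ levelₐ x < ρ → τ coloursₐ x ≡ σ phaseₐ 0 + σ phaseₐ 0 + suc (σ parityₐ x)) ×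
        (ρ ≤ σ levelₐ x → τ coloursₐ x ≡ σ coloursₐ x)
  colour-correct {n} σ = λ x x<n →
    let ((_ , _ , _ , _ , k) , q) = run in proj₁ (q x x<n) , proj₁ (k x) , proj₂ (q x x<n) , proj₂ (k x)
    where
    ρ = σ radiusₐ 0
    level = σ levelₐ
    K : Store → Set
    K τ = τ levelₐ ≡ level × τ radiusₐ 0 ≡ ρ × τ parityₐ ≡ σ parityₐ × τ phaseₐ 0 ≡ σ phaseₐ 0 ×
          (∀ x → (ρ < level x → τ activeₐ x ≡ σ activeₐ x) × (ρ ≤ level x → τ coloursₐ x ≡ σ coloursₐ x))
    Q : ℕ → Store → Set
    Q x τ = (level x ≤ ρ → τ activeₐ x ≡ 0) × (level x < ρ → τ coloursₐ x ≡ σ phaseₐ 0 + σ phaseₐ 0 + suc (σ parityₐ x))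
    step : ∀ τ → τ xₐ 0 < n → K τ → K (sem n colourStep τ) × Q (τ xₐ 0) (sem n colourStep τ) ×
           (∀ i → i < n → Q i τ → Q i (sem n colourStep τ))
    step τ _ (h₁₁ , h₁₄ , h₁₃ , h₂₀ , same) =
      guard-elim n retire τ Φ (($ radiusₐ ⊕ lit 1) ⊖ levelₐ ! $ xₐ ∷ [])
        (λ { (h ∷ []) → let x≤ρ = s≤s⁻¹ (subst₂ _<_ lx ρ+1 (∸≢0⇒< _ (τ levelₐ x) h)) in
          guard-elim n paint τ′ Φ ($ radiusₐ ⊖ levelₐ ! $ xₐ ∷ [])
            (λ { (h ∷ []) → let x<ρ = subst₂ _<_ lx h₁₄ (∸≢0⇒< _ (τ levelₐ x) h) in
              (h₁₁ , h₁₄ , h₁₃ , h₂₀ , λ z → cleared x≤ρ z (proj₁ (same z)) ,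
                put-elim (λ z c → (ρ ≤ level z → τ coloursₐ z ≡ σ coloursₐ z) → ρ ≤ level z → c ≡ σ coloursₐ z)
                    (τ coloursₐ) x new
                  (λ _ ρ≤x → ⊥-elim (<⇒≱ x<ρ ρ≤x)) (λ _ _ h → h) z (proj₂ (same z))) ,
              ((λ _ → put-here (τ activeₐ) x 0) , λ _ → trans (put-here (τ coloursₐ) x new) hnew) ,
              λ i _ (q₁ , q₂) → (λ i≤ρ → erased i (q₁ i≤ρ)) , λ i<ρ →
                put-elim (λ z c → (level z < ρ → τ coloursₐ z ≡ σ phaseₐ 0 + σ phaseₐ 0 + suc (σ parityₐ z)) →
                    level z < ρ → c ≡ σ phaseₐ 0 + σ phaseₐ 0 + suc (σ parityₐ z)) (τ coloursₐ) x new
                  (λ _ _ → hnew) (λ _ _ h → h) i q₂ i<ρ })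
            (λ h → let ρ≤x = subst₂ _≤_ h₁₄ lx (m∸n≡0⇒m≤n {τ radiusₐ 0} (¬guard⇒≡0 {τ′} ($ radiusₐ ⊖ levelₐ ! $ xₐ) h)) in
              (h₁₁ , h₁₄ , h₁₃ , h₂₀ , λ z → cleared x≤ρ z (proj₁ (same z)) , proj₂ (same z)) ,
              ((λ _ → put-here (τ activeₐ) x 0) , λ x<ρ → ⊥-elim (<⇒≱ x<ρ ρ≤x)) ,
              λ i _ (q₁ , q₂) → (λ i≤ρ → erased i (q₁ i≤ρ)) , q₂) })
        (λ h → let ρ<x = subst₂ _≤_ ρ+1 lx (m∸n≡0⇒m≤n (¬guard⇒≡0 (($ radiusₐ ⊕ lit 1) ⊖ levelₐ ! $ xₐ) h)) in
          (h₁₁ , h₁₄ , h₁₃ , h₂₀ , same) ,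
          ((λ x≤ρ → ⊥-elim (<⇒≱ ρ<x x≤ρ)) , λ x<ρ → ⊥-elim (<⇒≱ ρ<x (<⇒≤ x<ρ))) , λ _ _ q → q)
      where
      x = τ xₐ 0
      Φ : Store → Set
      Φ υ = K υ × Q x υ × (∀ i → i < n → Q i τ → Q i υ)
      τ′ = sem n (activeₐ [ $ xₐ ]≔ lit 0) τ
      new = τ phaseₐ 0 + τ phaseₐ 0 + (1 + τ parityₐ x)
      hnew : new ≡ σ phaseₐ 0 + σ phaseₐ 0 + suc (σ parityₐ x)
      hnew = cong₂ (λ p f → p + p + suc (f x)) h₂₀ h₁₃
      lx : τ levelₐ x ≡ level x
      lx = cong (λ f → f x) h₁₁
      ρ+1 : τ radiusₐ 0 + 1 ≡ suc ρ
      ρ+1 = trans (+-comm _ 1) (cong suc h₁₄)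
      cleared : level x ≤ ρ → ∀ z → (ρ < level z → τ activeₐ z ≡ σ activeₐ z) → ρ < level z →
          put (τ activeₐ) x 0 z ≡ σ activeₐ z
      cleared x≤ρ z h = put-elim (λ z u → (ρ < level z → τ activeₐ z ≡ σ activeₐ z) → ρ < level z →
          u ≡ σ activeₐ z) (τ activeₐ) x 0
        (λ _ ρ<x → ⊥-elim (<⇒≱ ρ<x x≤ρ)) (λ _ _ h → h) z h
      erased : ∀ z → τ activeₐ z ≡ 0 → put (τ activeₐ) x 0 z ≡ 0
      erased z h = put-elim (λ z u → τ activeₐ z ≡ 0 → u ≡ 0) (τ activeₐ) x 0 (λ _ → refl) (λ _ _ h → h) z h
    run : K (sem n colour σ) × (∀ x → x < n → Q x (sem n colour σ))
    run = for-each n xₐ colourStep σ K Q refl (λ _ _ k → k) (λ _ _ _ q → q)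
      (refl , refl , refl , refl , λ _ → (λ _ → refl) , λ _ → refl) step

  ∑-strict : ∀ n {f g} w → w < n → (∀ i → i < n → f i ≤ g i) → f w < g w → ∑ n f < ∑ n g
  ∑-strict (suc n) {f} {g} w (s≤s w≤n) le lt with m≤n⇒m<n∨m≡n w≤n
  ... | inj₁ w<n  = +-mono-<-≤ (∑-strict n w w<n (λ i i<n → le i (m<n⇒m<1+n i<n)) lt) (le n ≤-refl)
  ... | inj₂ refl = +-mono-≤-< (∑-mono n (λ i i<n → le i (m<n⇒m<1+n i<n))) lt

  undone : (removed colour : ℕ → ℕ) → ℕ → ℕ
  undone S col x = 1 ∸ S x ∸ col x

  undone≡0 : ∀ S col x → S x ≡ 1 → undone S col x ≡ 0
  undone≡0 S col x e rewrite e = 0∸n≡0 (col x)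

  undone⇒kept : ∀ {s c} → 1 ∸ s ∸ c ≢ 0 → s ≡ 0 × c ≡ 0
  undone⇒kept {zero}  {zero}  h = refl , refl
  undone⇒kept {zero}  {suc c} h = ⊥-elim (h (0∸n≡0 c))
  undone⇒kept {suc s} {c}     h = ⊥-elim (h (trans (cong (_∸ c) (0∸n≡0 s)) (0∸n≡0 c)))

  -- Accounting over carvings and phases.

  module Correctness (n k q T : ℕ) (E : ℕ → ℕ → ℕ) (bad side : ℕ → ℕ)
    (1≤k : 1 ≤ k) (k≤n : k ≤ n) (1≤q : 1 ≤ q) (n≤q^k : n ≤ q ^ k)
    (E-sym : ∀ x y → x < n → y < n → E x y ≢ 0 → E y x ≢ 0)
    (bip : Bipartition n E bad side)
    (exhausted : ∀ p m → T ≤ p → m * q ^ p ≤ pred q ^ p * n → m ≡ 0) where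

    -- The state between two carvings of phase p. `removed-few` charges all deletions to the deleted
    -- bad vertices. Colours above 2p belong to the current phase, so `separated` keeps its clusters
    -- apart.
    record Invariant (p : ℕ) (S col U : ℕ → ℕ) : Set where
      field
        removed≤1     : ∀ x → x < n → S x ≤ 1
        active≤undone : ∀ x → x < n → U x ≤ undone S col x
        removed-few   : ∑ n S ≤ k * 2 * ∑ n (λ x → S x * bad x)
        proper        : ∀ x y → x < n → y < n → S x ≡ 0 → S y ≡ 0 → col x ≢ 0 → col y ≢ 0 →
                        E x y ≢ 0 → col x ≢ col y
        separated     : ∀ x y → x < n → y < n → U x ≢ 0 → p + p < col y → ¬ (E x y ≢ 0)
        colour≤phase  : ∀ x → x < n → col x ≤ p + p + 2
        colour≤T      : ∀ x → x < n → col x ≤ T * 2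

    open Invariant

    record Progress (p v : ℕ) (S col U S′ col′ U′ : ℕ → ℕ) : Set where
      field
        invariant : Invariant p S′ col′ U′
        shrinks   : ∀ x → x < n → U′ x ≤ U x
        treated   : U′ v ≡ 0
        -- q · undone − active does not increase; over a phase, which starts with all
        -- undone vertices active, this settles a 1/q fraction of them.
        potential : q * ∑ n (undone S′ col′) + ∑ n U ≤ q * ∑ n (undone S col) + ∑ n U′

    -- The bad vertex on the walk is active, hence undone, hence not deleted before. So the sum over
    -- deleted bad vertices grows by at least 1, which pays for the at most 2k new deletions.
    remove-progress : ∀ {p v ρ S col U S′ U′ level parent parity x y} →
      Invariant p S col U → Tree n E v ρ U level parent parity → 1 ≤ ρ → ρ ≤ k →
      Monochromatic n E ρ level parity x y →
      (∀ z → Change S U S′ U′ z) → ∑ n S′ ≤ ∑ n S + k * 2 →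
      (∀ j → j < k → Gone S′ U′ (iterate j parent x) × Gone S′ U′ (iterate j parent y)) →
      Progress p v S col U S′ col U′
    remove-progress {p} {v} {suc c} {S} {col} {U} {S′} {U′} {level} {parent} {parity} {x} {y}
      inv tree 1≤ρ ρ≤k (x<n , y<n , s≤s lx , s≤s ly , Exy , same) change sum gone = record
      { invariant = record
        { removed≤1     = λ z z<n → [ (λ (s , _) → subst (_≤ 1) (sym s) (inv .removed≤1 z z<n)) ,
                                      (λ (s , _) → ≤-reflexive s) ]′ (change z)
        ; active≤undone = λ z z<n → [ (λ (s , u) →
            subst₂ (λ a b → a ≤ 1 ∸ b ∸ col z) (sym u) (sym s) (inv .active≤undone z z<n)) ,
                                      (λ (_ , u) → subst (_≤ undone S′ col z) (sym u) z≤n) ]′ (change z)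
        ; removed-few   = few
        ; proper        = λ a b a<n b<n Sa Sb → inv .proper a b a<n b<n (kept a Sa) (kept b Sb)
        ; separated     = λ a b a<n b<n Ua → inv .separated a b a<n b<n (active a Ua)
        ; colour≤phase  = inv .colour≤phase
        ; colour≤T      = inv .colour≤T
        }
      ; shrinks   = λ z _ → [ (λ (_ , u) → ≤-reflexive u) , (λ (_ , u) → subst (_≤ U z) (sym u) z≤n) ]′ (change z)
      -- The level of `x` is at most c = ρ - 1, so its `c`-th ancestor is the root, and the deletion
      -- reaches it because c < k.
      ; treated   = subst (λ w → U′ w ≡ 0) (ancestor-root c (n≤1+n c) (x<n , lx)) (proj₂ (proj₁ (gone c ρ≤k)))
      ; potential = subst₂ _≤_ (trans (∑-+ n _ _) (cong (_+ ∑ n U) (∑-* n q _)))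
                               (trans (∑-+ n _ _) (cong (_+ ∑ n U′) (∑-* n q _)))
                               (∑-mono n pointwise)
      }
      where
      open Ancestors tree (≤-trans ρ≤k k≤n)
      open OddWalk tree (≤-trans ρ≤k k≤n) bip
      kept : ∀ z → S′ z ≡ 0 → S z ≡ 0
      kept z e = [ (λ (s , _) → trans (sym s) e) , (λ (s , _) → ⊥-elim (0≢1+n (trans (sym e) s))) ]′ (change z)
      active : ∀ z → U′ z ≢ 0 → U z ≢ 0
      active z h e = [ (λ (_ , u) → h (trans u e)) , (λ (_ , u) → h u) ]′ (change z)
      -- For a vertex that is gone, U ≤ undone ≤ q·undone: the undone term it gives up covers the
      -- activity it loses.
      pointwise : ∀ z → z < n → q * undone S′ col z + U z ≤ q * undone S col z + U′ z
      pointwise z z<n = [ (λ (s , u) → ≤-reflexive (cong₂ (λ a b → q * (1 ∸ a ∸ col z) + b) s (sym u))) ,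
        (λ (s , u) → begin
          q * undone S′ col z + U z    ≡⟨ cong (λ a → q * a + U z) (undone≡0 S′ col z s) ⟩
          q * 0 + U z                  ≡⟨ cong (_+ U z) (*-zeroʳ q) ⟩
          U z                          ≤⟨ inv .active≤undone z z<n ⟩
          undone S col z               ≤⟨ m≤n*m _ q {{>-nonZero 1≤q}} ⟩
          q * undone S col z           ≤⟨ m≤m+n _ _ ⟩
          q * undone S col z + U′ z    ∎) ]′ (change z)
        where open ≤-Reasoning
      grows : ∀ z → z < n → S z * bad z ≤ S′ z * bad z
      grows z z<n = *-monoˡ-≤ (bad z) ([ (λ (s , _) → ≤-reflexive (sym s)) ,
        (λ (s , _) → subst (S z ≤_) (sym s) (inv .removed≤1 z z<n)) ]′ (change z))
      newly : ∀ z → Within c z → bad z ≢ 0 → S′ z ≡ 1 → ∑ n (λ z → S z * bad z) < ∑ n (λ z → S′ z * bad z)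
      newly z w bz S′z = ∑-strict n z (proj₁ w) grows (subst₂ (λ a b → a * bad z < b * bad z) (sym Sz) (sym S′z)
        (subst (0 <_) (sym (*-identityˡ (bad z))) (n≢0⇒n>0 bz)))
        where
        Sz : S z ≡ 0
        Sz = proj₁ (undone⇒kept {S z} {col z} λ e →
          within-active (proj₁ w , ≤-trans (proj₂ w) (n≤1+n c))
              (n≤0⇒n≡0 (subst (U z ≤_) e (inv .active≤undone z (proj₁ w)))))
      more : ∑ n (λ z → S z * bad z) < ∑ n (λ z → S′ z * bad z)
      more = let (j , j≤c , b) = bad-ancestor c (n≤1+n c) (x<n , lx) (y<n , ly) Exy same
                 g = gone j (≤-<-trans j≤c ρ≤k) in
        [ (λ b → newly _ (ancestor-within j (n≤1+n c) (x<n , lx)) b (proj₁ (proj₁ g))) ,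
          (λ b → newly _ (ancestor-within j (n≤1+n c) (y<n , ly)) b (proj₁ (proj₂ g))) ]′ b
      few : ∑ n S′ ≤ k * 2 * ∑ n (λ z → S′ z * bad z)
      few = begin
        ∑ n S′                                          ≤⟨ sum ⟩
        ∑ n S + k * 2                                   ≤⟨ +-monoˡ-≤ (k * 2) (inv .removed-few) ⟩
        k * 2 * ∑ n (λ z → S z * bad z) + k * 2         ≡⟨ +-comm _ (k * 2) ⟩
        k * 2 + k * 2 * ∑ n (λ z → S z * bad z)         ≡⟨ *-suc (k * 2) _ ⟨
        k * 2 * suc (∑ n (λ z → S z * bad z))           ≤⟨ *-monoʳ-≤ (k * 2) more ⟩
        k * 2 * ∑ n (λ z → S′ z * bad z)                ∎
        where open ≤-Reasoning

    -- Activity drops by ball(ρ+1) and the undone count by ball(ρ), and `growth` balances the two.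
    -- Inside the ball parities separate neighbours. A coloured neighbour outside has a colour of an
    -- earlier phase, by `separated`, because the ball was active.
    colour-progress : ∀ {p v ρ S col U col′ U′ level parent parity} →
      Invariant p S col U → p < T → v < n → 1 ≤ ρ → ρ ≤ k →
      Explored n E q v ρ U level parent parity →
      (∀ x y → ¬ Monochromatic n E ρ level parity x y) →
      (∀ x → x < n →
        (level x ≤ ρ → U′ x ≡ 0) × (ρ < level x → U′ x ≡ U x) ×
        (level x < ρ → col′ x ≡ p + p + suc (parity x)) × (ρ ≤ level x → col′ x ≡ col x)) →
      Progress p v S col U S col′ U′
    colour-progress {p} {v} {ρ} {S} {col} {U} {col′} {U′} {level} {parent} {parity}
      inv p<T v<n 1≤ρ ρ≤k explored bichromatic effect = record
      { invariant = record
        { removed≤1     = inv .removed≤1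
        ; active≤undone = λ x x<n → cases x (level x ≤? ρ)
            (λ x≤ρ → subst (_≤ undone S col′ x) (sym (left x x<n x≤ρ)) z≤n)
            (λ ρ<x → subst₂ (λ u c → u ≤ 1 ∸ S x ∸ c) (sym (stays x x<n ρ<x)) (sym (old x x<n (<⇒≤ ρ<x)))
                (inv .active≤undone x x<n))
        ; removed-few   = inv .removed-few
        ; proper        = proper′
        ; separated     = λ x y x<n y<n Ux py Exy → cases x (level x ≤? ρ)
            (λ x≤ρ → Ux (left x x<n x≤ρ))
            (λ ρ<x → cases′ y (level y <? ρ)
              (λ y<ρ → <⇒≱ ρ<x (closed x y x<n y<n (λ e → Ux (trans (stays x x<n ρ<x) e)) y<ρ Exy))
              (λ ρ≤y → inv .separated x y x<n y<n (λ e → Ux (trans (stays x x<n ρ<x) e))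
                  (subst (p + p <_) (old y y<n ρ≤y) py) Exy))
        ; colour≤phase  = λ x x<n → cases′ x (level x <? ρ)
            (λ x<ρ → new≤ x x<n x<ρ)
            (λ ρ≤x → subst (_≤ p + p + 2) (sym (old x x<n ρ≤x)) (inv .colour≤phase x x<n))
        ; colour≤T      = λ x x<n → cases′ x (level x <? ρ)
            (λ x<ρ → ≤-trans (new≤ x x<n x<ρ) phase≤T)
            (λ ρ≤x → subst (_≤ T * 2) (sym (old x x<n ρ≤x)) (inv .colour≤T x x<n))
        }
      ; shrinks   = λ x x<n → cases x (level x ≤? ρ)
          (λ x≤ρ → subst (_≤ U x) (sym (left x x<n x≤ρ)) z≤n)
          (λ ρ<x → ≤-reflexive (stays x x<n ρ<x))
      ; treated   = left v v<n (subst (_≤ ρ) (sym (tree .root-level)) z≤n)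
      ; potential = begin
          q * ∑ n (undone S col′) + ∑ n U
            ≡⟨ cong (q * ∑ n (undone S col′) +_) (trans (∑-cong n active-split) (∑-+ n U′ _)) ⟩
          q * ∑ n (undone S col′) + (∑ n U′ + ball n level (suc ρ))
            ≤⟨ +-monoʳ-≤ (q * ∑ n (undone S col′)) (+-monoʳ-≤ (∑ n U′) growth) ⟩
          q * ∑ n (undone S col′) + (∑ n U′ + q * ball n level ρ)
            ≡⟨ cong (q * ∑ n (undone S col′) +_) (+-comm (∑ n U′) _) ⟩
          q * ∑ n (undone S col′) + (q * ball n level ρ + ∑ n U′)
            ≡⟨ +-assoc (q * ∑ n (undone S col′)) _ _ ⟨
          q * ∑ n (undone S col′) + q * ball n level ρ + ∑ n U′
            ≡⟨ cong (_+ ∑ n U′) (*-distribˡ-+ q (∑ n (undone S col′)) _) ⟨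
          q * (∑ n (undone S col′) + ball n level ρ) + ∑ n U′
            ≡⟨ cong (λ s → q * s + ∑ n U′) (trans (∑-cong n undone-split) (∑-+ n (undone S col′) _)) ⟨
          q * ∑ n (undone S col) + ∑ n U′ ∎
      }
      where
      open ≤-Reasoning
      open Explored explored
      open Ancestors tree (≤-trans ρ≤k k≤n)
      left : ∀ x → x < n → level x ≤ ρ → U′ x ≡ 0
      left x x<n = proj₁ (effect x x<n)
      stays : ∀ x → x < n → ρ < level x → U′ x ≡ U x
      stays x x<n = proj₁ (proj₂ (effect x x<n))
      new : ∀ x → x < n → level x < ρ → col′ x ≡ p + p + suc (parity x)
      new x x<n = proj₁ (proj₂ (proj₂ (effect x x<n)))
      old : ∀ x → x < n → ρ ≤ level x → col′ x ≡ col x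
      old x x<n = proj₂ (proj₂ (proj₂ (effect x x<n)))
      cases : ∀ {A : Set} x → Dec (level x ≤ ρ) → (level x ≤ ρ → A) → (ρ < level x → A) → A
      cases x (yes h) f g = f h
      cases x (no  h) f g = g (≰⇒> h)
      cases′ : ∀ {A : Set} x → Dec (level x < ρ) → (level x < ρ → A) → (ρ ≤ level x → A) → A
      cases′ x (yes h) f g = f h
      cases′ x (no  h) f g = g (≮⇒≥ h)
      active : ∀ x → x < n → level x ≤ ρ → U x ≢ 0
      active x x<n x≤ρ = within-active (x<n , x≤ρ)
      fresh : ∀ x → x < n → level x ≤ ρ → S x ≡ 0 × col x ≡ 0
      fresh x x<n x≤ρ = undone⇒kept λ e → active x x<n x≤ρ
        (n≤0⇒n≡0 (subst (U x ≤_) e (inv .active≤undone x x<n)))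
      new≤ : ∀ x → x < n → level x < ρ → col′ x ≤ p + p + 2
      new≤ x x<n x<ρ = subst (_≤ p + p + 2) (sym (new x x<n x<ρ))
        (+-monoʳ-≤ (p + p) (s≤s (parity≤1 (x<n , <⇒≤ x<ρ))))
      new> : ∀ x → x < n → level x < ρ → p + p < col′ x
      new> x x<n x<ρ = subst (p + p <_) (sym (new x x<n x<ρ)) (m<m+n (p + p) (s≤s z≤n))
      phase≤T : p + p + 2 ≤ T * 2
      phase≤T = begin
        p + p + 2          ≡⟨ +-comm (p + p) 2 ⟩
        2 + (p + p)        ≡⟨ cong (λ z → 2 + (p + z)) (+-identityʳ p) ⟨
        2 + 2 * p          ≡⟨ cong (2 +_) (*-comm 2 p) ⟩
        suc p * 2          ≤⟨ *-monoˡ-≤ 2 p<T ⟩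
        T * 2              ∎
      crossing : ∀ x y → x < n → y < n → level x < ρ → col y ≢ 0 → ρ ≤ level y → E x y ≢ 0 → col′ x ≢ col′ y
      crossing x y x<n y<n x<ρ cy ρ≤y Exy e with p + p <? col y
      ... | yes lt = inv .separated x y x<n y<n (active x x<n (<⇒≤ x<ρ)) lt Exy
      ... | no ¬lt = <⇒≱ (new> x x<n x<ρ) (subst (_≤ p + p) (sym (trans e (old y y<n ρ≤y))) (≮⇒≥ ¬lt))
      proper′ : ∀ x y → x < n → y < n → S x ≡ 0 → S y ≡ 0 → col′ x ≢ 0 → col′ y ≢ 0 → E x y ≢ 0 → col′ x ≢ col′ y
      proper′ x y x<n y<n Sx Sy cx cy Exy e = cases′ x (level x <? ρ)
        (λ x<ρ → cases′ y (level y <? ρ)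
          (λ y<ρ → bichromatic x y (x<n , y<n , x<ρ , y<ρ , Exy , suc-injective
            (+-cancelˡ-≡ (p + p) _ _ (trans (sym (new x x<n x<ρ)) (trans e (new y y<n y<ρ))))))
          (λ ρ≤y → crossing x y x<n y<n x<ρ (λ z → cy (trans (old y y<n ρ≤y) z)) ρ≤y Exy e))
        (λ ρ≤x → cases′ y (level y <? ρ)
          (λ y<ρ → crossing y x y<n x<n y<ρ (λ z → cx (trans (old x x<n ρ≤x) z)) ρ≤x (E-sym x y x<n y<n Exy) (sym e))
          (λ ρ≤y → inv .proper x y x<n y<n Sx Sy (λ z → cx (trans (old x x<n ρ≤x) z)) (λ z → cy (trans (old y y<n ρ≤y) z))
            Exy (trans (sym (old x x<n ρ≤x)) (trans e (old y y<n ρ≤y)))))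
      active-split : ∀ x → x < n → U x ≡ U′ x + sgn (suc ρ ∸ level x)
      active-split x x<n = cases x (level x ≤? ρ)
        (λ x≤ρ → trans (≤-antisym (≤-trans (inv .active≤undone x x<n)
            (≤-trans (m∸n≤m (1 ∸ S x) (col x)) (m∸n≤m 1 (S x)))) (n≢0⇒n>0 (active x x<n x≤ρ)))
          (sym (cong₂ _+_ (left x x<n x≤ρ) (sgn-pos (<⇒∸≢0 (suc ρ) _ (s≤s x≤ρ))))))
        (λ ρ<x → trans (sym (+-identityʳ (U x))) (sym (cong₂ (λ u m → u + sgn m) (stays x x<n ρ<x) (m≤n⇒m∸n≡0 ρ<x))))
      undone-split : ∀ x → x < n → undone S col x ≡ undone S col′ x + sgn (ρ ∸ level x)
      undone-split x x<n = cases′ x (level x <? ρ)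
        (λ x<ρ → trans (cong₂ (λ s c → 1 ∸ s ∸ c) (proj₁ (fresh x x<n (<⇒≤ x<ρ))) (proj₂ (fresh x x<n (<⇒≤ x<ρ))))
          (sym (cong₂ _+_ (m≤n⇒m∸n≡0 (≤-trans (m∸n≤m 1 (S x)) (≤-trans (s≤s z≤n) (new> x x<n x<ρ))))
                          (sgn-pos (<⇒∸≢0 ρ _ x<ρ)))))
        (λ ρ≤x → trans (sym (+-identityʳ _)) (sym (cong₂ (λ c m → 1 ∸ S x ∸ c + sgn m) (old x x<n ρ≤x) (m≤n⇒m∸n≡0 ρ≤x))))

    record Environment (τ : Store) : Set where
      field
        order      : τ inputₐ 0 ≡ n
        adjacency  : Adjacency n E τ
        bound      : τ boundₐ 0 ≡ k
        threshold : ∀ r → r ≤ n → τ thresholdₐ r ≡ q ^ r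

    open Environment

    environment-frame : ∀ P σ → assigns inputₐ P ≡ false → assigns adjacencyₐ P ≡ false → assigns rowₐ P ≡ false →
      assigns boundₐ P ≡ false → assigns thresholdₐ P ≡ false → Environment σ → Environment (sem n P σ)
    environment-frame P σ a₀ a₁ a₄ a₅ a₆ env = record
      { order      = trans (cong (λ f → f 0) (frame n P σ inputₐ a₀)) (env .order)
      ; adjacency  = subst₂ (λ f g → ∀ x y → x < n → y < n → f (g x + y) ≡ E x y)
                       (sym (frame n P σ adjacencyₐ a₁)) (sym (frame n P σ rowₐ a₄)) (env .adjacency)
      ; bound      = trans (cong (λ f → f 0) (frame n P σ boundₐ a₅)) (env .bound)
      ; threshold = λ r r≤n → trans (cong (λ f → f r) (frame n P σ thresholdₐ a₆)) (env .threshold r r≤n)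
      }

    -- Stated about arrays instead of stores, so that `frame` can replace them one at a time.
    Searched : (v ρ : ℕ) (active level parent parity : ℕ → ℕ) → ℕ → ℕ → ℕ → Set
    Searched v ρ active level parent parity flag x y =
      1 ≤ ρ × ρ ≤ k × Explored n E q v (ρ) active level parent parity ×
      ((flag ≡ 0 × (∀ x y → ¬ Monochromatic n E (ρ) level parity x y)) ⊎
       (flag ≢ 0 × Monochromatic n E (ρ) level parity x y))

    search-correct : ∀ σ → let v = σ sourceₐ 0 ; τ = sem n search σ in
      Environment σ → v < n → σ activeₐ v ≢ 0 →
      Searched v (τ radiusₐ 0) (τ activeₐ) (τ levelₐ) (τ parentₐ) (τ parityₐ) (τ foundₐ 0) (τ leftₐ 0) (τ rightₐ 0)
    search-correct σ env v<n av =
      subst (λ r → Searched v (r 0) (τ activeₐ) (τ levelₐ) (τ parentₐ) (τ parityₐ) f x y) (sym (keep radiusₐ refl))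
     (subst (λ U → Searched v (τ₂ radiusₐ 0) U (τ levelₐ) (τ parentₐ) (τ parityₐ) f x y)
         (sym (trans (keep activeₐ refl) (frame n explore τ₁ activeₐ refl)))
     (subst (λ l → Searched v (τ₂ radiusₐ 0) (τ₁ activeₐ) l (τ parentₐ) (τ parityₐ) f x y) (sym (keep levelₐ refl))
     (subst (λ p → Searched v (τ₂ radiusₐ 0) (τ₁ activeₐ) (τ₂ levelₐ) p (τ parityₐ) f x y) (sym (keep parentₐ refl))
     (subst (λ p → Searched v (τ₂ radiusₐ 0) (τ₁ activeₐ) (τ₂ levelₐ) (τ₂ parentₐ) p f x y) (sym (keep parityₐ refl))
     (let (1≤ρ , ρ≤k , explored) = exploration in
      1≤ρ , ρ≤k , explored , conflict-correct τ₂ (env₂ .adjacency))))))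
      where
      v = σ sourceₐ 0
      τ₁ = sem n (unlabel ⨟ root) σ
      τ₂ = sem n explore τ₁
      τ = sem n conflict τ₂
      f = τ foundₐ 0
      x = τ leftₐ 0
      y = τ rightₐ 0
      keep : ∀ b → assigns b conflict ≡ false → τ b ≡ τ₂ b
      keep = frame n conflict τ₂
      env₁ : Environment τ₁
      env₁ = environment-frame (unlabel ⨟ root) σ refl refl refl refl refl env
      env₂ : Environment τ₂
      env₂ = environment-frame explore τ₁ refl refl refl refl refl env₁
      start : Tree n E v 0 (τ₁ activeₐ) (τ₁ levelₐ) (τ₁ parentₐ) (τ₁ parityₐ)
      start = subst (λ U → Tree n E v 0 U (τ₁ levelₐ) (τ₁ parentₐ) (τ₁ parityₐ))
          (sym (frame n (unlabel ⨟ root) σ activeₐ refl))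
        (start-correct σ (env .order) v<n av)
      exploration : 1 ≤ τ₂ radiusₐ 0 × τ₂ radiusₐ 0 ≤ k ×
          Explored n E q v (τ₂ radiusₐ 0) (τ₁ activeₐ) (τ₂ levelₐ) (τ₂ parentₐ) (τ₂ parityₐ)
      exploration = explore-correct k q v τ₁ 1≤k k≤n n≤q^k (env₁ .adjacency) (env₁ .threshold) refl v<n start

    carve-correct : ∀ p σ → let v = σ sourceₐ 0 ; τ = sem n carve σ in
      Environment σ → σ phaseₐ 0 ≡ p → p < T → v < n → σ activeₐ v ≢ 0 →
      Invariant p (σ removedₐ) (σ coloursₐ) (σ activeₐ) →
          Progress p v (σ removedₐ) (σ coloursₐ) (σ activeₐ) (τ removedₐ) (τ coloursₐ) (τ activeₐ)
    carve-correct .(σ phaseₐ 0) σ env refl p<T v<n av inv = outcome (search-correct σ env v<n av)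
      where
      p = σ phaseₐ 0
      v = σ sourceₐ 0
      τ = sem n search σ
      inv′ : Invariant p (τ removedₐ) (τ coloursₐ) (τ activeₐ)
      inv′ = subst (λ S → Invariant p S (τ coloursₐ) (τ activeₐ)) (sym (frame n search σ removedₐ refl))
            (subst (λ col → Invariant p (σ removedₐ) col (τ activeₐ)) (sym (frame n search σ coloursₐ refl))
            (subst (λ U → Invariant p (σ removedₐ) (σ coloursₐ) U) (sym (frame n search σ activeₐ refl)) inv))
      restore : ∀ {S′ col′ U′} → Progress p v (τ removedₐ) (τ coloursₐ) (τ activeₐ) S′ col′ U′ →
          Progress p v (σ removedₐ) (σ coloursₐ) (σ activeₐ) S′ col′ U′
      restore {S′} {col′} {U′} g =
        subst (λ S → Progress p v S (σ coloursₐ) (σ activeₐ) S′ col′ U′) (frame n search σ removedₐ refl)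
       (subst (λ col → Progress p v (τ removedₐ) col (σ activeₐ) S′ col′ U′) (frame n search σ coloursₐ refl)
       (subst (λ U → Progress p v (τ removedₐ) (τ coloursₐ) U S′ col′ U′) (frame n search σ activeₐ refl) g))
      Φ : Store → Set
      Φ υ = Progress p v (σ removedₐ) (σ coloursₐ) (σ activeₐ) (υ removedₐ) (υ coloursₐ) (υ activeₐ)
      outcome : Searched v (τ radiusₐ 0) (τ activeₐ) (τ levelₐ) (τ parentₐ) (τ parityₐ) (τ foundₐ 0) (τ leftₐ 0)
          (τ rightₐ 0) → Φ (branch (τ foundₐ 0) (sem n remove τ) (sem n colour τ))
      outcome (1≤ρ , ρ≤k , explored , inj₂ (found , mono@(x<n , y<n , lx , ly , _))) =
        branch-elim Φ (τ foundₐ 0)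
          (λ _ → let (change , sum , gone) = remove-correct k τ (environment-frame search σ refl refl refl refl refl env .bound) k≤n
                                              (λ j → proj₁ (ancestor-within j ≤-refl (x<n , <⇒≤ lx)) ,
                                                     proj₁ (ancestor-within j ≤-refl (y<n , <⇒≤ ly))) in
            restore (subst (λ col → Progress p v (τ removedₐ) (τ coloursₐ) (τ activeₐ) (sem n remove τ removedₐ)
                col (sem n remove τ activeₐ))
              (sym (frame n remove τ coloursₐ refl))
              (remove-progress inv′ tree 1≤ρ ρ≤k mono change sum gone)))
          (λ e → ⊥-elim (found e))
        where
        open Explored explored
        open Ancestors tree (≤-trans ρ≤k k≤n)
      outcome (1≤ρ , ρ≤k , explored , inj₁ (none , bichromatic)) =
        branch-elim Φ (τ foundₐ 0) (λ h → ⊥-elim (h none))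
          (λ _ → restore (subst (λ S → Progress p v (τ removedₐ) (τ coloursₐ) (τ activeₐ) S
              (sem n colour τ coloursₐ) (sem n colour τ activeₐ))
            (sym (frame n colour τ removedₐ refl))
            (colour-progress inv′ p<T v<n 1≤ρ ρ≤k explored bichromatic
              (subst (λ p → ∀ x → x < n →
                (τ levelₐ x ≤ τ radiusₐ 0 → sem n colour τ activeₐ x ≡ 0) ×
                    (τ radiusₐ 0 < τ levelₐ x → sem n colour τ activeₐ x ≡ τ activeₐ x) ×
                (τ levelₐ x < τ radiusₐ 0 → sem n colour τ coloursₐ x ≡ p + p + suc (τ parityₐ x)) ×
                    (τ radiusₐ 0 ≤ τ levelₐ x → sem n colour τ coloursₐ x ≡ τ coloursₐ x))
                (cong (λ f → f 0) (frame n search σ phaseₐ refl)) (colour-correct τ)))))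

    refill-correct : ∀ σ x → x < n → sem n refill σ activeₐ x ≡ undone (σ removedₐ) (σ coloursₐ) x
    refill-correct σ = proj₂ (for-each n iₐ refillStep σ (λ τ → τ removedₐ ≡ σ removedₐ × τ coloursₐ ≡ σ coloursₐ)
      (λ x τ → τ activeₐ x ≡ undone (σ removedₐ) (σ coloursₐ) x) refl (λ _ _ k → k) (λ _ _ _ q → q) (refl , refl)
      λ τ _ (h₂ , h₃) → (h₂ , h₃) ,
        trans (put-here (τ activeₐ) (τ iₐ 0) _) (cong₂ (λ S col → undone S col (τ iₐ 0)) h₂ h₃) ,
        λ i _ h → put-elim (λ i u → τ activeₐ i ≡ undone (σ removedₐ) (σ coloursₐ) i →
            u ≡ undone (σ removedₐ) (σ coloursₐ) i) (τ activeₐ) (τ iₐ 0) _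
          (λ _ → cong₂ (λ S col → undone S col (τ iₐ 0)) h₂ h₃) (λ _ _ h → h) i h)

    -- `decay` limits the number of phases that can use colours. The phase loop, however, runs `n`
    -- times, possibly fewer than `T`; `progress` ensures that everything is settled by then.
    record Boundary (p : ℕ) (S col : ℕ → ℕ) : Set where
      field
        removed≤1    : ∀ x → x < n → S x ≤ 1
        removed-few  : ∑ n S ≤ k * 2 * ∑ n (λ x → S x * bad x)
        proper       : ∀ x y → x < n → y < n → S x ≡ 0 → S y ≡ 0 → col x ≢ 0 → col y ≢ 0 →
                       E x y ≢ 0 → col x ≢ col y
        colour≤phase : ∀ x → x < n → col x ≤ p + p
        colour≤T     : ∀ x → x < n → col x ≤ T * 2
        decay        : ∑ n (undone S col) * q ^ p ≤ pred q ^ p * n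
        progress     : ∑ n (undone S col) ≡ 0 ⊎ ∑ n (undone S col) + p ≤ n

    phase-start : ∀ {p S col U} → Boundary p S col → (∀ x → x < n → U x ≡ undone S col x) → Invariant p S col U
    phase-start {p} b fill = record
      { removed≤1     = b.removed≤1
      ; active≤undone = λ x x<n → ≤-reflexive (fill x x<n)
      ; removed-few   = b.removed-few
      ; proper        = b.proper
      ; separated     = λ x y _ y<n _ lt _ → <⇒≱ lt (b.colour≤phase y y<n)
      ; colour≤phase  = λ x x<n → ≤-trans (b.colour≤phase x x<n) (m≤m+n (p + p) 2)
      ; colour≤T      = b.colour≤T
      }
      where module b = Boundary b

    -- With no active vertex left, the potential inequality becomes q·m′ + m ≤ q·m. It gives both m′
    -- ≤ (1 - 1/q)·m and, unless m = 0, m′ < m.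
    phase-end : ∀ {p S col U m} → Invariant p S col U → (∀ x → x < n → U x ≡ 0) →
      q * ∑ n (undone S col) + m ≤ q * m + ∑ n U →
      m * q ^ p ≤ pred q ^ p * n → m ≡ 0 ⊎ m + p ≤ n → Boundary (suc p) S col
    phase-end {p} {S} {col} {U} {m} inv empty potential decay progress = record
      { removed≤1    = inv .removed≤1
      ; removed-few  = inv .removed-few
      ; proper       = inv .proper
      ; colour≤phase = λ x x<n → subst (col x ≤_) (trans (+-comm (p + p) 2) (cong suc (sym (+-suc p p))))
          (inv .colour≤phase x x<n)
      ; colour≤T     = inv .colour≤T
      ; decay        = begin
          m′ * (q * q ^ p)             ≡⟨ *-assoc m′ q (q ^ p) ⟨
          m′ * q * q ^ p               ≤⟨ *-monoˡ-≤ (q ^ p) (subst (_≤ pred q * m) (*-comm q m′) shrink) ⟩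
          pred q * m * q ^ p           ≡⟨ *-assoc (pred q) m (q ^ p) ⟩
          pred q * (m * q ^ p)         ≤⟨ *-monoʳ-≤ (pred q) decay ⟩
          pred q * (pred q ^ p * n)    ≡⟨ *-assoc (pred q) (pred q ^ p) n ⟨
          pred q * pred q ^ p * n      ∎
      ; progress     = advance progress
      }
      where
      open ≤-Reasoning
      m′ = ∑ n (undone S col)
      drop : q * m′ + m ≤ q * m
      drop = subst (q * m′ + m ≤_) (trans
          (cong (q * m +_) (trans (∑-cong n empty) (trans (∑-const n 0) (*-zeroʳ n))))
          (+-identityʳ _)) potential
      shrink : q * m′ ≤ pred q * m
      shrink = +-cancelʳ-≤ m _ _ (subst (q * m′ + m ≤_)
        (trans (cong (_* m) (sym (suc-pred q {{>-nonZero 1≤q}}))) (+-comm m (pred q * m))) drop)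
      vanish : m ≡ 0 → m′ ≡ 0
      vanish e = m*n≡0⇒m≡0 m′ q {{>-nonZero 1≤q}}
        (n≤0⇒n≡0 (subst₂ _≤_ (*-comm q m′) (trans (cong (pred q *_) e) (*-zeroʳ (pred q))) shrink))
      advance : m ≡ 0 ⊎ m + p ≤ n → m′ ≡ 0 ⊎ m′ + suc p ≤ n
      advance (inj₁ e) = inj₁ (vanish e)
      advance (inj₂ le) with m ≟ 0
      ... | yes e   = inj₁ (vanish e)
      ... | no  m≢0 = inj₂ (≤-trans (≤-reflexive (+-suc m′ p)) (≤-trans (+-monoˡ-≤ p m′<m) le))
        where
        m′<m : m′ < m
        m′<m = *-cancelˡ-< q m′ m (<-≤-trans (m<m+n (q * m′) (n≢0⇒n>0 m≢0)) drop)

    -- From phase `T` on, `exhausted` leaves no vertex to activate. Hence every actual carving has p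
    -- < T, and no colour exceeds 2T.
    phase-correct : ∀ p σ → Environment σ → σ phaseₐ 0 ≡ p → Boundary p (σ removedₐ) (σ coloursₐ) →
      let τ = sem n phase σ in Environment τ × Boundary (suc p) (τ removedₐ) (τ coloursₐ)
    phase-correct p σ env h₂₀ boundary =
      finish (for-induction n sourceₐ carveStep σ′ I refl
        (counter 0 (environment-frame refill σ refl refl refl refl refl env) ,
         trans (cong (λ f → f 0) (frame n refill σ phaseₐ refl)) h₂₀ ,
         subst₂ (λ S col → Invariant p S col U) (sym S-kept) (sym col-kept) (phase-start boundary (refill-correct σ)) ,
         (λ _ _ ()) ,
         subst₂ (λ S col → q * ∑ n (undone S col) + m ≤ q * m + ∑ n U) (sym S-kept) (sym col-kept)
           (≤-reflexive (cong (q * m +_) (sym (∑-cong n (refill-correct σ))))) ,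
         λ T≤p x x<n → trans (refill-correct σ x x<n)
             (∑≡0⇒ n (undone (σ removedₐ) (σ coloursₐ)) (exhausted p m T≤p decay) x x<n)) step)
      where
      open Boundary boundary
      σ′ = sem n refill σ
      U = σ′ activeₐ
      m = ∑ n (undone (σ removedₐ) (σ coloursₐ))
      S-kept : σ′ removedₐ ≡ σ removedₐ
      S-kept = frame n refill σ removedₐ refl
      col-kept : σ′ coloursₐ ≡ σ coloursₐ
      col-kept = frame n refill σ coloursₐ refl
      I : ℕ → Store → Set
      I i τ = Environment τ × τ phaseₐ 0 ≡ p × Invariant p (τ removedₐ) (τ coloursₐ) (τ activeₐ) ×
        (∀ x → x < n → x < i → τ activeₐ x ≡ 0) ×
        (q * ∑ n (undone (τ removedₐ) (τ coloursₐ)) + m ≤ q * m + ∑ n (τ activeₐ)) ×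
        (T ≤ p → ∀ x → x < n → τ activeₐ x ≡ 0)
      finish : I n (sem n phase σ) → _
      finish (env , _ , inv , empty , potential , _) =
        env , phase-end inv (λ x x<n → empty x x<n x<n) potential decay progress
      counter : ∀ v {τ} → Environment τ → Environment (update τ sourceₐ 0 v)
      counter v {τ} = environment-frame (sourceₐ [ lit 0 ]≔ lit v) τ refl refl refl refl refl
      step : ∀ i τ → i < n → τ sourceₐ 0 ≡ i → I i τ → I (suc i) (bump sourceₐ (sem n carveStep τ))
      step .(τ sourceₐ 0) τ v<n refl (env , h₂₀ , inv , empty , potential , late) =
        guard-elim n carve τ (λ ρ → I (suc (τ sourceₐ 0)) (bump sourceₐ ρ)) (activeₐ ! $ sourceₐ ∷ [])
          (λ { (av ∷ []) → next (carve-correct p τ env h₂₀ (≰⇒> λ T≤p → av (late T≤p _ v<n)) v<n av inv) })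
          (λ h → counter _ env , h₂₀ , inv ,
            (λ x x<n x≤v → [ empty x x<n , (λ { refl → ¬guard⇒≡0 (activeₐ ! $ sourceₐ) h }) ]′ (m≤n⇒m<n∨m≡n (s≤s⁻¹ x≤v))) ,
            potential , late)
        where
        ρ = sem n carve τ
        next : Progress p (τ sourceₐ 0) (τ removedₐ) (τ coloursₐ) (τ activeₐ) (ρ removedₐ) (ρ coloursₐ)
            (ρ activeₐ) → I (suc (τ sourceₐ 0)) (bump sourceₐ ρ)
        next g = counter _ (environment-frame carve τ refl refl refl refl refl env) ,
          trans (cong (λ f → f 0) (frame n carve τ phaseₐ refl)) h₂₀ ,
          g.invariant ,
          (λ x x<n x≤v → [ (λ x<v → still x x<n (empty x x<n x<v)) , (λ { refl → g.treated }) ]′ (m≤n⇒m<n∨m≡n (s≤s⁻¹ x≤v))) ,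
          accumulate _ _ _ _ g.potential potential ,
          λ T≤p x x<n → still x x<n (late T≤p x x<n)
          where
          module g = Progress g
          still : ∀ x → x < n → τ activeₐ x ≡ 0 → ρ activeₐ x ≡ 0
          still x x<n e = n≤0⇒n≡0 (subst (ρ activeₐ x ≤_) e (g.shrinks x x<n))
          -- Telescoping of the potential inequalities of successive carvings.
          accumulate : ∀ a b c d → a + b ≤ c + d → c + m ≤ q * m + b → a + m ≤ q * m + d
          accumulate a b c d h₁ h₂ = +-cancelʳ-≤ (b + c) _ _ (begin
            a + m + (b + c)          ≡⟨ cong (a + m +_) (+-comm b c) ⟩
            a + m + (c + b)          ≡⟨ exchange a m c b ⟩
            (a + b) + (c + m)        ≤⟨ +-mono-≤ h₁ h₂ ⟩
            (c + d) + (q * m + b)    ≡⟨ +-comm (c + d) _ ⟩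
            (q * m + b) + (c + d)    ≡⟨ cong ((q * m + b) +_) (+-comm c d) ⟩
            (q * m + b) + (d + c)    ≡⟨ interchange (q * m) b d c ⟩
            (q * m + d) + (b + c)    ∎)
            where
            open ≤-Reasoning
            exchange : ∀ a m c b → a + m + (c + b) ≡ (a + b) + (c + m)
            exchange a m c b = trans (cong (a + m +_) (+-comm c b))
                (trans (interchange a m b c) (cong (a + b +_) (+-comm m c)))

    phases-correct : ∀ σ → Environment σ → (∀ x → x < n → σ removedₐ x ≡ 0) → (∀ x → x < n → σ coloursₐ x ≡ 0) →
      let τ = sem n phases σ in
      Boundary n (τ removedₐ) (τ coloursₐ) × (∀ x → x < n → undone (τ removedₐ) (τ coloursₐ) x ≡ 0)
    phases-correct σ env S≡0 col≡0 =
      finish (for-induction n phaseₐ phase σ (λ p τ → Environment τ × Boundary p (τ removedₐ) (τ coloursₐ)) refl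
        (counter 0 env , record
          { removed≤1    = λ x x<n → ≤-trans (≤-reflexive (S≡0 x x<n)) z≤n
          ; removed-few  = subst (_≤ k * 2 * ∑ n (λ x → σ removedₐ x * bad x)) (sym (∑-zero S≡0)) z≤n
          ; proper       = λ x y x<n _ _ _ cx → ⊥-elim (cx (col≡0 x x<n))
          ; colour≤phase = λ x x<n → ≤-reflexive (col≡0 x x<n)
          ; colour≤T     = λ x x<n → ≤-trans (≤-reflexive (col≡0 x x<n)) z≤n
          ; decay        = subst₂ _≤_ (sym (*-identityʳ _)) (sym (+-identityʳ n)) undone≤n
          ; progress     = inj₂ (subst (_≤ n) (sym (+-identityʳ _)) undone≤n)
          })
        λ { p τ _ h₂₀ (env , b) → let (env′ , b′) = phase-correct p τ env h₂₀ b in counter _ env′ , b′ })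
      where
      counter : ∀ v {τ} → Environment τ → Environment (update τ phaseₐ 0 v)
      counter v {τ} = environment-frame (phaseₐ [ lit 0 ]≔ lit v) τ refl refl refl refl refl
      ∑-zero : ∀ {f} → (∀ x → x < n → f x ≡ 0) → ∑ n f ≡ 0
      ∑-zero h = trans (∑-cong n h) (trans (∑-const n 0) (*-zeroʳ n))
      undone≤n : ∑ n (undone (σ removedₐ) (σ coloursₐ)) ≤ n
      undone≤n = subst (∑ n (undone (σ removedₐ) (σ coloursₐ)) ≤_) (trans (∑-const n 1) (*-identityʳ n))
        (∑-mono n λ x _ → ≤-trans (m∸n≤m (1 ∸ σ removedₐ x) (σ coloursₐ x)) (m∸n≤m 1 (σ removedₐ x)))
      finish : Environment (sem n phases σ) × Boundary n (sem n phases σ removedₐ) (sem n phases σ coloursₐ) → _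
      finish (_ , b) = b , ∑≡0⇒ n _ ([ (λ e → e) , (λ h → n≤0⇒n≡0 (+-cancelʳ-≤ n _ 0 h)) ]′ (Boundary.progress b))

  -- Correctness of the whole program.

  record Correct (n a b : ℕ) (E : ℕ → ℕ → ℕ) (bad S col : ℕ → ℕ) (L : ℕ) : Set where
    field
      k q         : ℕ
      k-low       : pred k * a < b
      k-high      : k ≡ n ⊎ b ≤ k * a
      1≤q         : 1 ≤ q
      q-low       : pred q ^ k < n
      removed≤1   : ∀ x → x < n → S x ≤ 1
      removed-few : ∑ n S ≤ k * 2 * ∑ n (λ x → S x * bad x)
      colours     : ∀ x → x < n → col x ≤ q * L * 2
      proper      : ∀ x y → x < n → y < n → S x ≡ 0 → S y ≡ 0 → E x y ≢ 0 → col x ≢ col y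

  algorithm-correct : ∀ {n L bad side} a b σ → 1 ≤ n → n < 2 ^ L → 1 ≤ b →
    σ inputₐ 0 ≡ n → σ inputₐ 1 ≡ a → σ inputₐ 2 ≡ b → (∀ c i → σ (2 + c) i ≡ 0) →
    let E = λ x y → σ adjacencyₐ (x * n + y) in
    (∀ x y → x < n → y < n → E x y ≢ 0 → E y x ≢ 0) → Bipartition n E bad side →
    let τ = sem n algorithm σ in Correct n a b E bad (τ removedₐ) (τ coloursₐ) L
  algorithm-correct {n} {L} {bad} {side} a b σ 1≤n n<2^L 1≤b h₀ ha hb blank E-sym bip = record
    { k = k ; q = q ; k-low = k-low ; k-high = k-high ; 1≤q = 1≤q ; q-low = q-low
    ; removed≤1   = removed≤1
    ; removed-few = removed-few
    ; colours     = colour≤T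
    ; proper      = λ x y x<n y<n Sx Sy → proper x y x<n y<n Sx Sy (coloured x x<n Sx) (coloured y y<n Sy)
    }
    where
    E : ℕ → ℕ → ℕ
    E x y = σ adjacencyₐ (x * n + y)
    τ₁ = sem n offsets σ
    τ₂ = sem n radiusBound τ₁
    τ₃ = sem n thresholds τ₂
    k = τ₂ boundₐ 0
    q = τ₃ growthₐ 0
    initial : ∀ c → assigns c offsets ≡ false → ∀ i → τ₁ c i ≡ σ c i
    initial c h i = cong (λ f → f i) (frame n offsets σ c h)
    radius = radiusBound-correct a b τ₁ (trans (initial inputₐ refl 1) ha) (trans (initial inputₐ refl 2) hb)
      (trans (initial boundₐ refl 0) (blank 3 0)) (trans (initial scratchₐ refl 0) (blank 6 0))
    k-high : k ≡ n ⊎ b ≤ k * a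
    k-high = proj₂ (proj₂ radius)
    k≢0 : k ≢ 0
    k≢0 e = [ (λ k≡n → <⇒≱ 1≤n (≤-reflexive (trans (sym k≡n) e))) ,
              (λ b≤ → <⇒≱ 1≤b (subst (λ z → b ≤ z * a) e b≤)) ]′ k-high
    k-low : pred k * a < b
    k-low = [ (λ e → ⊥-elim (k≢0 e)) , (λ h → h) ]′ (proj₁ (proj₂ radius))
    unset : ∀ c i → assigns c offsets ≡ false → assigns c radiusBound ≡ false → τ₂ c i ≡ σ c i
    unset c i h₁ h₂ = trans (cong (λ f → f i) (frame n radiusBound τ₁ c h₂)) (initial c h₁ i)
    powers = thresholds-correct k τ₂ 1≤n (n≢0⇒n>0 k≢0) (proj₁ radius) (trans (unset inputₐ 0 refl refl) h₀) refl
      (trans (unset growthₐ 0 refl refl) (blank 5 0)) (trans (unset thresholdₐ k refl refl) (blank 4 k))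
    1≤q : 1 ≤ q
    1≤q = proj₁ powers
    q-low : pred q ^ k < n
    q-low = proj₂ (proj₂ (proj₂ powers))
    -- The choice T = q·L is what `few-phases` requires: L halvings, each taking q phases.
    open Correctness n k q (q * L) E bad side (n≢0⇒n>0 k≢0) (proj₁ radius) 1≤q (proj₁ (proj₂ (proj₂ powers)))
      E-sym bip (λ p m → few-phases p m 1≤q n<2^L)
    kept : ∀ c i → assigns c offsets ≡ false → assigns c radiusBound ≡ false → assigns c thresholds ≡ false →
        τ₃ c i ≡ σ c i
    kept c i h₁ h₂ h₃ = trans (cong (λ f → f i) (frame n thresholds τ₂ c h₃)) (unset c i h₁ h₂)
    rows : ∀ x → x < n → τ₃ rowₐ x ≡ x * n
    rows x x<n = trans (cong (λ f → f x) (trans (frame n thresholds τ₂ rowₐ refl) (frame n radiusBound τ₁ rowₐ refl)))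
      (offsets-correct σ h₀ (blank 2 0) x (<⇒≤ x<n))
    environment : Environment τ₃
    environment = record
      { order     = trans (kept inputₐ 0 refl refl refl) h₀
      ; adjacency = λ x y x<n y<n → trans (kept adjacencyₐ _ refl refl refl)
          (cong (λ z → σ adjacencyₐ (z + y)) (rows x x<n))
      ; bound     = cong (λ f → f 0) (frame n thresholds τ₂ boundₐ refl)
      ; threshold = proj₁ (proj₂ powers)
      }
    outcome = phases-correct τ₃ environment (λ x _ → trans (kept removedₐ x refl refl refl) (blank 0 x))
      (λ x _ → trans (kept coloursₐ x refl refl refl) (blank 1 x))
    open Boundary (proj₁ outcome)
    coloured : ∀ x → x < n → sem n phases τ₃ removedₐ x ≡ 0 → sem n phases τ₃ coloursₐ x ≢ 0
    coloured x x<n Sx cx = 0≢1+n (trans (sym (proj₂ outcome x x<n)) (cong₂ (λ s c → 1 ∸ s ∸ c) Sx cx))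

  -- From graphs and subsets to functions on ℕ, and back.

  extend : ∀ {n} → (Fin n → ℕ) → ℕ → ℕ
  extend {n} f x with x <? n
  ... | yes x<n = f (fromℕ< x<n)
  ... | no  _   = 0

  extend-toℕ : ∀ {n} (f : Fin n → ℕ) v → extend f (toℕ v) ≡ f v
  extend-toℕ {n} f v with toℕ v <? n
  ... | yes v<n = cong f (fromℕ<-toℕ v v<n)
  ... | no  v≮n = ⊥-elim (v≮n (toℕ<n v))

  from-Fin : ∀ {n} (P : ℕ → Set) → (∀ v → P (toℕ {n} v)) → ∀ x → x < n → P x
  from-Fin P h x x<n = subst P (toℕ-fromℕ< x<n) (h (fromℕ< x<n))

  ∑-front : ∀ n f → ∑ (suc n) f ≡ f 0 + ∑ n (λ i → f (suc i))
  ∑-front zero    f = sym (+-identityʳ (f 0))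
  ∑-front (suc n) f = trans (cong (_+ f (suc n)) (∑-front n f)) (+-assoc (f 0) _ _)

  ∣p∣≡∑ : ∀ {n} (p : Subset n) f → (∀ v → f (toℕ v) ≡ bit (lookup p v)) → ∣ p ∣ ≡ ∑ n f
  ∣p∣≡∑ []              f h = refl
  ∣p∣≡∑ {suc n} (b ∷ p) f h = trans (size b)
      (trans (cong₂ _+_ (sym (h zero)) (∣p∣≡∑ p (λ i → f (suc i)) (λ v → h (suc v)))) (sym (∑-front n f)))
    where
    size : ∀ b → ∣ b ∷ p ∣ ≡ bit b + ∣ p ∣
    size true  = refl
    size false = refl

  adjacencyCell-correct : ∀ {n} (G : Graph n) u v →
    adjacencyCell G (toℕ u * n + toℕ v) ≡ bit (Graph.adj G u v)
  adjacencyCell-correct {n} G u v = trans (cong (adjacencyCell G) index) cell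
    where
    index : toℕ u * n + toℕ v ≡ toℕ (combine u v)
    index = trans (cong (_+ toℕ v) (*-comm (toℕ u) n)) (sym (toℕ-combine u v))
    cell : adjacencyCell G (toℕ (combine u v)) ≡ bit (Graph.adj G u v)
    cell with toℕ (combine u v) <? n * n
    ... | yes i<n² = cong (λ uv → bit (uncurry (Graph.adj G) uv))
                       (trans (cong (remQuot n) (fromℕ<-toℕ (combine u v) i<n²)) (remQuot-combine u v))
    ... | no  i≮n² = ⊥-elim (i≮n² (toℕ<n (combine u v)))

  bit≢0⇒T : ∀ {b} → bit b ≢ 0 → T b
  bit≢0⇒T {true}  h = tt
  bit≢0⇒T {false} h = h refl

  T⇒bit≢0 : ∀ {b} → T b → bit b ≢ 0
  T⇒bit≢0 {true} _ ()

  -- The exponent is the nesting depth of the loops. The input size is at least n + 1: n² ≥ n matrix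
  -- cells, and at least one bit for `n`.
  polynomial-time : RunsInPolynomialTime (compile algorithm)
  polynomial-time = weight algorithm , depth algorithm , run
    where
    run : ∀ {n} (G : Graph n) (γ : ℚ.ℚ) .{{_ : ℚ.Positive γ}} → _
    run {n} G γ =
      let (t , r , t≤) = execution n algorithm (encode G γ) refl refl refl in
      _ , t , r , ≤-trans t≤ (≤-trans (cost-bound n algorithm)
        (*-monoʳ-≤ (weight algorithm) (^-monoˡ-≤ (depth algorithm) n<size)))
      where
      a = ℤ.∣ ℚ.↥ γ ∣
      b = ℚ.↧ₙ γ
      n<size : suc n ≤ inputSize n γ
      n<size = begin
        suc n                                          ≤⟨ s≤s (m≤m*m n) ⟩
        suc (n * n)                                    ≡⟨ +-comm 1 (n * n) ⟩
        n * n + 1                                      ≤⟨ +-monoʳ-≤ (n * n) (s≤s z≤n) ⟩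
        n * n + bitLength n                            ≤⟨ m≤m+n _ (bitLength a) ⟩
        n * n + bitLength n + bitLength a              ≤⟨ m≤m+n _ (bitLength b) ⟩
        inputSize n γ                                  ∎
        where
        open ≤-Reasoning
        m≤m*m : ∀ m → m ≤ m * m
        m≤m*m zero    = z≤n
        m≤m*m (suc m) = m≤m*n (suc m) (suc m)

  module Output {n} (G : Graph n) (γ : ℚ.ℚ) (1≤n : 1 ≤ n) (Good : Subset n) (c : Fin n → ℕ)
    (good : IsProperColoring G Good 2 c) where

    E : ℕ → ℕ → ℕ
    E x y = encode G γ 1 (x * n + y)

    bad side : ℕ → ℕ
    bad  = extend (λ v → bit (lookup (∁ Good) v))
    side = extend c

    edge-bit : ∀ u v → E (toℕ u) (toℕ v) ≡ bit (Graph.adj G u v)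
    edge-bit = adjacencyCell-correct G

    E-sym : ∀ x y → x < n → y < n → E x y ≢ 0 → E y x ≢ 0
    E-sym x y x<n y<n = from-Fin (λ x → E x y ≢ 0 → E y x ≢ 0) (λ u →
      from-Fin (λ y → E (toℕ u) y ≢ 0 → E y (toℕ u) ≢ 0) (λ v h e → h (begin
        E (toℕ u) (toℕ v)         ≡⟨ edge-bit u v ⟩
        bit (Graph.adj G u v)     ≡⟨ cong bit (Graph.symmetric G u v) ⟩
        bit (Graph.adj G v u)     ≡⟨ edge-bit v u ⟨
        E (toℕ v) (toℕ u)         ≡⟨ e ⟩
        0                         ∎)) y y<n) x x<n
      where open ≡-Reasoning

    good-vertex : ∀ v → bad (toℕ v) ≡ 0 → v ∈ Good
    good-vertex v e = lookup⇒[]= v Good (not-bad (lookup Good v)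
      (trans (cong bit (sym (lookup-map v not Good))) (trans (sym (extend-toℕ (λ v → bit (lookup (∁ Good) v)) v)) e)))
      where
      not-bad : ∀ b → bit (not b) ≡ 0 → b ≡ true
      not-bad true  _ = refl

    bipartition : Bipartition n E bad side
    bipartition = record
      { binary = from-Fin (λ x → bad x ≡ 0 → side x < 2) λ v h →
          subst (_< 2) (sym (extend-toℕ c v)) (proj₁ good v (good-vertex v h))
      ; proper = λ x y x<n y<n → from-Fin (λ x → bad x ≡ 0 → bad y ≡ 0 → E x y ≢ 0 → side x ≢ side y) (λ u →
          from-Fin (λ y → bad (toℕ u) ≡ 0 → bad y ≡ 0 → E (toℕ u) y ≢ 0 → side (toℕ u) ≢ side y) (λ v bu bv Euv e →
            proj₂ good u v (good-vertex u bu) (good-vertex v bv)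
              (bit≢0⇒T (subst (_≢ 0) (edge-bit u v) Euv))
              (trans (sym (extend-toℕ c u)) (trans e (extend-toℕ c v)))) y y<n) x x<n
      }

    final : Store
    final = sem n algorithm (encode G γ)

    correct : Correct n ℤ.∣ ℚ.↥ γ ∣ (ℚ.↧ₙ γ) E bad (final removedₐ) (final coloursₐ) (suc ⌊log₂ n ⌋)
    correct = algorithm-correct ℤ.∣ ℚ.↥ γ ∣ (ℚ.↧ₙ γ) (encode G γ) 1≤n (n<2^[1+⌊log₂n⌋] n) (s≤s z≤n)
      refl refl refl (λ _ _ → refl) E-sym bipartition

    open Correct correct public

    removed : Subset n
    removed = tabulate (λ v → 0 <ᵇ final removedₐ (toℕ v))

    removed-bit : ∀ v → final removedₐ (toℕ v) ≡ bit (lookup removed v)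
    removed-bit v = trans (binary (removed≤1 (toℕ v) (toℕ<n v))) (cong bit (sym (lookup∘tabulate _ v)))
      where
      binary : ∀ {m} → m ≤ 1 → m ≡ bit (0 <ᵇ m)
      binary z≤n       = refl
      binary (s≤s z≤n) = refl

    colouring : Fin n → ℕ
    colouring v = final coloursₐ (toℕ v)

    outputs : Outputs (compile algorithm) G γ removed colouring
    outputs = let (t , r , _) = execution n algorithm (encode G γ) refl refl refl in
      final , t , r , removed-bit , λ _ → refl

    kept : ∀ v → v ∈ ∁ removed → final removedₐ (toℕ v) ≡ 0
    kept v v∈ = trans (removed-bit v)
        (not-removed (lookup removed v) (trans (sym (lookup-map v not removed)) ([]=⇒lookup v∈)))
      where
      not-removed : ∀ b → not b ≡ true → bit b ≡ 0
      not-removed false _ = refl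

    -- The number of colours is 2qL + 1 because the palette also counts the value 0, which marks
    -- uncoloured vertices.
    proper-colouring : IsProperColoring G (∁ removed) (suc (q * suc ⌊log₂ n ⌋ * 2)) colouring
    proper-colouring = (λ v _ → s≤s (colours (toℕ v) (toℕ<n v))) , λ u v u∈ v∈ uv →
      proper (toℕ u) (toℕ v) (toℕ<n u) (toℕ<n v) (kept u u∈) (kept v v∈)
        (subst (_≢ 0) (sym (edge-bit u v)) (T⇒bit≢0 uv))

    removed-size : ∣ removed ∣ ≤ k * 2 * ∣ ∁ Good ∣
    removed-size = begin
      ∣ removed ∣                                     ≡⟨ ∣p∣≡∑ removed (final removedₐ) removed-bit ⟩
      ∑ n (final removedₐ)                                   ≤⟨ removed-few ⟩
      k * 2 * ∑ n (λ x → final removedₐ x * bad x)           ≤⟨ *-monoʳ-≤ (k * 2)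
          (∑-mono n λ x x<n → ≤-trans (*-monoˡ-≤ (bad x) (removed≤1 x x<n))
          (≤-reflexive (*-identityˡ (bad x)))) ⟩
      k * 2 * ∑ n bad                                 ≡⟨ cong (k * 2 *_) (∣p∣≡∑ (∁ Good) bad (extend-toℕ _)) ⟨
      k * 2 * ∣ ∁ Good ∣                              ∎
      where open ≤-Reasoning

    palette : suc (q * suc ⌊log₂ n ⌋ * 2) ≤ 6 * suc ⌊log₂ n ⌋ ^ 1 · n ^ (fromℕ 2 ℚ.* γ)
    palette = palette-bound {n} {q} {suc ⌊log₂ n ⌋} {ℤ.∣ ℚ.↥ δ ∣} {ℚ.↧ₙ δ} 1≤q (s≤s z≤n)
      (ratio-bound {n} {k} {q} {ℤ.∣ ℚ.↥ γ ∣} {ℚ.↧ₙ γ} {ℤ.∣ ℚ.↥ δ ∣} {ℚ.↧ₙ δ} 1≤n (s≤s z≤n) 1≤q q-low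
          (double-ratio γ) k-high)
      where
      δ = fromℕ 2 ℚ.* γ

    good+bad : ∣ Good ∣ + ∣ ∁ Good ∣ ≡ n
    good+bad = trans (cong (∣ Good ∣ +_) (∣∁p∣≡n∸∣p∣ Good)) (m+[n∸m]≡n (∣p∣≤n Good))

-- Assembly, with the constants 6 and 1 in the colour bound.

open import Data.Fin.Subset using (∁; ∣_∣)
open import Data.Integer using (+_)
open import Data.Nat using (ℕ; zero; suc; z≤n; s≤s) renaming (_*_ to _*ℕ_; _^_ to _^ℕ_)
open import Data.Nat.Logarithm using (⌊log₂_⌋)
open import Data.Product using (_×_; _,_; ∃-syntax)
open import Data.Rational using (ℚ; 0ℚ; 1ℚ; Positive; _≤_; _-_; _*_; _÷_; _/_)
open import Data.Rational.Properties using (pos⇒nonZero; *-zeroʳ; ≤-reflexive)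
open import Data.Vec using ([])
open import Relation.Binary.PropositionalEquality using (refl; sym)
open Algorithm using (algorithm; polynomial-time; module Output)
open Language using (compile; execution)
open Rationals using (removed-bound)

proposition1p4 : ∃[ P ] RunsInPolynomialTime P ×
    (∃[ A ] ∃[ d ]
    (∀ {n : ℕ} (G : Graph n) (ε γ : ℚ) .{{γ>0 : Positive γ}} →
    0ℚ ≤ ε → ε ≤ γ → γ ≤ + 1 / 100 →
    PartiallyColorable (1ℚ - ε) 2 G →
    ∃[ S ] ∃[ c ] Outputs P G γ S c ×
    (fromℕ ∣ S ∣ ≤ (_÷_ (fromℕ 4 * ε) γ {{pos⇒nonZero γ}}) * fromℕ n) ×
    (∃[ k ]
    (k ≤ A *ℕ (suc ⌊log₂ n ⌋ ^ℕ d) · n ^ (fromℕ 2 * γ)) ×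
    IsProperColoring G (∁ S) k c)))
proposition1p4 = compile algorithm , polynomial-time , 6 , 1 , solve
  where
  solve : ∀ {n : ℕ} (G : Graph n) (ε γ : ℚ) .{{γ>0 : Positive γ}} →
    0ℚ ≤ ε → ε ≤ γ → γ ≤ + 1 / 100 →
    PartiallyColorable (1ℚ - ε) 2 G →
    ∃[ S ] ∃[ c ] Outputs (compile algorithm) G γ S c ×
    (fromℕ ∣ S ∣ ≤ (_÷_ (fromℕ 4 * ε) γ {{pos⇒nonZero γ}}) * fromℕ n) ×
    (∃[ k ]
    (k ≤ 6 *ℕ (suc ⌊log₂ n ⌋ ^ℕ 1) · n ^ (fromℕ 2 * γ)) ×
    IsProperColoring G (∁ S) k c)
  -- The empty graph is apart because the analysis needs 1 ≤ k ≤ n. The empty set and zero colours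
  -- serve.
  solve {zero} G ε γ 0≤ε ε≤γ γ≤ _ =
    let (t , r , _) = execution 0 algorithm (encode G γ) refl refl refl in
    [] , (λ ()) , (_ , t , r , (λ ()) , (λ ())) ,
    ≤-reflexive (sym (*-zeroʳ (_÷_ (fromℕ 4 * ε) γ {{pos⇒nonZero γ}}))) ,
    0 , z≤n , (λ ()) , (λ ())
  solve {suc m} G ε γ 0≤ε ε≤γ γ≤ (Good , large , c , good) =
    removed , colouring , outputs ,
    removed-bound (suc m) (∣ Good ∣) (∣ ∁ Good ∣) (∣ removed ∣) k ε γ γ≤ k-low removed-size good+bad large ,
    _ , palette , proper-colouring
    where
    open Output G γ (s≤s z≤n) Good c good
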